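{- There is a set $C\subseteq\omega$ that is $\mathrm{REA}[\omega]$ and not computable such that every set $B$ with $B\le_T C$ and $B\le_T \emptyset'$ is computable. (That is, $C$ and $\emptyset'$ form a minimal pair: $\deg(C)\wedge\deg(\emptyset')=\mathbf{0}$.)
   Context: Fix a pairing function $\langle\cdot,\cdot\rangle:\omega^2\to\omega$. For $X\subseteq\omega$, the $n$-th column is $X^{[n]}=\{y:\langle n,y\rangle\in X\}$ and $X^{[<n]}=\{\langle m,y\rangle\in X: m<n\}$ (with $X^{[<0]}=\emptyset$). $W_e^Z$ denotes the $e$-th set computably enumerable relative to $Z$. A set $C\subseteq\omega$ is $\mathrm{REA}[\omega]$ iff there is a computable function $f$ such that for every $n$, $C^{[n]}=W^{C^{[<n]}}_{f(n)}$. $\emptyset'$ is the halting set. -}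

module Defs where

open import Data.Nat using (ℕ; zero; suc; _+_; _*_; _<_; ⌊_/2⌋)
open import Data.Bool using (Bool; true; false; if_then_else_)
open import Data.Product using (Σ; _×_; _,_; proj₁; proj₂)
open import Relation.Binary.PropositionalEquality using (_≡_)
open import Relation.Nullary using (¬_)

_∈_ : ℕ → (ℕ → Bool) → Set
x ∈ X = X x ≡ true

-- The fixed pairing function: Cantor pairing
--   ⟨x , y⟩ = (x+y)(x+y+1)/2 + y
-- and its inverse, computed by walking along the diagonals.

pair : ℕ → ℕ → ℕ
pair x y = ⌊ (x + y) * suc (x + y) /2⌋ + y

private
  step : ℕ × ℕ → ℕ × ℕ
  step (zero , y)  = (suc y , 0)
  step (suc x , y) = (x , suc y)

unpair : ℕ → ℕ × ℕ
unpair zero    = (0 , 0)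
unpair (suc z) = step (unpair z)

column : (ℕ → Bool) → ℕ → (ℕ → Bool)
column X n y = X (pair n y)

_<ᵇ_ : ℕ → ℕ → Bool
zero  <ᵇ zero  = false
zero  <ᵇ suc _ = true
suc _ <ᵇ zero  = false
suc m <ᵇ suc n = m <ᵇ n

columnsBelow : (ℕ → Bool) → ℕ → (ℕ → Bool)
columnsBelow X n z = if proj₁ (unpair z) <ᵇ n then X z else false

-- Oracle partial recursive functions (unary, with pairing).

data Code : Set where
  Zero Succ Id Left Right Oracle : Code
  Comp : Code → Code → Code
  Pair : Code → Code → Code
  Prec : Code → Code → Code
  Mu   : Code → Code

data Eval (X : ℕ → Bool) : Code → ℕ → ℕ → Set where
  ezero  : ∀ {x} → Eval X Zero x 0
  esucc  : ∀ {x} → Eval X Succ x (suc x)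
  eid    : ∀ {x} → Eval X Id x x
  eleft  : ∀ {x} → Eval X Left x (proj₁ (unpair x))
  eright : ∀ {x} → Eval X Right x (proj₂ (unpair x))
  eorc   : ∀ {x} → Eval X Oracle x (if X x then 1 else 0)
  ecomp  : ∀ {f g x y z} → Eval X g x y → Eval X f y z → Eval X (Comp f g) x z
  epair  : ∀ {f g x a b} → Eval X f x a → Eval X g x b → Eval X (Pair f g) x (pair a b)
  eprec0 : ∀ {f g x a y} → unpair x ≡ (a , 0) → Eval X f a y → Eval X (Prec f g) x y
  eprecS : ∀ {f g x a n v y} → unpair x ≡ (a , suc n) →
           Eval X (Prec f g) (pair a n) v →
           Eval X g (pair (pair a n) v) y → Eval X (Prec f g) x y
  emu    : ∀ {f x n} → Eval X f (pair x n) 0 →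
           (∀ m → m < n → Σ ℕ λ v → Eval X f (pair x m) (suc v)) →
           Eval X (Mu f) x n

-- Gödel numbering: index e ↦ code.  e = ⟨t , r⟩ with tag t.
-- (Components of unpair z are ≤ z, so fuel z+1 suffices.)

private
  decodeF : ℕ → ℕ → Code
  tagged  : ℕ → ℕ → ℕ → Code
  decodeF zero    _ = Zero
  decodeF (suc k) z = tagged k (proj₁ (unpair z)) (proj₂ (unpair z))
  tagged k 0 r = Zero
  tagged k 1 r = Succ
  tagged k 2 r = Id
  tagged k 3 r = Left
  tagged k 4 r = Right
  tagged k 5 r = Oracle
  tagged k 6 r = Comp (decodeF k (proj₁ (unpair r))) (decodeF k (proj₂ (unpair r)))
  tagged k 7 r = Pair (decodeF k (proj₁ (unpair r))) (decodeF k (proj₂ (unpair r)))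
  tagged k 8 r = Prec (decodeF k (proj₁ (unpair r))) (decodeF k (proj₂ (unpair r)))
  tagged k 9 r = Mu (decodeF k r)
  tagged k _ r = Zero

decode : ℕ → Code
decode e = decodeF (suc e) e

Φ : ℕ → (ℕ → Bool) → ℕ → ℕ → Set
Φ e X x y = Eval X (decode e) x y

∅ : ℕ → Bool
∅ _ = false

χ : (ℕ → Bool) → ℕ → ℕ
χ B x = if B x then 1 else 0

_≤T_ : (ℕ → Bool) → (ℕ → Bool) → Set
B ≤T A = Σ ℕ λ e → ∀ x → Φ e A x (χ B x)

Computable : (ℕ → Bool) → Set
Computable B = B ≤T ∅

ComputableFn : (ℕ → ℕ) → Set
ComputableFn f = Σ ℕ λ e → ∀ x → Φ e ∅ x (f x)

W : ℕ → (ℕ → Bool) → ℕ → Set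
W e Z x = Σ ℕ λ y → Φ e Z x y

HaltingSet : ℕ → Set
HaltingSet e = W e ∅ e

IsHaltingSet : (ℕ → Bool) → Set
IsHaltingSet K = ∀ e → (e ∈ K → HaltingSet e) × (HaltingSet e → e ∈ K)

REAω : (ℕ → Bool) → Set
REAω C = Σ (ℕ → ℕ) λ f → ComputableFn f ×
  (∀ n y → (y ∈ column C n → W (f n) (columnsBelow C n) y)
         × (W (f n) (columnsBelow C n) y → y ∈ column C n))

{-# OPTIONS --safe #-}
module Submission where

-- Requirement i = ⟨ e , k ⟩ asks: if Φ_e^C = B = Φ_k^K, then B is computable. Reading the true contents of
-- the earlier columns, it looks for a string τ that C can still extend and an input X such that Φ_e^τ(X)
-- differs from the current approximation to Φ_k^K(X). Whenever the least such candidate changes, or there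
-- is none, column 2i grows. Hence column 2i is finite exactly if some candidate is final; in that case the
-- number |τ| is put into column 2i+1, which is c.e. in column 2i. Later columns see this marker once they
-- have read past position |τ|, recover τ and copy it. What they enumerated before lies in τ anyway,
-- because only strings closed under the enumeration are admitted. So C extends τ, and Φ_e^C(X) ≠ B(X).
-- If no candidate is final, then column 2i is cofinite and column 2i+1 is finite, and every string
-- compatible with this outcome computes via Φ_e only correct values of B. Such strings can be searched for
-- effectively, since all columns below 2i are eventually constant; so B is computable.
-- Finally, C is not computable: otherwise take Φ_e to be the identity and B = C, and note that there are
-- two compatible strings which differ at one position.

open import Defs
open import Data.Nat using (ℕ; zero; suc; _+_; _*_; _∸_; _≤_; _<_; z≤n; s≤s; pred; _≡ᵇ_; _⊔_; ⌊_/2⌋; _≟_)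
open import Data.Nat.Properties hiding (_≟_)
open import Data.Nat.Induction using (<-rec)
open import Data.Bool using (Bool; true; false; if_then_else_; _∧_; _∨_; not)
open import Data.List using (List; []; _∷_; _++_)
open import Data.Product using (Σ; _×_; _,_; proj₁; proj₂)
open import Data.Sum using (_⊎_; inj₁; inj₂)
open import Data.Empty using (⊥; ⊥-elim)
open import Relation.Binary.Definitions using (tri<; tri≈; tri>)
open import Relation.Binary.PropositionalEquality
open import Relation.Nullary using (¬_; Dec; yes; no; does)

-- Cantor pairing

-- All tests are total and act on finite strings: stage `s` reads only positions below `s`, so
-- positions, lengths and stages share one scale, and a marker at `p` becomes visible at stage
-- `p + 1`. A computation is a list of facts that a bounded test can check, so that having a
-- computation from a string oracle is a decidable property of numbers. The delicate point is a
-- circle: a candidate string must be closed under the enumeration into later columns, and that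
-- enumeration consults candidates computed from this very string. No recursion theorem is needed. A
-- candidate is considered only at stages far beyond its code, so every call has a smaller code, and
-- course-of-values recursion yields one computable function. The set C enters the verification only
-- as a fixed point of the enumeration. Which columns are finite cannot be decided effectively.
-- Excluded middle settles the outcomes, and the algorithm for B has finitely many of these facts
-- built in.

tri : ℕ → ℕ
tri n = ⌊ n * suc n /2⌋

half-+ : ∀ a b → ⌊ a + (b + b) /2⌋ ≡ ⌊ a /2⌋ + b
half-+ a zero = trans (cong ⌊_/2⌋ (+-identityʳ a)) (sym (+-identityʳ _))
half-+ a (suc b) = trans (cong ⌊_/2⌋ lem) (trans (cong suc (half-+ a b)) (sym (+-suc _ b)))
  where
  lem : a + suc (b + suc b) ≡ suc (suc (a + (b + b)))
  lem = trans (+-suc a _) (cong suc (trans (cong (a +_) (+-suc b b)) (+-suc a _)))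

tri-suc : ∀ n → tri (suc n) ≡ tri n + suc n
tri-suc n = trans (cong ⌊_/2⌋ lem) (half-+ (n * suc n) (suc n))
  where
  open ≡-Reasoning
  lem : suc n * suc (suc n) ≡ n * suc n + (suc n + suc n)
  lem = begin
    suc n * suc (suc n)           ≡⟨ *-suc (suc n) (suc n) ⟩
    suc n + (suc n + n * suc n)   ≡⟨ sym (+-assoc (suc n) (suc n) _) ⟩
    (suc n + suc n) + n * suc n   ≡⟨ +-comm (suc n + suc n) _ ⟩
    n * suc n + (suc n + suc n)   ∎

n≤tri : ∀ n → n ≤ tri n
n≤tri zero = z≤n
n≤tri (suc n) = subst (suc n ≤_) (sym (tri-suc n)) (m≤n+m (suc n) (tri n))

tri-mono : ∀ {m n} → m ≤ n → tri m ≤ tri n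
tri-mono {m} {n} p = ⌊n/2⌋-mono (*-mono-≤ p (s≤s p))

-- The walk behind `unpair` has two kinds of move, to the start of the next diagonal and along a
-- diagonal. This equation follows the first kind, `pair-diag` the second.
pair-up : ∀ y → pair (suc y) 0 ≡ suc (pair 0 y)
pair-up y = trans (+-identityʳ _) (trans (cong tri (+-identityʳ (suc y))) (trans (tri-suc y) (+-suc (tri y) y)))

pair-diag : ∀ x y → pair x (suc y) ≡ suc (pair (suc x) y)
pair-diag x y = trans (+-suc _ y) (cong (λ k → suc (tri k + y)) (+-suc x y))

unpair-pair : ∀ x y → unpair (pair x y) ≡ (x , y)
unpair-pair x y = go (x + y) y x refl
  where
  up : ∀ {w m} → unpair w ≡ (0 , m) → unpair (suc w) ≡ (suc m , 0)
  up e rewrite e = refl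
  down : ∀ {w a b} → unpair w ≡ (suc a , b) → unpair (suc w) ≡ (a , suc b)
  down e rewrite e = refl
  go : ∀ n y x → x + y ≡ n → unpair (pair x y) ≡ (x , y)
  go zero zero zero _ = refl
  go (suc n) zero zero ()
  go zero zero (suc x) ()
  go (suc n) zero (suc x) eq = trans (cong unpair (pair-up x)) (up {pair 0 x} (go n x 0 (trans (sym (+-identityʳ x)) (suc-injective eq))))
  go n (suc y) x eq = trans (cong unpair (pair-diag x y)) (down {pair (suc x) y} (go n y (suc x) (trans (sym (+-suc x y)) eq)))

raw-surj : ∀ z → pair (proj₁ (unpair z)) (proj₂ (unpair z)) ≡ z
raw-surj zero = refl
raw-surj (suc z) with unpair z | raw-surj z
... | zero , y | ih = trans (pair-up y) (cong suc ih)
... | suc x , y | ih = trans (pair-diag x y) (cong suc ih)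

-- Opaque copies of the pairing, so that unification treats them as rigid.
infix 8 ⟪_,_⟫
abstract
  ⟪_,_⟫ : ℕ → ℕ → ℕ
  ⟪ x , y ⟫ = pair x y

  fst snd : ℕ → ℕ
  fst z = proj₁ (unpair z)
  snd z = proj₂ (unpair z)

  ⟪⟫-def : ∀ x y → ⟪ x , y ⟫ ≡ pair x y
  ⟪⟫-def x y = refl

  unpair-def : ∀ z → unpair z ≡ (fst z , snd z)
  unpair-def z = refl

  fst-pair : ∀ x y → fst ⟪ x , y ⟫ ≡ x
  fst-pair x y = cong proj₁ (unpair-pair x y)

  snd-pair : ∀ x y → snd ⟪ x , y ⟫ ≡ y
  snd-pair x y = cong proj₂ (unpair-pair x y)

  pair-fs : ∀ z → ⟪ fst z , snd z ⟫ ≡ z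
  pair-fs z = raw-surj z

  sum≤pair : ∀ x y → x + y ≤ ⟪ x , y ⟫
  sum≤pair x y = ≤-trans (n≤tri (x + y)) (m≤m+n _ y)

  y≤pair : ∀ x y → y ≤ ⟪ x , y ⟫
  y≤pair x y = m≤n+m y _

  pair-mono : ∀ {a b c d} → a ≤ c → b ≤ d → ⟪ a , b ⟫ ≤ ⟪ c , d ⟫
  pair-mono {a} {b} {c} {d} p q = +-mono-≤ (tri-mono {a + b} {c + d} (+-mono-≤ p q)) q

  -- Diagonals are consecutive intervals, so the sum of the coordinates alone decides. The recursion
  -- that defines the candidates descends along this comparison.
  pair-sum< : ∀ {a b c d} → a + b < c + d → ⟪ a , b ⟫ < ⟪ c , d ⟫
  pair-sum< {a} {b} {c} {d} p = ≤-trans (s≤s (+-monoʳ-≤ (tri (a + b)) (m≤n+m b a)))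
    (≤-trans (≤-reflexive (sym (trans (tri-suc (a + b)) (+-suc _ _)))) (≤-trans (tri-mono p) (m≤m+n _ d)))

  pair-shift : ∀ x y → ⟪ x , y ⟫ ≡ ⟪ x + y , 0 ⟫ + y
  pair-shift x y = cong (_+ y) (sym (trans (+-identityʳ _) (cong tri (+-identityʳ (x + y)))))

x≤pair : ∀ x y → x ≤ ⟪ x , y ⟫
x≤pair x y = ≤-trans (m≤m+n x y) (sum≤pair x y)

fst≤ : ∀ z → fst z ≤ z
fst≤ z = subst (fst z ≤_) (pair-fs z) (x≤pair _ _)

snd≤ : ∀ z → snd z ≤ z
snd≤ z = subst (snd z ≤_) (pair-fs z) (y≤pair _ _)

-- Boolean tests

b2n : Bool → ℕ
b2n b = if b then 1 else 0

eq-sound : ∀ m n → (m ≡ᵇ n) ≡ true → m ≡ n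
eq-sound zero zero _ = refl
eq-sound (suc m) (suc n) p = cong suc (eq-sound m n p)

eq-refl : ∀ m → (m ≡ᵇ m) ≡ true
eq-refl zero = refl
eq-refl (suc m) = eq-refl m

eq-complete : ∀ {m n} → m ≡ n → (m ≡ᵇ n) ≡ true
eq-complete {m} refl = eq-refl m

lt-sound : ∀ m n → (m <ᵇ n) ≡ true → m < n
lt-sound zero (suc n) _ = s≤s z≤n
lt-sound (suc m) (suc n) p = s≤s (lt-sound m n p)

lt-complete : ∀ {m n} → m < n → (m <ᵇ n) ≡ true
lt-complete {zero} (s≤s _) = refl
lt-complete {suc m} (s≤s p) = lt-complete p

clash : ∀ {b} {A : Set} → b ≡ true → b ≡ false → A
clash refl ()

≢true⇒false : ∀ {b} → ¬ (b ≡ true) → b ≡ false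
≢true⇒false {true} p = ⊥-elim (p refl)
≢true⇒false {false} _ = refl

bool-iff : ∀ {a b} → (a ≡ true → b ≡ true) → (b ≡ true → a ≡ true) → a ≡ b
bool-iff {true} {true} _ _ = refl
bool-iff {true} {false} f _ = sym (f refl)
bool-iff {false} {true} _ g = g refl
bool-iff {false} {false} _ _ = refl

∧-l : ∀ {a b} → (a ∧ b) ≡ true → a ≡ true
∧-l {true} _ = refl

∧-r : ∀ {a b} → (a ∧ b) ≡ true → b ≡ true
∧-r {true} p = p

∧-i : ∀ {a b} → a ≡ true → b ≡ true → (a ∧ b) ≡ true
∧-i refl q = q

∧-map : ∀ a {b c} → (b ≡ true → c ≡ true) → (a ∧ b) ≡ true → (a ∧ c) ≡ true
∧-map true f p = f p

∨-e : ∀ {a b} → (a ∨ b) ≡ true → a ≡ true ⊎ b ≡ true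
∨-e {true} _ = inj₁ refl
∨-e {false} p = inj₂ p

∨-l : ∀ {a} b → a ≡ true → (a ∨ b) ≡ true
∨-l b refl = refl

∨-r : ∀ a {b} → b ≡ true → (a ∨ b) ≡ true
∨-r true _ = refl
∨-r false p = p

not-t : ∀ {a} → not a ≡ true → a ≡ false
not-t {false} _ = refl

not-f : ∀ {a} → a ≡ false → not a ≡ true
not-f refl = refl

infixr 4 _⇒_
_⇒_ : Bool → Bool → Bool
a ⇒ b = not a ∨ b

⇒-e : ∀ {a b} → (a ⇒ b) ≡ true → a ≡ true → b ≡ true
⇒-e p refl = p

⇒-i : ∀ {a b} → (a ≡ true → b ≡ true) → (a ⇒ b) ≡ true
⇒-i {true} f = f refl
⇒-i {false} _ = refl

infix 5 _==_
_==_ : Bool → Bool → Bool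
true == b = b
false == b = not b

==-sound : ∀ a b → (a == b) ≡ true → a ≡ b
==-sound true true _ = refl
==-sound false false _ = refl

==-complete : ∀ {a b} → a ≡ b → (a == b) ≡ true
==-complete {true} refl = refl
==-complete {false} refl = refl

-- Primitive recursion and bounded search

natrec : ℕ → (ℕ → ℕ → ℕ) → ℕ → ℕ
natrec a g zero = a
natrec a g (suc n) = g n (natrec a g n)

data Least (n : ℕ) (P : ℕ → Bool) (r : ℕ) : Set where
  none  : r ≡ n → (∀ k → k < n → P k ≡ false) → Least n P r
  found : r < n → P r ≡ true → (∀ k → k < r → P k ≡ false) → Least n P r

abstract
  -- last n P is the successor of the largest k < n with P k, and 0 if there is none.
  last : ℕ → (ℕ → Bool) → ℕ
  last n P = natrec 0 (λ k r → if P k then suc k else r) n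

  -- least n P is n if P fails below n.
  least : ℕ → (ℕ → Bool) → ℕ
  least n P = natrec 0 (λ k r → if r <ᵇ k then r else (if P k then k else suc k)) n

  all any : ℕ → (ℕ → Bool) → Bool
  all n P = n ≡ᵇ least n (λ k → not (P k))
  any n P = least n P <ᵇ n

  least-spec : ∀ n P → Least n P (least n P)
  least-spec zero P = none refl (λ _ ())
  least-spec (suc n) P with least n P | least-spec n P
  ... | r | found r<n Pr lo rewrite lt-complete r<n = found (≤-trans r<n (n≤1+n n)) Pr lo
  ... | r | none refl hi with r <ᵇ r in e
  ...   | true = ⊥-elim (<-irrefl refl (lt-sound r r e))
  ...   | false with P r in eP
  ...     | true = found ≤-refl eP hi
  ...     | false = none refl λ k k<sn → lem k (m≤n⇒m<n∨m≡n (≤-pred k<sn))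
      where
      lem : ∀ k → k < r ⊎ k ≡ r → P k ≡ false
      lem k (inj₁ l) = hi k l
      lem k (inj₂ refl) = eP

  least-cong : ∀ n P Q → (∀ k → k < n → P k ≡ Q k) → least n P ≡ least n Q
  least-cong zero P Q e = refl
  least-cong (suc n) P Q e rewrite least-cong n P Q (λ k l → e k (≤-trans l (n≤1+n n))) | e n ≤-refl = refl

  last-cong : ∀ n P Q → (∀ k → k < n → P k ≡ Q k) → last n P ≡ last n Q
  last-cong zero P Q e = refl
  last-cong (suc n) P Q e rewrite last-cong n P Q (λ k l → e k (≤-trans l (n≤1+n n))) | e n ≤-refl = refl

  all-cong : ∀ n P Q → (∀ k → k < n → P k ≡ Q k) → all n P ≡ all n Q
  all-cong n P Q e = cong (n ≡ᵇ_) (least-cong n _ _ λ k l → cong not (e k l))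

  any-cong : ∀ n P Q → (∀ k → k < n → P k ≡ Q k) → any n P ≡ any n Q
  any-cong n P Q e = cong (_<ᵇ n) (least-cong n P Q e)

  all-sound : ∀ n P → all n P ≡ true → ∀ k → k < n → P k ≡ true
  all-sound n P h k k<n with least n (λ k → not (P k)) | least-spec n (λ k → not (P k))
  ... | r | none _ hi with P k in e
  ...   | true = refl
  ...   | false = clash (cong not e) (hi k k<n)
  all-sound n P h k k<n | r | found r<n _ _ = ⊥-elim (<-irrefl (sym (eq-sound n r h)) r<n)

  all-complete : ∀ n P → (∀ k → k < n → P k ≡ true) → all n P ≡ true
  all-complete n P h with least n (λ k → not (P k)) | least-spec n (λ k → not (P k))
  ... | r | none e _ = eq-complete (sym e)
  ... | r | found r<n Pr _ = clash (h r r<n) (not-t Pr)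

  any-sound : ∀ n P → any n P ≡ true → Σ ℕ λ k → k < n × P k ≡ true
  any-sound n P h with least n P | least-spec n P
  ... | r | none refl _ = ⊥-elim (<-irrefl refl (lt-sound n n h))
  ... | r | found r<n Pr _ = r , r<n , Pr

  any-complete : ∀ n P k → k < n → P k ≡ true → any n P ≡ true
  any-complete n P k k<n Pk with least n P | least-spec n P
  ... | r | none _ hi = clash Pk (hi k k<n)
  ... | r | found r<n _ _ = lt-complete r<n

  last-spec : ∀ n P → (last n P ≡ 0 × (∀ k → k < n → P k ≡ false)) ⊎
    (Σ ℕ λ p → last n P ≡ suc p × p < n × P p ≡ true × (∀ k → k < n → P k ≡ true → k ≤ p))
  last-spec zero P = inj₁ (refl , λ _ ())
  last-spec (suc n) P with P n in e
  ... | true = inj₂ (n , refl , ≤-refl , e , λ k l _ → ≤-pred l)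
  ... | false with last-spec n P
  ...   | inj₁ (eq , hi) = inj₁ (eq , λ k l → lem k (m≤n⇒m<n∨m≡n (≤-pred l)))
    where
    lem : ∀ k → k < n ⊎ k ≡ n → P k ≡ false
    lem k (inj₁ l) = hi k l
    lem k (inj₂ refl) = e
  ...   | inj₂ (p , eq , p<n , Pp , hi) = inj₂ (p , eq , ≤-trans p<n (n≤1+n n) , Pp , λ k l → lem k (m≤n⇒m<n∨m≡n (≤-pred l)))
    where
    lem : ∀ k → k < n ⊎ k ≡ n → P k ≡ true → k ≤ p
    lem k (inj₁ l) = hi k l
    lem k (inj₂ refl) t = clash t e

  last-def : ∀ n P → last n P ≡ natrec 0 (λ k r → if P k then suc k else r) n
  last-def n P = refl

  least-def : ∀ n P → least n P ≡ natrec 0 (λ k r → if r <ᵇ k then r else (if P k then k else suc k)) n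
  least-def n P = refl

  all-def : ∀ n P → all n P ≡ (n ≡ᵇ least n (λ k → not (P k)))
  all-def n P = refl

  any-def : ∀ n P → any n P ≡ (least n P <ᵇ n)
  any-def n P = refl

-- Lists and strings as numbers

cons : ℕ → ℕ → ℕ
cons a l = suc ⟪ a , l ⟫

hd tl : ℕ → ℕ
hd l = fst (pred l)
tl l = snd (pred l)

drop : ℕ → ℕ → ℕ
drop k l = natrec l (λ _ r → tl r) k

nth : ℕ → ℕ → ℕ
nth k l = hd (drop k l)

hd-cons : ∀ a l → hd (cons a l) ≡ a
hd-cons a l = fst-pair a l

tl-cons : ∀ a l → tl (cons a l) ≡ l
tl-cons a l = snd-pair a l

drop-tl : ∀ k l → drop (suc k) l ≡ drop k (tl l)
drop-tl zero l = refl
drop-tl (suc k) l = cong tl (drop-tl k l)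

drop-cons : ∀ k a l → drop (suc k) (cons a l) ≡ drop k l
drop-cons k a l = trans (drop-tl k (cons a l)) (cong (drop k) (tl-cons a l))

nth-cons : ∀ k a l → nth (suc k) (cons a l) ≡ nth k l
nth-cons k a l = cong hd (drop-cons k a l)

lst : (ℕ → Bool) → ℕ → ℕ
lst f s = natrec 0 (λ k r → cons (b2n (f k)) r) s

-- A string is a length together with the list of its bits, last bit first.
str : (ℕ → Bool) → ℕ → ℕ
str f s = ⟪ s , lst f s ⟫

len : ℕ → ℕ
len τ = fst τ

bit : ℕ → ℕ → Bool
bit τ p = nth (len τ ∸ suc p) (snd τ) ≡ᵇ 1

len-str : ∀ f s → len (str f s) ≡ s
len-str f s = fst-pair s _

nth-lst : ∀ f s p → p < s → nth (s ∸ suc p) (lst f s) ≡ b2n (f p)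
nth-lst f (suc s) p p<ss with m≤n⇒m<n∨m≡n (≤-pred p<ss)
... | inj₂ refl rewrite n∸n≡0 p = hd-cons (b2n (f p)) (lst f p)
... | inj₁ p<s = trans (cong (λ k → nth k (lst f (suc s))) lem) (trans (nth-cons (s ∸ suc p) (b2n (f s)) (lst f s)) (nth-lst f s p p<s))
  where
  lem : suc s ∸ suc p ≡ suc (s ∸ suc p)
  lem = +-∸-assoc 1 p<s

bit-str : ∀ f s p → p < s → bit (str f s) p ≡ f p
bit-str f s p p<s rewrite len-str f s | snd-pair s (lst f s) | nth-lst f s p p<s with f p
... | true = refl
... | false = refl

lst-cong : ∀ s f g → (∀ p → p < s → f p ≡ g p) → lst f s ≡ lst g s
lst-cong zero f g e = refl
lst-cong (suc s) f g e = cong₂ cons (cong b2n (e s ≤-refl)) (lst-cong s f g λ p l → e p (≤-trans l (n≤1+n s)))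

str-cong : ∀ s f g → (∀ p → p < s → f p ≡ g p) → str f s ≡ str g s
str-cong s f g e = cong (⟪_,_⟫ s) (lst-cong s f g e)

lst-mono : ∀ s t f g → s ≤ t → (∀ p → p < s → f p ≡ true → g p ≡ true) → lst f s ≤ lst g t
lst-mono s t f g s≤t h with m≤n⇒m<n∨m≡n s≤t
lst-mono zero t f g s≤t h | _ = z≤n
lst-mono (suc s) (suc t) f g s≤t h | inj₁ (s≤s l) = ≤-trans (lst-mono (suc s) t f g l h) (≤-trans (y≤pair (b2n (g t)) _) (n≤1+n _))
lst-mono (suc s) .(suc s) f g s≤t h | inj₂ refl = s≤s (pair-mono (lem (f s) (g s) (h s ≤-refl)) (lst-mono s s f g ≤-refl λ p l → h p (≤-trans l (n≤1+n s))))
  where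
  lem : ∀ a b → (a ≡ true → b ≡ true) → b2n a ≤ b2n b
  lem false b _ = z≤n
  lem true b k rewrite k refl = ≤-refl

-- Consequently the string of `c` ones bounds the code of every string of length at most `c`, which
-- is the bound used in `fits`.
str-mono : ∀ s t f g → s ≤ t → (∀ p → p < s → f p ≡ true → g p ≡ true) → str f s ≤ str g t
str-mono s t f g s≤t h = pair-mono s≤t (lst-mono s t f g s≤t h)

dbl : ℕ → ℕ
dbl i = i + i

par half : ℕ → ℕ
par n = natrec 0 (λ _ r → 1 ∸ r) n
half n = natrec 0 (λ k r → r + par k) n

par-dbl : ∀ i → par (dbl i) ≡ 0
par-dbl zero = refl
par-dbl (suc i) rewrite +-suc i i | par-dbl i = refl

par-sdbl : ∀ i → par (suc (dbl i)) ≡ 1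
par-sdbl i rewrite par-dbl i = refl

half-dbl : ∀ i → half (dbl i) ≡ i
half-dbl zero = refl
half-dbl (suc i) rewrite +-suc i i | half-dbl i | par-dbl i | +-identityʳ i = +-comm i 1

half-sdbl : ∀ i → half (suc (dbl i)) ≡ i
half-sdbl i rewrite half-dbl i | par-dbl i = +-identityʳ i

half-cases : ∀ m → (m ≡ dbl (half m) × par m ≡ 0) ⊎ (m ≡ suc (dbl (half m)) × par m ≡ 1)
half-cases zero = inj₁ (refl , refl)
half-cases (suc m) with half-cases m
... | inj₁ (e , p) = inj₂ (cong suc (trans e (cong dbl (trans (sym (+-identityʳ _)) (cong (half m +_) (sym p))))) , cong (1 ∸_) p)
... | inj₂ (e , p) = inj₁ (trans (cong suc e) (trans (sym (lem (half m))) (cong dbl (sym (trans (cong (half m +_) p) (+-comm (half m) 1))))) , cong (1 ∸_) p)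
  where
  lem : ∀ i → dbl (suc i) ≡ suc (suc (dbl i))
  lem i = cong suc (+-suc i i)

half-odd : ∀ m → par m ≡ 1 → m ≡ suc (dbl (half m))
half-odd m p with half-cases m
... | inj₂ (e , _) = e
... | inj₁ (_ , q) with trans (sym p) q
... | ()

dbl-half≤ : ∀ m → dbl (half m) ≤ m
dbl-half≤ m with half-cases m
... | inj₁ (e , _) = ≤-reflexive (sym e)
... | inj₂ (e , _) = ≤-trans (n≤1+n _) (≤-reflexive (sym e))

≤sdbl-half : ∀ m → m ≤ suc (dbl (half m))
≤sdbl-half m with half-cases m
... | inj₁ (e , _) = ≤-trans (≤-reflexive e) (n≤1+n _)
... | inj₂ (e , _) = ≤-reflexive e

dbl-mono : ∀ {i j} → i ≤ j → dbl i ≤ dbl j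
dbl-mono p = +-mono-≤ p p

dbl-mono< : ∀ {i j} → i < j → suc (dbl i) < dbl j
dbl-mono< {i} {j} p = ≤-trans (≤-reflexive (cong suc (sym (+-suc i i)))) (+-mono-≤ p p)

dbl-cancel< : ∀ {i j} → dbl i < dbl j → i < j
dbl-cancel< {i} {j} p with <-≤-connex i j
... | inj₁ q = q
... | inj₂ q = ⊥-elim (<-irrefl refl (<-≤-trans p (dbl-mono q)))

-- Codes and their indices

det : ∀ {X c x y y′} → Eval X c x y → Eval X c x y′ → y ≡ y′
det ezero ezero = refl
det esucc esucc = refl
det eid eid = refl
det eleft eleft = refl
det eright eright = refl
det eorc eorc = refl
det (ecomp a b) (ecomp a′ b′) with det a a′
... | refl = det b b′
det (epair a b) (epair a′ b′) = cong₂ pair (det a a′) (det b b′)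
det (eprec0 e a) (eprec0 e′ a′) with trans (sym e) e′
... | refl = det a a′
det (eprec0 e a) (eprecS e′ _ _) with trans (sym e) e′
... | ()
det (eprecS e _ _) (eprec0 e′ a′) with trans (sym e) e′
... | ()
det (eprecS e a b) (eprecS e′ a′ b′) with trans (sym e) e′
... | refl with det a a′
... | refl = det b b′
det (emu {n = n} a h) (emu {n = n′} a′ h′) with <-cmp n n′
... | tri≈ _ p _ = p
... | tri< l _ _ with det a (proj₂ (h′ n l))
... | ()
det (emu {n = n} a h) (emu {n = n′} a′ h′) | tri> _ _ l with det a′ (proj₂ (h n′ l))
... | ()

-- The decoder with fuel is private in Defs; unification reads it off an unfolding of decode.
mutual
  decodeFuel : ℕ → ℕ → Code
  decodeFuel = _
  private
    decodeFuel-fixed : ∀ z r a b → unpair z ≡ (6 , r) → unpair r ≡ (a , b) → decode z ≡ Comp (decodeFuel z a) (decodeFuel z b)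
    decodeFuel-fixed z r a b e e′ rewrite e | e′ = refl

-- One step of `decode` with the fuel removed; the reasoning about indices goes through it.
dcd : ℕ → ℕ → Code
dcd 0 r = Zero
dcd 1 r = Succ
dcd 2 r = Id
dcd 3 r = Left
dcd 4 r = Right
dcd 5 r = Oracle
dcd 6 r = Comp (decode (fst r)) (decode (snd r))
dcd 7 r = Pair (decode (fst r)) (decode (snd r))
dcd 8 r = Prec (decode (fst r)) (decode (snd r))
dcd 9 r = Mu (decode r)
dcd _ r = Zero

private
  tag< : ∀ {z t r k} → unpair z ≡ (suc t , r) → z < suc k → r < k
  tag< {z} {t} {r} e (s≤s l) = <-≤-trans (s≤s (m≤n+m r t)) (≤-trans (sum≤pair (suc t) r) (≤-trans (≤-reflexive eq) l))
    where
    eq : ⟪ suc t , r ⟫ ≡ z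
    eq = trans (cong₂ ⟪_,_⟫ (sym (cong proj₁ (trans (sym (unpair-def z)) e))) (sym (cong proj₂ (trans (sym (unpair-def z)) e)))) (pair-fs z)

  f< : ∀ {r k} → r < k → proj₁ (unpair r) < k
  f< {r} l = ≤-<-trans (subst (_≤ r) (sym (cong proj₁ (unpair-def r))) (fst≤ r)) l

  s< : ∀ {r k} → r < k → proj₂ (unpair r) < k
  s< {r} l = ≤-<-trans (subst (_≤ r) (sym (cong proj₂ (unpair-def r))) (snd≤ r)) l

  -- Recursive calls are made only on components of a code with nonzero tag. These are strictly
  -- smaller than the code, so one unit of fuel per level is enough.
  fuel : ∀ k k′ z → z < k → z < k′ → decodeFuel k z ≡ decodeFuel k′ z
  fuel (suc k) (suc k′) z l l′ with unpair z in eq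
  ... | 0 , r = refl
  ... | 1 , r = refl
  ... | 2 , r = refl
  ... | 3 , r = refl
  ... | 4 , r = refl
  ... | 5 , r = refl
  ... | 6 , r = cong₂ Comp (fuel k k′ _ (f< (tag< eq l)) (f< (tag< eq l′))) (fuel k k′ _ (s< (tag< eq l)) (s< (tag< eq l′)))
  ... | 7 , r = cong₂ Pair (fuel k k′ _ (f< (tag< eq l)) (f< (tag< eq l′))) (fuel k k′ _ (s< (tag< eq l)) (s< (tag< eq l′)))
  ... | 8 , r = cong₂ Prec (fuel k k′ _ (f< (tag< eq l)) (f< (tag< eq l′))) (fuel k k′ _ (s< (tag< eq l)) (s< (tag< eq l′)))
  ... | 9 , r = cong Mu (fuel k k′ _ (tag< eq l) (tag< eq l′))
  ... | suc (suc (suc (suc (suc (suc (suc (suc (suc (suc _))))))))) , r = refl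

  fuel-f : ∀ k r → r < k → decodeFuel k (proj₁ (unpair r)) ≡ decode (fst r)
  fuel-f k r l = trans (fuel k (suc (proj₁ (unpair r))) _ (f< l) ≤-refl) (cong decode (cong proj₁ (unpair-def r)))

  fuel-s : ∀ k r → r < k → decodeFuel k (proj₂ (unpair r)) ≡ decode (snd r)
  fuel-s k r l = trans (fuel k (suc (proj₂ (unpair r))) _ (s< l) ≤-refl) (cong decode (cong proj₂ (unpair-def r)))

decode-dcd : ∀ e → decode e ≡ dcd (fst e) (snd e)
decode-dcd e = trans go (cong₂ dcd (cong proj₁ (unpair-def e)) (cong proj₂ (unpair-def e)))
  where
  go : decode e ≡ dcd (proj₁ (unpair e)) (proj₂ (unpair e))
  go with unpair e in eq
  ... | 0 , r = refl
  ... | 1 , r = refl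
  ... | 2 , r = refl
  ... | 3 , r = refl
  ... | 4 , r = refl
  ... | 5 , r = refl
  ... | 6 , r = cong₂ Comp (fuel-f e r (tag< eq ≤-refl)) (fuel-s e r (tag< eq ≤-refl))
  ... | 7 , r = cong₂ Pair (fuel-f e r (tag< eq ≤-refl)) (fuel-s e r (tag< eq ≤-refl))
  ... | 8 , r = cong₂ Prec (fuel-f e r (tag< eq ≤-refl)) (fuel-s e r (tag< eq ≤-refl))
  ... | 9 , r = cong Mu (fuel e (suc r) r (tag< eq ≤-refl) ≤-refl)
  ... | suc (suc (suc (suc (suc (suc (suc (suc (suc (suc _))))))))) , r = refl

decode-pair : ∀ t r → decode ⟪ t , r ⟫ ≡ dcd t r
decode-pair t r = trans (decode-dcd _) (cong₂ dcd (fst-pair t r) (snd-pair t r))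

ix : Code → ℕ
ix Zero = ⟪ 0 , 0 ⟫
ix Succ = ⟪ 1 , 0 ⟫
ix Id = ⟪ 2 , 0 ⟫
ix Left = ⟪ 3 , 0 ⟫
ix Right = ⟪ 4 , 0 ⟫
ix Oracle = ⟪ 5 , 0 ⟫
ix (Comp f g) = ⟪ 6 , ⟪ ix f , ix g ⟫ ⟫
ix (Pair f g) = ⟪ 7 , ⟪ ix f , ix g ⟫ ⟫
ix (Prec f g) = ⟪ 8 , ⟪ ix f , ix g ⟫ ⟫
ix (Mu f) = ⟪ 9 , ix f ⟫

decode-ix : ∀ c → decode (ix c) ≡ c
decode-ix Zero = decode-pair _ _
decode-ix Succ = decode-pair _ _
decode-ix Id = decode-pair _ _
decode-ix Left = decode-pair _ _
decode-ix Right = decode-pair _ _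
decode-ix Oracle = decode-pair _ _
decode-ix (Comp f g) = trans (decode-pair _ _) (cong₂ Comp (trans (cong decode (fst-pair _ _)) (decode-ix f)) (trans (cong decode (snd-pair _ _)) (decode-ix g)))
decode-ix (Pair f g) = trans (decode-pair _ _) (cong₂ Pair (trans (cong decode (fst-pair _ _)) (decode-ix f)) (trans (cong decode (snd-pair _ _)) (decode-ix g)))
decode-ix (Prec f g) = trans (decode-pair _ _) (cong₂ Prec (trans (cong decode (fst-pair _ _)) (decode-ix f)) (trans (cong decode (snd-pair _ _)) (decode-ix g)))
decode-ix (Mu f) = trans (decode-pair _ _) (cong Mu (decode-ix f))

-- Computable functions

-- The code must work relative to every oracle. A combinator named c followed by an operation
-- shows that the operation preserves Cp; functions of several arguments take nested pairs.
record Cp (f : ℕ → ℕ) : Set where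
  constructor mkCp
  field
    code : Code
    run  : ∀ X x → Eval X code x (f x)
open Cp public

Cp2 : (ℕ → ℕ → ℕ) → Set
Cp2 f = Cp λ z → f (fst z) (snd z)

Cp3 : (ℕ → ℕ → ℕ → ℕ) → Set
Cp3 f = Cp λ z → f (fst (fst z)) (snd (fst z)) (snd z)

CpB : (ℕ → Bool) → Set
CpB p = Cp λ e → b2n (p e)

CpB2 : (ℕ → ℕ → Bool) → Set
CpB2 p = Cp λ z → b2n (p (fst z) (snd z))

cext : ∀ {f g} → (∀ x → f x ≡ g x) → Cp f → Cp g
cext e (mkCp c r) = mkCp c λ X x → subst (Eval X c x) (e x) (r X x)

cid : Cp λ x → x
cid = mkCp Id λ _ _ → eid

cc : ∀ {f g} → Cp f → Cp g → Cp λ e → f (g e)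
cc (mkCp c r) (mkCp d t) = mkCp (Comp c d) λ X x → ecomp (t X x) (r X _)

ck : ∀ n → Cp λ _ → n
ck zero = mkCp Zero λ _ _ → ezero
ck (suc n) = mkCp (Comp Succ (code (ck n))) λ X x → ecomp (run (ck n) X x) esucc

cs : ∀ {f} → Cp f → Cp λ e → suc (f e)
cs (mkCp c r) = mkCp (Comp Succ c) λ X x → ecomp (r X x) esucc

cpr : ∀ {f g} → Cp f → Cp g → Cp λ e → ⟪ f e , g e ⟫
cpr (mkCp c r) (mkCp d t) = mkCp (Pair c d) λ X x → subst (Eval X _ x) (sym (⟪⟫-def _ _)) (epair (r X x) (t X x))

cl : ∀ {f} → Cp f → Cp λ e → fst (f e)
cl (mkCp c r) = mkCp (Comp Left c) λ X x → ecomp (r X x) (subst (Eval X Left _) (cong proj₁ (unpair-def _)) eleft)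

cr : ∀ {f} → Cp f → Cp λ e → snd (f e)
cr (mkCp c r) = mkCp (Comp Right c) λ X x → ecomp (r X x) (subst (Eval X Right _) (cong proj₂ (unpair-def _)) eright)

ap2 : ∀ {f a b} → Cp2 f → Cp a → Cp b → Cp λ e → f (a e) (b e)
ap2 {f} F A B = cext (λ e → cong₂ f (fst-pair _ _) (snd-pair _ _)) (cc F (cpr A B))

ap3 : ∀ {f a b c} → Cp3 f → Cp a → Cp b → Cp c → Cp λ e → f (a e) (b e) (c e)
ap3 {f} {a} {b} {c} F A B D = cext (λ e → trans (cong₂ (λ u v → f (fst u) (snd u) v) (fst-pair _ _) (snd-pair _ _)) (cong₂ (λ u v → f u v (c e)) (fst-pair _ _) (snd-pair _ _))) (cc F (cpr (cpr A B) D))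

crec : ∀ {a g n} → Cp a → Cp3 g → Cp n → Cp λ e → natrec (a e) (g e) (n e)
crec {a} {g} {n} A G N = mkCp (Comp (Prec (code A) (code G)) (Pair Id (code N)))
  λ X x → ecomp (epair eid (run N X x)) (go X x (n x))
  where
  go : ∀ X e k → Eval X (Prec (code A) (code G)) (pair e k) (natrec (a e) (g e) k)
  go X e zero = eprec0 (unpair-pair e 0) (run A X e)
  go X e (suc k) = eprecS (unpair-pair e (suc k)) (go X e k) (subst (Eval X _ _) eq (run G X _))
    where
    v = natrec (a e) (g e) k
    eq : g (fst (fst (pair (pair e k) v))) (snd (fst (pair (pair e k) v))) (snd (pair (pair e k) v)) ≡ g e k v
    eq rewrite sym (⟪⟫-def (pair e k) v) | fst-pair (pair e k) v | snd-pair (pair e k) v | sym (⟪⟫-def e k) | fst-pair e k | snd-pair e k = refl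

cv0 : Cp λ z → fst z
cv0 = cl cid

cv1 : Cp λ z → snd z
cv1 = cr cid

-- Branching is a recursion whose length is the truth value: no step leaves the second branch, one
-- step replaces it by the first.
cif : ∀ {p a b} → CpB p → Cp a → Cp b → Cp λ e → if p e then a e else b e
cif {p} {a} {b} P A B = cext lem (crec {g = λ e _ _ → a e} B (cc A (cl cv0)) P)
  where
  lem : ∀ x → natrec (b x) (λ _ _ → a x) (b2n (p x)) ≡ (if p x then a x else b x)
  lem x with p x
  ... | true = refl
  ... | false = refl

cifB : ∀ {p q r} → CpB p → CpB q → CpB r → CpB λ e → if p e then q e else r e
cifB {p} {q} {r} P Q R = cext lem (cif P Q R)
  where
  lem : ∀ x → (if p x then b2n (q x) else b2n (r x)) ≡ b2n (if p x then q x else r x)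
  lem x with p x
  ... | true = refl
  ... | false = refl

cnot : ∀ {p} → CpB p → CpB λ e → not (p e)
cnot {p} P = cext lem (cif P (ck 0) (ck 1))
  where
  lem : ∀ x → (if p x then 0 else 1) ≡ b2n (not (p x))
  lem x with p x
  ... | true = refl
  ... | false = refl

infixr 6 _c∧_
infixr 5 _c∨_
_c∧_ : ∀ {p q} → CpB p → CpB q → CpB λ e → p e ∧ q e
_c∧_ {p} {q} P Q = cext lem (cif P Q (ck 0))
  where
  lem : ∀ x → (if p x then b2n (q x) else 0) ≡ b2n (p x ∧ q x)
  lem x with p x
  ... | true = refl
  ... | false = refl

_c∨_ : ∀ {p q} → CpB p → CpB q → CpB λ e → p e ∨ q e
_c∨_ {p} {q} P Q = cext lem (cif P (ck 1) Q)
  where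
  lem : ∀ x → (if p x then 1 else b2n (q x)) ≡ b2n (p x ∨ q x)
  lem x with p x
  ... | true = refl
  ... | false = refl

_c⇒_ : ∀ {p q} → CpB p → CpB q → CpB λ e → p e ⇒ q e
P c⇒ Q = cnot P c∨ Q

_c==_ : ∀ {p q} → CpB p → CpB q → CpB λ e → p e == q e
_c==_ {p} {q} P Q = cext lem (cif P Q (cnot Q))
  where
  lem : ∀ x → (if p x then b2n (q x) else b2n (not (q x))) ≡ b2n (p x == q x)
  lem x with p x
  ... | true = refl
  ... | false = refl

cpred : ∀ {f} → Cp f → Cp λ e → pred (f e)
cpred {f} F = cext (λ x → lem (f x)) (crec {g = λ _ k _ → k} (ck 0) (cr cv0) F)
  where
  lem : ∀ n → natrec 0 (λ k _ → k) n ≡ pred n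
  lem zero = refl
  lem (suc n) = refl

_c+_ : ∀ {f g} → Cp f → Cp g → Cp λ e → f e + g e
_c+_ {f} {g} F G = cext (λ x → lem (f x) (g x)) (crec {g = λ _ _ r → suc r} F (cs cv1) G)
  where
  lem : ∀ m n → natrec m (λ _ r → suc r) n ≡ m + n
  lem m zero = sym (+-identityʳ m)
  lem m (suc n) = trans (cong suc (lem m n)) (sym (+-suc m n))

_c∸_ : ∀ {f g} → Cp f → Cp g → Cp λ e → f e ∸ g e
_c∸_ {f} {g} F G = cext (λ x → lem (f x) (g x)) (crec {g = λ _ _ r → pred r} F (cpred cv1) G)
  where
  lem : ∀ m n → natrec m (λ _ r → pred r) n ≡ m ∸ n
  lem m zero = refl
  lem m (suc n) = trans (cong pred (lem m n)) (pred[m∸n]≡m∸[1+n] m n)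

cz : ∀ {f} → Cp f → CpB λ e → f e ≡ᵇ 0
cz {f} F = cext (λ x → lem (f x)) (crec {g = λ _ _ _ → 0} (ck 1) (ck 0) F)
  where
  lem : ∀ n → natrec 1 (λ _ _ → 0) n ≡ b2n (n ≡ᵇ 0)
  lem zero = refl
  lem (suc n) = refl

_c≡_ : ∀ {f g} → Cp f → Cp g → CpB λ e → f e ≡ᵇ g e
_c≡_ {f} {g} F G = cext (λ x → cong b2n (lem (f x) (g x))) (cz ((F c∸ G) c+ (G c∸ F)))
  where
  lem : ∀ m n → (((m ∸ n) + (n ∸ m)) ≡ᵇ 0) ≡ (m ≡ᵇ n)
  lem zero zero = refl
  lem zero (suc n) = refl
  lem (suc m) zero = refl
  lem (suc m) (suc n) = lem m n

_c<_ : ∀ {f g} → Cp f → Cp g → CpB λ e → f e <ᵇ g e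
_c<_ {f} {g} F G = cext (λ x → cong b2n (lem (f x) (g x))) (cz (cs F c∸ G))
  where
  lem : ∀ m n → ((suc m ∸ n) ≡ᵇ 0) ≡ (m <ᵇ n)
  lem zero zero = refl
  lem zero (suc n) = cong (_≡ᵇ 0) (0∸n≡0 n)
  lem (suc m) zero = refl
  lem (suc m) (suc n) = lem m n

clast : ∀ {P : ℕ → ℕ → Bool} {n} → Cp n → CpB2 P → Cp λ e → last (n e) (P e)
clast {P} N Q = cext (λ e → sym (last-def _ _))
  (crec {g = λ e k r → if P e k then suc k else r} (ck 0) (cif (cc Q cv0) (cs (cr cv0)) cv1) N)

cleast : ∀ {P : ℕ → ℕ → Bool} {n} → Cp n → CpB2 P → Cp λ e → least (n e) (P e)
cleast {P} N Q = cext (λ e → sym (least-def _ _))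
  (crec {g = λ e k r → if r <ᵇ k then r else (if P e k then k else suc k)} (ck 0)
  (cif (cv1 c< cr cv0) cv1 (cif (cc Q cv0) (cr cv0) (cs (cr cv0)))) N)

call : ∀ {P : ℕ → ℕ → Bool} {n} → Cp n → CpB2 P → CpB λ e → all (n e) (P e)
call {P} N Q = cext (λ e → cong b2n (sym (all-def _ _))) (N c≡ cleast {λ e k → not (P e k)} N (cnot Q))

cany : ∀ {P : ℕ → ℕ → Bool} {n} → Cp n → CpB2 P → CpB λ e → any (n e) (P e)
cany {P} N Q = cext (λ e → cong b2n (sym (any-def _ _))) (cleast {P} N Q c< N)

ccons : ∀ {f g} → Cp f → Cp g → Cp λ e → cons (f e) (g e)
ccons F G = cs (cpr F G)

chd : ∀ {f} → Cp f → Cp λ e → hd (f e)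
chd F = cl (cpred F)

ctl : ∀ {f} → Cp f → Cp λ e → tl (f e)
ctl F = cr (cpred F)

cdrop : ∀ {f g} → Cp f → Cp g → Cp λ e → drop (f e) (g e)
cdrop F G = crec {g = λ _ _ r → tl r} G (ctl cv1) F

cnth : ∀ {f g} → Cp f → Cp g → Cp λ e → nth (f e) (g e)
cnth F G = chd (cdrop F G)

clst : ∀ {h : ℕ → ℕ → Bool} {n} → CpB2 h → Cp n → Cp λ e → lst (h e) (n e)
clst {h} H N = crec {g = λ e k r → cons (b2n (h e k)) r} (ck 0) (ccons (cc H cv0) cv1) N

cstr : ∀ {h : ℕ → ℕ → Bool} {n} → CpB2 h → Cp n → Cp λ e → str (h e) (n e)
cstr H N = cpr N (clst H N)

cbit : ∀ {f g} → Cp f → Cp g → CpB λ e → bit (f e) (g e)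
cbit F G = cnth (cl F c∸ cs G) (cr F) c≡ ck 1

cdbl : ∀ {f} → Cp f → Cp λ e → dbl (f e)
cdbl F = F c+ F

cpar : ∀ {f} → Cp f → Cp λ e → par (f e)
cpar F = crec {g = λ _ _ r → 1 ∸ r} (ck 0) (ck 1 c∸ cv1) F

chalf : ∀ {f} → Cp f → Cp λ e → half (f e)
chalf F = crec {g = λ _ k r → r + par k} (ck 0) (cv1 c+ cpar (cr cv0)) F

module _ (P : ℕ → ℕ → Bool) (Q : CpB2 P) (ex : ∀ x → Σ ℕ λ n → P x n ≡ true) where

  -- The bound comes from the existence proof, which need not be computable. The program of `cmu`
  -- searches without a bound and, by minimality, finds the same number.
  mu : ℕ → ℕ
  mu x = least (suc (proj₁ (ex x))) (P x)

  mu-spec : ∀ x → P x (mu x) ≡ true × (∀ k → k < mu x → P x k ≡ false)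
  mu-spec x with least (suc (proj₁ (ex x))) (P x) | least-spec (suc (proj₁ (ex x))) (P x)
  ... | r | none _ hi = clash (proj₂ (ex x)) (hi _ ≤-refl)
  ... | r | found _ Pr lo = Pr , lo

  cmu : Cp mu
  cmu = mkCp (Mu (code (cnot Q))) λ X x →
    emu (subst (Eval X _ _) (trans (val x (mu x)) (cong (λ b → b2n (not b)) (proj₁ (mu-spec x)))) (run (cnot Q) X _))
        (λ k l → 0 , subst (Eval X _ _) (trans (val x k) (cong (λ b → b2n (not b)) (proj₂ (mu-spec x) k l))) (run (cnot Q) X _))
    where
    val : ∀ x n → b2n (not (P (fst (pair x n)) (snd (pair x n)))) ≡ b2n (not (P x n))
    val x n rewrite sym (⟪⟫-def x n) | fst-pair x n | snd-pair x n = refl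

computable : ∀ {f} → Cp f → ComputableFn f
computable (mkCp c r) = ix c , λ x → subst (λ d → Eval ∅ d x _) (sym (decode-ix c)) (r ∅ x)

-- Functions computed uniformly from an oracle

record OCp (f : (ℕ → Bool) → ℕ → ℕ) : Set where
  constructor mkOCp
  field
    ocode : Code
    orun  : ∀ X x → Eval X ocode x (f X x)
open OCp public

oext : ∀ {f g} → (∀ X x → f X x ≡ g X x) → OCp f → OCp g
oext e (mkOCp c r) = mkOCp c λ X x → subst (Eval X c x) (e X x) (r X x)

olift : ∀ {f} → Cp f → OCp λ _ → f
olift (mkCp c r) = mkOCp c r

occ : ∀ {f g} → Cp f → OCp g → OCp λ X x → f (g X x)
occ (mkCp c r) (mkOCp d t) = mkOCp (Comp c d) λ X x → ecomp (t X x) (r X _)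

opr : ∀ {f g} → OCp f → OCp g → OCp λ X x → ⟪ f X x , g X x ⟫
opr (mkOCp c r) (mkOCp d t) = mkOCp (Pair c d) λ X x → subst (Eval X _ x) (sym (⟪⟫-def _ _)) (epair (r X x) (t X x))

olst : OCp lst
olst = mkOCp (Comp (Prec Zero step) (Pair Zero Id)) λ X x → ecomp (epair ezero eid) (go X x)
  where
  step : Code
  step = Comp Succ (Pair (Comp Oracle (Comp Right Left)) Right)
  go : ∀ X k → Eval X (Prec Zero step) (pair 0 k) (lst X k)
  go X zero = eprec0 (unpair-pair 0 0) ezero
  go X (suc k) = eprecS (unpair-pair 0 (suc k)) (go X k) (subst (Eval X step _) eq (ecomp (epair (ecomp (ecomp eleft eright) eorc) eright) esucc))
    where
    v = lst X k
    w = pair (pair 0 k) v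
    eq : suc (pair (b2n (X (proj₂ (unpair (proj₁ (unpair w)))))) (proj₂ (unpair w))) ≡ lst X (suc k)
    eq rewrite unpair-pair (pair 0 k) v | unpair-pair 0 k = cong suc (sym (⟪⟫-def _ _))

ostr : ∀ {f} → Cp f → OCp λ X x → str X (f x)
ostr F = opr (olift F) (mkOCp (Comp (ocode olst) (code F)) λ X x → ecomp (run F X x) (orun olst X _))

-- Certificates of computations

-- The empty list is 0 and every `cons` is positive, so `0 < drop k L` says that there is an entry
-- at index `k`.
In : ℕ → ℕ → Set
In u L = Σ ℕ λ k → 0 < drop k L × nth k L ≡ u

tl< : ∀ L → 0 < L → tl L < L
tl< (suc l) _ = s≤s (snd≤ l)

tl0 : tl 0 ≡ 0
tl0 = n≤0⇒n≡0 (snd≤ 0)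

drop0 : ∀ k → drop k 0 ≡ 0
drop0 zero = refl
drop0 (suc k) = trans (cong tl (drop0 k)) tl0

drop< : ∀ k L → 0 < drop k L → k + drop k L ≤ L
drop< zero L _ = ≤-refl
drop< (suc k) L p with drop k L in e
... | zero = ⊥-elim (<-irrefl (sym tl0) p)
... | suc d = ≤-trans (≤-reflexive (sym (+-suc k (tl (suc d))))) (≤-trans (+-monoʳ-≤ k (tl< (suc d) (s≤s z≤n))) (subst (λ z → k + z ≤ L) e (drop< k L (subst (0 <_) (sym e) (s≤s z≤n)))))

In-idx : ∀ k L → 0 < drop k L → k < L
In-idx k L p = <-≤-trans (≤-<-trans (≤-reflexive (sym (+-identityʳ k))) (+-monoʳ-< k p)) (drop< k L p)

nth<drop : ∀ k L → 0 < drop k L → nth k L < drop k L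
nth<drop k L p with drop k L
... | suc d = s≤s (fst≤ d)

In< : ∀ {u L} → In u L → u < L
In< {u} {L} (k , p , refl) = <-≤-trans (nth<drop k L p) (≤-trans (m≤n+m _ k) (drop< k L p))

In-hd : ∀ L → 0 < L → In (hd L) L
In-hd L p = 0 , p , refl

In-tl : ∀ {u L} → In u (tl L) → In u L
In-tl {u} {L} (k , p , e) = suc k , subst (0 <_) (sym (drop-tl k L)) p , trans (cong hd (drop-tl k L)) e

In-cases : ∀ {u L} → In u L → (0 < L × u ≡ hd L) ⊎ In u (tl L)
In-cases {u} {L} (zero , p , e) = inj₁ (p , sym e)
In-cases {u} {L} (suc k , p , e) = inj₂ (k , subst (0 <_) (drop-tl k L) p , trans (sym (cong hd (drop-tl k L))) e)

abstract
  -- The code of a list exceeds every index at which it has an entry, so the code itself can bound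
  -- the search.
  exf : ℕ → (ℕ → Bool) → Bool
  exf R P = any R (λ k → (0 <ᵇ drop k R) ∧ P (nth k R))

  exf-sound : ∀ R P → exf R P ≡ true → Σ ℕ λ v → In v R × P v ≡ true
  exf-sound R P h with any-sound R _ h
  ... | k , _ , p = nth k R , (k , lt-sound _ _ (∧-l p) , refl) , ∧-r {0 <ᵇ drop k R} p

  exf-complete : ∀ R P v → In v R → P v ≡ true → exf R P ≡ true
  exf-complete R P v (k , p , refl) q = any-complete R _ k (In-idx k R p) (∧-i (lt-complete p) q)

  mem : ℕ → ℕ → Bool
  mem u R = exf R (λ v → v ≡ᵇ u)

  mem-sound : ∀ {u R} → mem u R ≡ true → In u R
  mem-sound {u} {R} h with exf-sound R _ h
  ... | v , i , e = subst (λ z → In z R) (eq-sound v u e) i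

  mem-complete : ∀ {u R} → In u R → mem u R ≡ true
  mem-complete {u} {R} i = exf-complete R (λ v → v ≡ᵇ u) u i (eq-refl u)

  cexf : ∀ {R} {P : ℕ → ℕ → Bool} → Cp R → CpB2 P → CpB λ e → exf (R e) (P e)
  cexf {R} {P} CR Q = cany {λ e k → (0 <ᵇ drop k (R e)) ∧ P e (nth k (R e))} CR
    ((ck 0 c< cdrop cv1 (cc CR cv0)) c∧ ap2 {λ e v → b2n (P e v)} Q cv0 (cnth cv1 (cc CR cv0)))

  cmem : ∀ {u R} → Cp u → Cp R → CpB λ e → mem (u e) (R e)
  cmem {u} U CR = cexf {P = λ e v → v ≡ᵇ u e} CR (cv1 c≡ cc U cv0)

-- A fact ⟪ e , ⟪ x , y ⟫ ⟫ claims that the program with index e maps x to y.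
-- In a valid list every fact follows from the facts behind it.

fact : ℕ → ℕ → ℕ → ℕ
fact e x y = ⟪ e , ⟪ x , y ⟫ ⟫

fe fx fy : ℕ → ℕ
fe u = fst u
fx u = fst (snd u)
fy u = snd (snd u)

fe-fact : ∀ e x y → fe (fact e x y) ≡ e
fe-fact e x y = fst-pair _ _

fx-fact : ∀ e x y → fx (fact e x y) ≡ x
fx-fact e x y = trans (cong fst (snd-pair _ _)) (fst-pair _ _)

fy-fact : ∀ e x y → fy (fact e x y) ≡ y
fy-fact e x y = trans (cong snd (snd-pair _ _)) (snd-pair _ _)

cfact : ∀ {f g h} → Cp f → Cp g → Cp h → Cp λ e → fact (f e) (g e) (h e)
cfact F G H = cpr F (cpr G H)

module _ (q : ℕ) (e x y R : ℕ) where
  -- Each clause mirrors a constructor of `Eval` for the tag of the index `e`, with its premises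
  -- looked up in `R`; `q` is the answer of the oracle at `x`.
  byTag : ℕ → Bool
  byTag 0 = y ≡ᵇ 0
  byTag 1 = y ≡ᵇ suc x
  byTag 2 = y ≡ᵇ x
  byTag 3 = y ≡ᵇ fst x
  byTag 4 = y ≡ᵇ snd x
  byTag 5 = (y <ᵇ 2) ∧ (q ≡ᵇ y)
  byTag 6 = exf R (λ v → (fe v ≡ᵇ snd (snd e)) ∧ ((fx v ≡ᵇ x) ∧ mem (fact (fst (snd e)) (fy v) y) R))
  byTag 7 = mem (fact (fst (snd e)) x (fst y)) R ∧ mem (fact (snd (snd e)) x (snd y)) R
  byTag 8 = if snd x ≡ᵇ 0 then mem (fact (fst (snd e)) (fst x) y) R
            else exf R (λ v → (fe v ≡ᵇ e) ∧ ((fx v ≡ᵇ ⟪ fst x , pred (snd x) ⟫) ∧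
                              mem (fact (snd (snd e)) ⟪ ⟪ fst x , pred (snd x) ⟫ , fy v ⟫ y) R))
  byTag 9 = mem (fact (snd e) ⟪ x , y ⟫ 0) R ∧
            all y (λ m → exf R (λ v → (fe v ≡ᵇ snd e) ∧ ((fx v ≡ᵇ ⟪ x , m ⟫) ∧ (0 <ᵇ fy v))))
  byTag _ = y ≡ᵇ 0

byTag-mono : ∀ q e x y R R′ → (∀ {u} → In u R → In u R′) → ∀ t → byTag q e x y R t ≡ true → byTag q e x y R′ t ≡ true
byTag-mono q e x y R R′ sub = go
  where
  mm : ∀ {u} → mem u R ≡ true → mem u R′ ≡ true
  mm h = mem-complete (sub (mem-sound h))
  ee : ∀ {P Q : ℕ → Bool} → (∀ v → P v ≡ true → Q v ≡ true) → exf R P ≡ true → exf R′ Q ≡ true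
  ee {P} {Q} pq h with exf-sound R P h
  ... | v , i , p = exf-complete R′ Q v (sub i) (pq v p)
  go : ∀ t → byTag q e x y R t ≡ true → byTag q e x y R′ t ≡ true
  go 0 h = h
  go 1 h = h
  go 2 h = h
  go 3 h = h
  go 4 h = h
  go 5 h = h
  go 6 h = ee (λ v → ∧-map (fe v ≡ᵇ snd (snd e)) (∧-map (fx v ≡ᵇ x) mm)) h
  go 7 h = ∧-i (mm (∧-l h)) (mm (∧-r {mem (fact (fst (snd e)) x (fst y)) R} h))
  go 8 h with snd x ≡ᵇ 0
  ... | true = mm h
  ... | false = ee (λ v → ∧-map (fe v ≡ᵇ e) (∧-map (fx v ≡ᵇ ⟪ fst x , pred (snd x) ⟫) mm)) h
  go 9 h = ∧-i (mm (∧-l h)) (all-complete y _ λ m l → ee (λ _ p → p) (all-sound y _ (∧-r {mem (fact (snd e) ⟪ x , y ⟫ 0) R} h) m l))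
  go (suc (suc (suc (suc (suc (suc (suc (suc (suc (suc _)))))))))) h = h

cbyTag : ∀ {q e x y R t} → Cp q → Cp e → Cp x → Cp y → Cp R → Cp t → CpB λ z → byTag (q z) (e z) (x z) (y z) (R z) (t z)
cbyTag {q} {e} {x} {y} {R} {t} Q E X Y CR T = cext (λ z → cong b2n (lem (q z) (e z) (x z) (y z) (R z) (t z)))
  (cifB (T c≡ ck 1) (Y c≡ cs X) (cifB (T c≡ ck 2) (Y c≡ X) (cifB (T c≡ ck 3) (Y c≡ cl X) (cifB (T c≡ ck 4) (Y c≡ cr X)
  (cifB (T c≡ ck 5) ((Y c< ck 2) c∧ (Q c≡ Y))
  (cifB (T c≡ ck 6) (cexf {P = λ z v → (fe v ≡ᵇ snd (snd (e z))) ∧ ((fx v ≡ᵇ x z) ∧ mem (fact (fst (snd (e z))) (fy v) (y z)) (R z))} CR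
     ((cl cv1 c≡ cr (cr (cc E cv0))) c∧ ((cl (cr cv1) c≡ cc X cv0) c∧ cmem (cfact (cl (cr (cc E cv0))) (cr (cr cv1)) (cc Y cv0)) (cc CR cv0))))
  (cifB (T c≡ ck 7) (cmem (cfact (cl (cr E)) X (cl Y)) CR c∧ cmem (cfact (cr (cr E)) X (cr Y)) CR)
  (cifB (T c≡ ck 8) (cifB (cr X c≡ ck 0) (cmem (cfact (cl (cr E)) (cl X) Y) CR)
     (cexf {P = λ z v → (fe v ≡ᵇ e z) ∧ ((fx v ≡ᵇ ⟪ fst (x z) , pred (snd (x z)) ⟫) ∧ mem (fact (snd (snd (e z))) ⟪ ⟪ fst (x z) , pred (snd (x z)) ⟫ , fy v ⟫ (y z)) (R z))} CR
       ((cl cv1 c≡ cc E cv0) c∧ ((cl (cr cv1) c≡ cpr (cl (cc X cv0)) (cpred (cr (cc X cv0)))) c∧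
          cmem (cfact (cr (cr (cc E cv0))) (cpr (cpr (cl (cc X cv0)) (cpred (cr (cc X cv0)))) (cr (cr cv1))) (cc Y cv0)) (cc CR cv0)))))
  (cifB (T c≡ ck 9) (cmem (cfact (cr E) (cpr X Y) (ck 0)) CR c∧
     call {λ z m → exf (R z) (λ v → (fe v ≡ᵇ snd (e z)) ∧ ((fx v ≡ᵇ ⟪ x z , m ⟫) ∧ (0 <ᵇ fy v)))} Y
       (cexf {P = λ w v → (fe v ≡ᵇ snd (e (fst w))) ∧ ((fx v ≡ᵇ ⟪ x (fst w) , snd w ⟫) ∧ (0 <ᵇ fy v))} (cc CR cv0)
         ((cl cv1 c≡ cr (cc E (cl cv0))) c∧ ((cl (cr cv1) c≡ cpr (cc X (cl cv0)) (cr cv0)) c∧ (ck 0 c< cr (cr cv1))))))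
  (Y c≡ ck 0))))))))))
  where
  lem : ∀ q e x y R t →
    (if t ≡ᵇ 1 then y ≡ᵇ suc x else if t ≡ᵇ 2 then y ≡ᵇ x else if t ≡ᵇ 3 then y ≡ᵇ fst x else if t ≡ᵇ 4 then y ≡ᵇ snd x else
     if t ≡ᵇ 5 then byTag q e x y R 5 else if t ≡ᵇ 6 then byTag q e x y R 6 else if t ≡ᵇ 7 then byTag q e x y R 7 else
     if t ≡ᵇ 8 then byTag q e x y R 8 else if t ≡ᵇ 9 then byTag q e x y R 9 else (y ≡ᵇ 0)) ≡ byTag q e x y R t
  lem q e x y R 0 = refl
  lem q e x y R 1 = refl
  lem q e x y R 2 = refl
  lem q e x y R 3 = refl
  lem q e x y R 4 = refl
  lem q e x y R 5 = refl
  lem q e x y R 6 = refl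
  lem q e x y R 7 = refl
  lem q e x y R 8 = refl
  lem q e x y R 9 = refl
  lem q e x y R (suc (suc (suc (suc (suc (suc (suc (suc (suc (suc _)))))))))) = refl

-- Here o w is the oracle coded by w; values other than 0 and 1 mean "not yet known".
module Cert (o : ℕ → ℕ → ℕ) where

  just : ℕ → ℕ → ℕ → Bool
  just w u R = byTag (o w (fx u)) (fe u) (fx u) (fy u) R (fst (fe u))

  valid : ℕ → ℕ → Bool
  valid w L = all L (λ k → (0 <ᵇ drop k L) ⇒ just w (nth k L) (drop (suc k) L))

  V : ℕ → ℕ → Set
  V w L = ∀ k → 0 < drop k L → just w (nth k L) (drop (suc k) L) ≡ true

  valid-V : ∀ {w L} → valid w L ≡ true → V w L
  valid-V {w} {L} h k p = ⇒-e (all-sound L _ h k (In-idx k L p)) (lt-complete p)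

  V-valid : ∀ {w L} → V w L → valid w L ≡ true
  V-valid {w} {L} v = all-complete L _ λ k _ → ⇒-i {0 <ᵇ drop k L} λ p → v k (lt-sound _ _ p)

  V-tl : ∀ {w L} → V w L → V w (tl L)
  V-tl {w} {L} v k p = subst (λ D → just w (hd D) (tl D) ≡ true) (drop-tl k L) (v (suc k) (subst (0 <_) (sym (drop-tl k L)) p))

  V-cons : ∀ {w a L} → just w a L ≡ true → V w L → V w (cons a L)
  V-cons {w} {a} {L} j v zero p rewrite hd-cons a L | tl-cons a L = j
  V-cons {w} {a} {L} j v (suc k) p = subst (λ D → just w (hd D) (tl D) ≡ true) (sym (drop-cons k a L)) (v k (subst (0 <_) (drop-cons k a L) p))

  just-mono : ∀ {w u R R′} → (∀ {u} → In u R → In u R′) → just w u R ≡ true → just w u R′ ≡ true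
  just-mono {w} {u} {R} {R′} sub = byTag-mono (o w (fx u)) (fe u) (fx u) (fy u) R R′ sub (fst (fe u))

  cvalid : ∀ {w L} → Cp2 o → Cp w → Cp L → CpB λ z → valid (w z) (L z)
  cvalid {w} {L} O W LL = call {λ z k → (0 <ᵇ drop k (L z)) ⇒ just (w z) (nth k (L z)) (drop (suc k) (L z))} LL
    ((ck 0 c< cdrop cv1 (cc LL cv0)) c⇒ cbyTag (ap2 {o} O (cc W cv0) (cl (cr N))) (cl N) (cl (cr N)) (cr (cr N)) (cdrop (cs cv1) (cc LL cv0)) (cl (cl N)))
    where N = cnth cv1 (cc LL cv0)

  module _ (X : ℕ → Bool) where
    True : ℕ → Set
    True u = Eval X (decode (fe u)) (fx u) (fy u)

    private
      fact-eval : ∀ {a b c} → True (fact a b c) → Eval X (decode a) b c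
      fact-eval {a} {b} {c} t rewrite fe-fact a b c | fx-fact a b c | fy-fact a b c = t

      atTag : ∀ {e t x y} → fst e ≡ t → Eval X (dcd t (snd e)) x y → Eval X (decode e) x y
      atTag {e} refl h = subst (λ c → Eval X c _ _) (sym (decode-dcd e)) h

    sound-step : ∀ w e x y R → (o w x < 2 → o w x ≡ b2n (X x)) → (∀ {u} → In u R → True u) →
      byTag (o w x) e x y R (fst e) ≡ true → Eval X (decode e) x y
    sound-step w e x y R ok ih h with fst e in eq
    ... | 0 = atTag eq (subst (Eval X Zero x) (sym (eq-sound _ _ h)) ezero)
    ... | 1 = atTag eq (subst (Eval X Succ x) (sym (eq-sound _ _ h)) esucc)
    ... | 2 = atTag eq (subst (Eval X Id x) (sym (eq-sound _ _ h)) eid)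
    ... | 3 = atTag eq (subst (Eval X Left x) (trans (cong proj₁ (unpair-def x)) (sym (eq-sound _ _ h))) eleft)
    ... | 4 = atTag eq (subst (Eval X Right x) (trans (cong proj₂ (unpair-def x)) (sym (eq-sound _ _ h))) eright)
    ... | 5 = atTag eq (subst (Eval X Oracle x) (trans (sym (ok (subst (_< 2) (sym oy) (lt-sound _ _ (∧-l h))))) oy) eorc)
      where
      oy : o w x ≡ y
      oy = eq-sound _ _ (∧-r {y <ᵇ 2} h)
    ... | 6 with exf-sound R _ h
    ... | v , i , p = atTag eq (ecomp (subst₂ (λ d z → Eval X (decode d) z (fy v)) p1 p2 (ih i)) (fact-eval (ih (mem-sound p3))))
      where
      p1 = eq-sound _ _ (∧-l p)
      p2 = eq-sound _ _ (∧-l (∧-r {fe v ≡ᵇ snd (snd e)} p))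
      p3 = ∧-r {fx v ≡ᵇ x} (∧-r {fe v ≡ᵇ snd (snd e)} p)
    sound-step w e x y R ok ih h | 7 = atTag eq (subst (Eval X (Pair _ _) x) (trans (sym (⟪⟫-def _ _)) (pair-fs y))
        (epair (fact-eval (ih (mem-sound (∧-l h)))) (fact-eval (ih (mem-sound (∧-r {mem (fact (fst (snd e)) x (fst y)) R} h))))))
    sound-step w e x y R ok ih h | 8 with snd x in ex
    ... | zero = atTag eq (eprec0 (trans (unpair-def x) (cong (fst x ,_) ex)) (fact-eval (ih (mem-sound h))))
    ... | suc n with exf-sound R _ h
    ... | v , i , p = atTag eq (eprecS (trans (unpair-def x) (cong (fst x ,_) ex))
          (subst₂ (λ c z → Eval X c z (fy v)) p1 p2 (ih i)) (subst (λ z → Eval X _ z y) (trans (⟪⟫-def _ _) (cong (λ z → pair z (fy v)) (⟪⟫-def _ _))) (fact-eval (ih (mem-sound p3)))))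
      where
      p1 : decode (fe v) ≡ dcd 8 (snd e)
      p1 = trans (cong decode (eq-sound (fe v) e (∧-l p))) (trans (decode-dcd e) (cong (λ t → dcd t (snd e)) eq))
      p2 : fx v ≡ pair (fst x) n
      p2 = trans (eq-sound _ _ (∧-l (∧-r {fe v ≡ᵇ e} p))) (⟪⟫-def _ _)
      p3 = ∧-r {fx v ≡ᵇ ⟪ fst x , n ⟫} (∧-r {fe v ≡ᵇ e} p)
    sound-step w e x y R ok ih h | 9 = atTag eq (emu (subst (λ z → Eval X _ z 0) (⟪⟫-def _ _) (fact-eval (ih (mem-sound (∧-l h)))))
        λ m l → below m (exf-sound R _ (all-sound y _ (∧-r {mem (fact (snd e) ⟪ x , y ⟫ 0) R} h) m l)))
      where
      below : ∀ m → (Σ ℕ λ v → In v R × ((fe v ≡ᵇ snd e) ∧ ((fx v ≡ᵇ ⟪ x , m ⟫) ∧ (0 <ᵇ fy v))) ≡ true) → Σ ℕ λ v → Eval X (decode (snd e)) (pair x m) (suc v)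
      below m (v , i , p) with fy v | ih i | lt-sound 0 (fy v) (∧-r {fx v ≡ᵇ ⟪ x , m ⟫} (∧-r {fe v ≡ᵇ snd e} p))
      ... | zero | t | ()
      ... | suc n | t | _ = n , subst₂ (λ d z → Eval X (decode d) z (suc n)) (eq-sound _ _ (∧-l p)) (trans (eq-sound _ _ (∧-l (∧-r {fe v ≡ᵇ snd e} p))) (⟪⟫-def _ _)) t
    sound-step w e x y R ok ih h | suc (suc (suc (suc (suc (suc (suc (suc (suc (suc n))))))))) = atTag eq (subst (Eval X Zero x) (sym (eq-sound _ _ h)) ezero)

    -- Every query is a component of an entry and thus smaller than the code of the list. So the
    -- list bounds its own use, and correct answers below `L` suffice.
    sound : ∀ w L → (∀ z → z < L → o w z < 2 → o w z ≡ b2n (X z)) → V w L → ∀ {u} → In u L → True u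
    sound w L₀ ok v i = go L₀ L₀ ≤-refl ≤-refl v i
      where
      fx< : ∀ L → 0 < L → L ≤ L₀ → fx (hd L) < L₀
      fx< L p l = <-≤-trans (≤-<-trans (≤-trans (fst≤ _) (snd≤ _)) (nth<drop 0 L p)) l
      go : ∀ n L → L ≤ n → L ≤ L₀ → V w L → ∀ {u} → In u L → True u
      go n L l l₀ v {u} i with In-cases i
      go (suc n) L l l₀ v {u} i | inj₁ (p , refl) = sound-step w _ _ _ (tl L) (ok _ (fx< L p l₀)) (go n (tl L) (≤-pred (≤-trans (tl< L p) l)) (≤-trans (<⇒≤ (tl< L p)) l₀) (V-tl v)) (v 0 p)
      go zero .0 z≤n l₀ v {u} i | inj₁ (() , _)
      go zero .0 z≤n l₀ v {u} i | inj₂ j = ⊥-elim (n≮0 (In< i))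
      go (suc n) L l l₀ v {u} i | inj₂ j = go n (tl L) (≤-pred (≤-trans tlL l)) (≤-trans (<⇒≤ tlL) l₀) (V-tl v) j
        where
        tlL : tl L < L
        tlL = tl< L (≤-<-trans z≤n (In< i))

    enc : List ℕ → ℕ
    enc [] = 0
    enc (u ∷ us) = cons u (enc us)

    In-here : ∀ u L → In u (cons u L)
    In-here u L = 0 , s≤s z≤n , hd-cons u L

    In-there : ∀ {v} u L → In v L → In v (cons u L)
    In-there u L i = In-tl (subst (In _) (sym (tl-cons u L)) i)

    In-++ˡ : ∀ us vs {u} → In u (enc us) → In u (enc (us ++ vs))
    In-++ˡ [] vs i = ⊥-elim (n≮0 (In< i))
    In-++ˡ (w ∷ us) vs i with In-cases i
    ... | inj₁ (_ , refl) = subst (λ z → In z (enc (w ∷ us ++ vs))) (sym (hd-cons w _)) (In-here w _)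
    ... | inj₂ j = In-there w _ (In-++ˡ us vs (subst (In _) (tl-cons w _) j))

    In-++ʳ : ∀ us vs {u} → In u (enc vs) → In u (enc (us ++ vs))
    In-++ʳ [] vs i = i
    In-++ʳ (w ∷ us) vs i = In-there w _ (In-++ʳ us vs i)

    -- Premises are looked up behind an entry, and a longer tail only offers more of them.
    V-++ : ∀ {w} us vs → V w (enc us) → V w (enc vs) → V w (enc (us ++ vs))
    V-++ [] vs a b = b
    V-++ {w} (u ∷ us) vs a b = V-cons (just-mono {w} {u} {enc us} (In-++ˡ us vs) hj) (V-++ us vs (subst (V w) (tl-cons u _) (V-tl a)) b)
      where
      hj : just w u (enc us) ≡ true
      hj = subst₂ (λ p r → just w p r ≡ true) (hd-cons u _) (tl-cons u _) (a 0 (s≤s z≤n))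

    enc-++ˡ : ∀ us vs → enc us ≤ enc (us ++ vs)
    enc-++ˡ [] vs = z≤n
    enc-++ˡ (u ∷ us) vs = s≤s (pair-mono {u} ≤-refl (enc-++ˡ us vs))

    enc-++ʳ : ∀ us vs → enc vs ≤ enc (us ++ vs)
    enc-++ʳ [] vs = ≤-refl
    enc-++ʳ (u ∷ us) vs = ≤-trans (enc-++ʳ us vs) (≤-trans (y≤pair u _) (n≤1+n _))

    enc-tl : ∀ u us → enc us ≤ enc (u ∷ us)
    enc-tl u us = ≤-trans (y≤pair u _) (n≤1+n _)

    Agree : ℕ → ℕ → Set
    Agree w n = ∀ q → q < n → o w q ≡ b2n (X q)

    -- The use principle is built in: one list has to be valid for every `w` that answers like `X`
    -- below the code of that list.
    record Pf (Goal : ℕ → Set) : Set where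
      constructor pf
      field
        us   : List ℕ
        vus  : ∀ w → Agree w (enc us) → V w (enc us)
        goal : Goal (enc us)
    open Pf

    Agree-≤ : ∀ {w m n} → m ≤ n → Agree w n → Agree w m
    Agree-≤ l a q p = a q (≤-trans p l)

    joinPf : ∀ {G H} → Pf (λ L → In G L) → Pf (λ L → In H L) → Pf λ L → In G L × In H L
    joinPf (pf us a g) (pf vs b h) = pf (us ++ vs) (λ w ag → V-++ us vs (a w (Agree-≤ (enc-++ˡ us vs) ag)) (b w (Agree-≤ (enc-++ʳ us vs) ag))) (In-++ˡ us vs g , In-++ʳ us vs h)

    addPf : ∀ {Goal : ℕ → Set} e x y → (p : Pf Goal) → (∀ L → Goal L → ∀ w → x < enc (fact e x y ∷ us p) → Agree w (enc (fact e x y ∷ us p)) → byTag (o w x) e x y L (fst e) ≡ true) → Pf λ L → In (fact e x y) L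
    addPf e x y (pf us a g) st = pf (fact e x y ∷ us) (λ w ag → V-cons (lem w (st (enc us) g w x< ag)) (a w (Agree-≤ (enc-tl _ us) ag))) (In-here _ _)
      where
      x< : x < enc (fact e x y ∷ us)
      x< = s≤s (≤-trans (x≤pair x y) (≤-trans (y≤pair e _) (x≤pair _ _)))
      lem : ∀ w → byTag (o w x) e x y (enc us) (fst e) ≡ true → just w (fact e x y) (enc us) ≡ true
      lem w h rewrite fe-fact e x y | fx-fact e x y | fy-fact e x y = h

    nilPf : Pf (λ _ → 0 ≡ 0)
    nilPf = pf [] (λ w ag k p → ⊥-elim (<-irrefl (sym (drop0 k)) p)) refl

    private
      inv6 : ∀ t r {f g} → dcd t r ≡ Comp f g → t ≡ 6 × decode (fst r) ≡ f × decode (snd r) ≡ g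
      inv6 6 r refl = refl , refl , refl
      inv6 0 r ()
      inv6 1 r ()
      inv6 2 r ()
      inv6 3 r ()
      inv6 4 r ()
      inv6 5 r ()
      inv6 7 r ()
      inv6 8 r ()
      inv6 9 r ()
      inv6 (suc (suc (suc (suc (suc (suc (suc (suc (suc (suc _)))))))))) r ()
      inv7 : ∀ t r {f g} → dcd t r ≡ Pair f g → t ≡ 7 × decode (fst r) ≡ f × decode (snd r) ≡ g
      inv7 7 r refl = refl , refl , refl
      inv7 0 r ()
      inv7 1 r ()
      inv7 2 r ()
      inv7 3 r ()
      inv7 4 r ()
      inv7 5 r ()
      inv7 6 r ()
      inv7 8 r ()
      inv7 9 r ()
      inv7 (suc (suc (suc (suc (suc (suc (suc (suc (suc (suc _)))))))))) r ()
      inv8 : ∀ t r {f g} → dcd t r ≡ Prec f g → t ≡ 8 × decode (fst r) ≡ f × decode (snd r) ≡ g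
      inv8 8 r refl = refl , refl , refl
      inv8 0 r ()
      inv8 1 r ()
      inv8 2 r ()
      inv8 3 r ()
      inv8 4 r ()
      inv8 5 r ()
      inv8 6 r ()
      inv8 7 r ()
      inv8 9 r ()
      inv8 (suc (suc (suc (suc (suc (suc (suc (suc (suc (suc _)))))))))) r ()
      inv9 : ∀ t r {f} → dcd t r ≡ Mu f → t ≡ 9 × decode r ≡ f
      inv9 9 r refl = refl , refl
      inv9 0 r ()
      inv9 1 r ()
      inv9 2 r ()
      inv9 3 r ()
      inv9 4 r ()
      inv9 5 r ()
      inv9 6 r ()
      inv9 7 r ()
      inv9 8 r ()
      inv9 (suc (suc (suc (suc (suc (suc (suc (suc (suc (suc _)))))))))) r ()
      at0 : ∀ q e x R t r → dcd t r ≡ Zero → byTag q e x 0 R t ≡ true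
      at0 q e x R 0 r _ = refl
      at0 q e x R (suc (suc (suc (suc (suc (suc (suc (suc (suc (suc _)))))))))) r _ = refl
      at1 : ∀ q e x R t r → dcd t r ≡ Succ → byTag q e x (suc x) R t ≡ true
      at1 q e x R 1 r _ = eq-refl x
      at1 q e x R (suc (suc (suc (suc (suc (suc (suc (suc (suc (suc _)))))))))) r ()
      at2 : ∀ q e x R t r → dcd t r ≡ Id → byTag q e x x R t ≡ true
      at2 q e x R 2 r _ = eq-refl x
      at2 q e x R (suc (suc (suc (suc (suc (suc (suc (suc (suc (suc _)))))))))) r ()
      at3 : ∀ q e x R t r → dcd t r ≡ Left → byTag q e x (fst x) R t ≡ true
      at3 q e x R 3 r _ = eq-refl (fst x)
      at3 q e x R (suc (suc (suc (suc (suc (suc (suc (suc (suc (suc _)))))))))) r ()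
      at4 : ∀ q e x R t r → dcd t r ≡ Right → byTag q e x (snd x) R t ≡ true
      at4 q e x R 4 r _ = eq-refl (snd x)
      at4 q e x R (suc (suc (suc (suc (suc (suc (suc (suc (suc (suc _)))))))))) r ()
      at5 : ∀ e x b R t r → dcd t r ≡ Oracle → byTag (b2n b) e x (b2n b) R t ≡ true
      at5 e x true R 5 r _ = refl
      at5 e x false R 5 r _ = refl
      at5 e x b R (suc (suc (suc (suc (suc (suc (suc (suc (suc (suc _)))))))))) r ()

      at : ∀ {e t q x y R} → fst e ≡ t → byTag q e x y R t ≡ true → byTag q e x y R (fst e) ≡ true
      at refl h = h

    complete : ∀ {c x y} → Eval X c x y → ∀ e → decode e ≡ c → Pf λ L → In (fact e x y) L
    -- Minimization is the only rule with a variable number of premises; their lists are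
    -- concatenated one by one.
    belowPf : ∀ {f x} n → (∀ m → m < n → Σ ℕ λ v → Eval X f (pair x m) (suc v)) → ∀ r → decode r ≡ f →
      (∀ m → (l : m < n) → Σ ℕ λ v → Pf λ L → In (fact r ⟪ x , m ⟫ (suc v)) L) → Pf λ L → ∀ m → m < n → Σ ℕ λ v → In (fact r ⟪ x , m ⟫ (suc v)) L

    complete ezero e d = addPf e _ _ nilPf λ L _ w _ _ → at0 _ e _ L (fst e) (snd e) (trans (sym (decode-dcd e)) d)
    complete esucc e d = addPf e _ _ nilPf λ L _ w _ _ → at1 _ e _ L (fst e) (snd e) (trans (sym (decode-dcd e)) d)
    complete eid e d = addPf e _ _ nilPf λ L _ w _ _ → at2 _ e _ L (fst e) (snd e) (trans (sym (decode-dcd e)) d)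
    complete (eleft {x}) e d = subst (λ y → Pf λ L → In (fact e x y) L) (sym (cong proj₁ (unpair-def x)))
      (addPf e _ _ nilPf λ L _ w _ _ → at3 _ e _ L (fst e) (snd e) (trans (sym (decode-dcd e)) d))
    complete (eright {x}) e d = subst (λ y → Pf λ L → In (fact e x y) L) (sym (cong proj₂ (unpair-def x)))
      (addPf e _ _ nilPf λ L _ w _ _ → at4 _ e _ L (fst e) (snd e) (trans (sym (decode-dcd e)) d))
    complete (eorc {x}) e d = addPf e x _ nilPf λ L _ w x< ag →
      subst (λ z → byTag z e x (b2n (X x)) L (fst e) ≡ true) (sym (ag x x<)) (at5 e x (X x) L (fst e) (snd e) (trans (sym (decode-dcd e)) d))
    complete (ecomp {x = x} {y = z} {z = y} p q) e d with inv6 (fst e) (snd e) (trans (sym (decode-dcd e)) d)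
    ... | t6 , df , dg = addPf e x y (joinPf (complete p (snd (snd e)) dg) (complete q (fst (snd e)) df)) λ where
      L (i , j) w _ _ → at t6 (exf-complete L _ (fact (snd (snd e)) x z) i
        (∧-i (eq-complete (fe-fact _ _ _)) (∧-i (eq-complete (fx-fact _ _ _)) (mem-complete (subst (λ u → In (fact (fst (snd e)) u y) L) (sym (fy-fact (snd (snd e)) x z)) j)))))
    complete (epair {x = x} {a = a} {b = b} p q) e d with inv7 (fst e) (snd e) (trans (sym (decode-dcd e)) d)
    ... | t7 , df , dg = subst (λ y → Pf λ L → In (fact e x y) L) (⟪⟫-def a b)
      (addPf e x ⟪ a , b ⟫ (joinPf (complete p (fst (snd e)) df) (complete q (snd (snd e)) dg)) λ where
        L (i , j) w _ _ → at t7 (∧-i (mem-complete (subst (λ u → In (fact (fst (snd e)) x u) L) (sym (fst-pair a b)) i))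
                                     (mem-complete (subst (λ u → In (fact (snd (snd e)) x u) L) (sym (snd-pair a b)) j))))
    complete (eprec0 {x = x} {a = a} {y = y} u p) e d with inv8 (fst e) (snd e) (trans (sym (decode-dcd e)) d)
    ... | t8 , df , dg = addPf e x y (complete p (fst (snd e)) df) λ L i w _ _ → at t8 (lem {o w x} L i)
      where
      ux : (fst x , snd x) ≡ (a , 0)
      ux = trans (sym (unpair-def x)) u
      lem : ∀ {q} L → In (fact (fst (snd e)) a y) L → byTag q e x y L 8 ≡ true
      lem L i with snd x | cong proj₂ ux
      ... | zero | _ = mem-complete (subst (λ z → In (fact (fst (snd e)) z y) L) (sym (cong proj₁ ux)) i)
    complete (eprecS {x = x} {a = a} {n = n} {v = v} {y = y} u p q) e d with inv8 (fst e) (snd e) (trans (sym (decode-dcd e)) d)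
    ... | t8 , df , dg = addPf e x y (joinPf (complete p e d) (complete q (snd (snd e)) dg)) λ where
        L (i , j) w _ _ → at t8 (lem {o w x} L i j)
      where
      ux : (fst x , snd x) ≡ (a , suc n)
      ux = trans (sym (unpair-def x)) u
      lem : ∀ {q} L → In (fact e (pair a n) v) L → In (fact (snd (snd e)) (pair (pair a n) v) y) L → byTag q e x y L 8 ≡ true
      lem L i j with snd x | cong proj₂ ux
      ... | suc .n | refl = exf-complete L _ (fact e (pair a n) v) i
        (∧-i (eq-complete (fe-fact _ _ _)) (∧-i (eq-complete (trans (fx-fact e (pair a n) v) an)) (mem-complete (subst (λ z → In (fact (snd (snd e)) z y) L)
          (trans (sym (⟪⟫-def _ _)) (cong₂ ⟪_,_⟫ an (sym (fy-fact e (pair a n) v)))) j))))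
        where
        an : pair a n ≡ ⟪ fst x , n ⟫
        an = trans (sym (⟪⟫-def a n)) (cong (λ z → ⟪ z , n ⟫) (sym (cong proj₁ ux)))
    complete (emu {x = x} {n = n} p h) e d with inv9 (fst e) (snd e) (trans (sym (decode-dcd e)) d)
    ... | t9 , df = addPf e x n both λ where
        L (i , j) w _ _ → at t9 (∧-i (mem-complete (subst (λ z → In (fact (snd e) z 0) L) (sym (⟪⟫-def x n)) i))
          (all-complete n _ λ m l → exf-complete L _ (fact (snd e) ⟪ x , m ⟫ (suc (proj₁ (j m l)))) (proj₂ (j m l))
            (∧-i (eq-complete (fe-fact _ _ _)) (∧-i (eq-complete (fx-fact _ _ _)) (lt-complete (subst (0 <_) (sym (fy-fact (snd e) ⟪ x , m ⟫ (suc (proj₁ (j m l))))) (s≤s z≤n)))))))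
      where
      p1 = complete p (snd e) df
      p2 = belowPf n h (snd e) df λ m l → proj₁ (h m l) , subst (λ z → Pf λ L → In (fact (snd e) z (suc (proj₁ (h m l)))) L) (sym (⟪⟫-def x m)) (complete (proj₂ (h m l)) (snd e) df)
      both : Pf λ L → In (fact (snd e) (pair x n) 0) L × (∀ m → m < n → Σ ℕ λ v → In (fact (snd e) ⟪ x , m ⟫ (suc v)) L)
      both = pf (us p1 ++ us p2) (λ w ag → V-++ (us p1) (us p2) (vus p1 w (Agree-≤ (enc-++ˡ (us p1) (us p2)) ag)) (vus p2 w (Agree-≤ (enc-++ʳ (us p1) (us p2)) ag)))
        (In-++ˡ (us p1) (us p2) (goal p1) , λ m l → proj₁ (goal p2 m l) , In-++ʳ (us p1) (us p2) (proj₂ (goal p2 m l)))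

    belowPf zero h r d c = pf [] (vus nilPf) λ _ ()
    belowPf {f} {x} (suc n) h r d c = pf (us p1 ++ us p2) (λ w ag → V-++ (us p1) (us p2) (vus p1 w (Agree-≤ (enc-++ˡ (us p1) (us p2)) ag)) (vus p2 w (Agree-≤ (enc-++ʳ (us p1) (us p2)) ag)))
        λ m l → pick m (m≤n⇒m<n∨m≡n (≤-pred l))
      where
      p1 = proj₂ (c n ≤-refl)
      p2 = belowPf n (λ m l → h m (≤-trans l (n≤1+n n))) r d λ m l → c m (≤-trans l (n≤1+n n))
      pick : ∀ m → m < n ⊎ m ≡ n → Σ ℕ λ v → In (fact r ⟪ x , m ⟫ (suc v)) (enc (us p1 ++ us p2))
      pick m (inj₁ l) = proj₁ (goal p2 m l) , In-++ʳ (us p1) (us p2) (proj₂ (goal p2 m l))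
      pick m (inj₂ refl) = proj₁ (c n ≤-refl) , In-++ˡ (us p1) (us p2) (goal p1)

    V-drop : ∀ {w L} k → V w L → V w (drop k L)
    V-drop zero v = v
    V-drop (suc k) v = V-tl (V-drop k v)

    -- Whatever stands before the wanted fact is dropped, since the tests inspect only the head of a
    -- valid list.
    certificate : ∀ {e x y} → Eval X (decode e) x y → Σ ℕ λ L → 0 < L × hd L ≡ fact e x y × Σ ℕ λ n → ∀ w → Agree w n → V w L
    certificate {e} h with complete h e refl
    ... | pf us vs (k , p , eq) = drop k (enc us) , p , eq , enc us , λ w ag → V-drop k (vs w ag)

-- Approximating functions computable from the halting set

emptyOracle : ℕ → ℕ → ℕ
emptyOracle _ _ = 0

module C0 = Cert emptyOracle

haltBy : ℕ → ℕ → Bool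
haltBy s e = any s (λ L → (0 <ᵇ L) ∧ (C0.valid 0 L ∧ ((fe (hd L) ≡ᵇ e) ∧ (fx (hd L) ≡ᵇ e))))

haltOracle : ℕ → ℕ → ℕ
haltOracle s x = b2n (haltBy s x)

module CK = Cert haltOracle

guessTest : ℕ → ℕ → ℕ → ℕ → Bool
guessTest i s X L = (0 <ᵇ L) ∧ (CK.valid s L ∧ ((fe (hd L) ≡ᵇ i) ∧ (fx (hd L) ≡ᵇ X)))

-- If no list below `s` passes the test, the value is arbitrary. This is harmless, because only the
-- limit in `s` is ever used.
guess : ℕ → ℕ → ℕ → ℕ
guess i s X = fy (hd (least s (guessTest i s X)))

chaltBy : ∀ {s x} → Cp s → Cp x → CpB λ e → haltBy (s e) (x e)
chaltBy {s} {x} S X = cany {λ e L → (0 <ᵇ L) ∧ (C0.valid 0 L ∧ ((fe (hd L) ≡ᵇ x e) ∧ (fx (hd L) ≡ᵇ x e)))} S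
  ((ck 0 c< cv1) c∧ (C0.cvalid (ck 0) (ck 0) cv1 c∧ ((cl (chd cv1) c≡ cc X cv0) c∧ (cl (cr (chd cv1)) c≡ cc X cv0))))

cguess : ∀ {i s x} → Cp i → Cp s → Cp x → Cp λ e → guess (i e) (s e) (x e)
cguess {i} {s} {x} I S X = cr (cr (chd (cleast {λ e L → guessTest (i e) (s e) (x e) L} S
  ((ck 0 c< cv1) c∧ (CK.cvalid (chaltBy cv0 cv1) (cc S cv0) cv1 c∧ ((cl (chd cv1) c≡ cc I cv0) c∧ (cl (cr (chd cv1)) c≡ cc X cv0)))))))

Eventually : (ℕ → Set) → Set
Eventually P = Σ ℕ λ s₀ → ∀ s → s₀ ≤ s → P s

ev-map : ∀ {P Q : ℕ → Set} → (∀ s → P s → Q s) → Eventually P → Eventually Q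
ev-map f (s₀ , h) = s₀ , λ s l → f s (h s l)

ev-× : ∀ {P Q : ℕ → Set} → Eventually P → Eventually Q → Eventually λ s → P s × Q s
ev-× (a , p) (b , q) = a ⊔ b , λ s l → p s (≤-trans (m≤m⊔n a b) l) , q s (≤-trans (m≤n⊔m a b) l)

ev-≥ : ∀ n → Eventually (n ≤_)
ev-≥ n = n , λ s l → l

ev-all : ∀ {P : ℕ → ℕ → Set} n → (∀ k → k < n → Eventually (P k)) → Eventually λ s → ∀ k → k < n → P k s
ev-all zero h = 0 , λ _ _ _ ()
ev-all {P} (suc n) h = ev-map (λ s pq k l → lem s pq k (m≤n⇒m<n∨m≡n (≤-pred l))) (ev-× (ev-all n λ k l → h k (≤-trans l (n≤1+n n))) (h n ≤-refl))
  where
  lem : ∀ s → (∀ k → k < n → P k s) × P n s → ∀ k → k < n ⊎ k ≡ n → P k s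
  lem s (p , q) k (inj₁ l) = p k l
  lem s (p , q) k (inj₂ refl) = q

haltBy-settles : ∀ K → IsHaltingSet K → ∀ e → Eventually λ s → haltBy s e ≡ K e
haltBy-settles K isK e with K e in eq
... | true with proj₁ (isK e) eq
...   | y , h with C0.certificate ∅ {e} h
...     | L , pos , hdL , n , v = suc L , λ s l → any-complete s _ L l (∧-i (lt-complete pos) (∧-i (C0.V-valid {0} {L} (v 0 (λ _ _ → refl)))
            (∧-i (eq-complete (trans (cong fe hdL) (fe-fact _ _ _))) (eq-complete (trans (cong fx hdL) (fx-fact _ _ _))))))
haltBy-settles K isK e | false = 0 , λ s _ → ≢true⇒false λ h → clash (never s (any-sound s _ h)) eq
  where
  never : ∀ s → (Σ ℕ λ L → L < s × ((0 <ᵇ L) ∧ (C0.valid 0 L ∧ ((fe (hd L) ≡ᵇ e) ∧ (fx (hd L) ≡ᵇ e)))) ≡ true) → K e ≡ true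
  never s (L , _ , t) = proj₂ (isK e) (_ , subst₂ (λ a b → Eval ∅ (decode a) b (fy (hd L))) (eq-sound _ _ (∧-l t3)) (eq-sound _ _ (∧-r {fe (hd L) ≡ᵇ e} t3))
      (C0.sound ∅ 0 L (λ _ _ _ → refl) (C0.valid-V {0} {L} (∧-l t2)) (In-hd L (lt-sound 0 L (∧-l t)))))
    where
    t2 = ∧-r {0 <ᵇ L} t
    t3 = ∧-r {C0.valid 0 L} t2

-- This is the limit lemma. Once the stage agrees with `K` far enough, the true certificate `L`
-- passes the test. The least passing list is then at most `L`, so its queries are answered
-- correctly too, and determinism identifies the outputs.
guess-settles : ∀ K → IsHaltingSet K → ∀ {i X y} → Eval K (decode i) X y → Eventually λ s → guess i s X ≡ y
guess-settles K isK {i} {X} {y} h with CK.certificate K {i} h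
... | L , pos , hdL , n , v = ev-map go (ev-× (ev-≥ (suc L)) (ev-all (suc L ⊔ n) λ k _ → haltBy-settles K isK k))
  where
  go : ∀ s → suc L ≤ s × (∀ k → k < suc L ⊔ n → haltBy s k ≡ K k) → guess i s X ≡ y
  go s (l , agr) with least s (guessTest i s X) | least-spec s (guessTest i s X)
  ... | r | sp = good r (bound r sp) (proj₂ (isTest r sp))
    where
    testL : guessTest i s X L ≡ true
    testL = ∧-i (lt-complete pos) (∧-i (CK.V-valid {s} {L} (v s (λ q q<n → cong b2n (agr q (<-≤-trans q<n (m≤n⊔m (suc L) n))))))
            (∧-i (eq-complete (trans (cong fe hdL) (fe-fact _ _ _))) (eq-complete (trans (cong fx hdL) (fx-fact _ _ _)))))
    isTest : ∀ r → Least s (guessTest i s X) r → r < s × guessTest i s X r ≡ true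
    isTest r (none _ hi) = clash testL (hi L l)
    isTest r (found a b _) = a , b
    bound : ∀ r → Least s (guessTest i s X) r → r ≤ L
    bound r (none _ hi) = clash testL (hi L l)
    bound r (found _ _ lo) with <-≤-connex L r
    ... | inj₁ L<r = clash testL (lo L L<r)
    ... | inj₂ r≤L = r≤L
    good : ∀ r → r ≤ L → guessTest i s X r ≡ true → fy (hd r) ≡ y
    good r r≤L t = det (subst₂ (λ a b → Eval K (decode a) b (fy (hd r))) (eq-sound _ _ (∧-l t3)) (eq-sound _ _ (∧-r {fe (hd r) ≡ᵇ i} t3))
        (CK.sound K s r (λ z z<r _ → cong b2n (agr z (<-≤-trans z<r (≤-trans r≤L (≤-trans (n≤1+n L) (m≤m⊔n (suc L) n)))))) (CK.valid-V {s} {r} (∧-l t2)) (In-hd r (lt-sound 0 r (∧-l t))))) h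
      where
      t2 = ∧-r {0 <ᵇ r} t
      t3 = ∧-r {CK.valid s r} t2

-- The construction

-- The default 2 is no legitimate answer, so a query beyond the end of the string can never be
-- justified in a valid list.
strOracle : ℕ → ℕ → ℕ
strOracle τ x = if x <ᵇ len τ then b2n (bit τ x) else 2

module CS = Cert strOracle

cstrOracle : Cp2 strOracle
cstrOracle = cif (cv1 c< cl cv0) (cbit cv0 cv1) (ck 2)

below : (ℕ → Bool) → ℕ → ℕ → Bool
below h m p = if fst p <ᵇ m then h p else false

strOf : ℕ → ℕ
strOf v = fst (pred v)

-- Requirement i owns columns dbl i and suc (dbl i). A position of column suc (dbl j) lying in h is a
-- marker of requirement j: at position p it announces that the string h ↾ p is being forced.
marker : (ℕ → Bool) → ℕ → ℕ → Bool
marker h i p = (fst p <ᵇ dbl i) ∧ ((par (fst p) ≡ᵇ 1) ∧ h p)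

topMarker : (ℕ → Bool) → ℕ → ℕ → ℕ
topMarker h i s = last s (marker h i)

owner : ℕ → ℕ
owner p = half (fst p)

-- cn j t is the candidate of requirement j at stage t: 0 if there is none, and otherwise the
-- successor of ⟪ τ , ⟪ X , L ⟫ ⟫, where L certifies a computation with oracle string τ and input X.
module _ (h : ℕ → Bool) (cn : ℕ → ℕ → ℕ) where

  -- Column dbl j omits t exactly when the candidate at stage t is final, so t reveals which string
  -- of length p requirement j is forcing.
  explains : ℕ → ℕ → ℕ → ℕ → Bool
  explains j s p t = (⟪ dbl j , t ⟫ <ᵇ s) ∧ (not (h ⟪ dbl j , t ⟫) ∧ ((0 <ᵇ cn j t) ∧ (len (strOf (cn j t)) ≡ᵇ p)))

  explanation : ℕ → ℕ → ℕ
  explanation s p = least s (explains (owner p) s p)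

  forced : ℕ → ℕ → ℕ
  forced s p = strOf (cn (owner p) (explanation s p))

  -- Here `m` is a value of `topMarker`: 0 means that no marker is visible, and `suc p` that the
  -- last one is at `p`.
  explained : ℕ → ℕ → Bool
  explained s m = (m ≡ᵇ 0) ∨ (explanation s (pred m) <ᵇ s)

  follow : ℕ → ℕ → ℕ → Bool
  follow s m q = (0 <ᵇ m) ∧ ((explanation s (pred m) <ᵇ s) ∧ ((q <ᵇ pred m) ∧ bit (forced s (pred m)) q))

  -- The number `snd q` is read as a stage. The test `m <ᵇ suc q` leaves all positions up to the
  -- last marker to `follow`, which protects what has been forced.
  ownT : ℕ → ℕ → ℕ → ℕ → Bool
  ownT i s m q = (par (fst q) ≡ᵇ 0) ∧ ((m <ᵇ suc q) ∧ ((snd q <ᵇ suc s) ∧ ((cn i (snd q) ≡ᵇ 0) ∨ not (cn i (snd q) ≡ᵇ cn i s))))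

  ownW : ℕ → ℕ → ℕ → ℕ → Bool
  ownW i s m q = (par (fst q) ≡ᵇ 1) ∧ ((m <ᵇ suc q) ∧ any s (explains i s q))

  -- q is enumerated at stage s: to copy a forced string, because its requirement changed its mind
  -- (even columns), or as a marker (odd columns). Only columns before that of q are consulted.
  entersWith : ℕ → ℕ → ℕ → Bool
  entersWith q s m = follow s m q ∨ (ownT (owner q) s m q ∨ ownW (owner q) s m q)

  enters : ℕ → ℕ → Bool
  enters q s = entersWith q s (topMarker h (owner q) s)

-- Requirement i may force τ: τ extends what is already forced, looks as if requirement i never had a
-- final candidate, and contains whatever later columns enumerate on seeing an initial segment of τ.
module _ (h : ℕ → Bool) (cn cn′ : ℕ → ℕ → ℕ) (i s m τ : ℕ) where

  admBit : ℕ → Bool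
  admBit q = ((fst q <ᵇ dbl i) ⇒ (bit τ q == h q)) ∧
            (((suc q <ᵇ m) ⇒ (bit τ q == bit (forced h cn s (pred m)) q)) ∧
            (((m <ᵇ suc q) ⇒ (((fst q ≡ᵇ dbl i) ⇒ bit τ q) ∧ ((fst q ≡ᵇ suc (dbl i)) ⇒ not (bit τ q)))) ∧
             ((suc (dbl i) <ᵇ fst q) ⇒ (bit τ q ∨ all (suc (len τ)) (λ s′ → not (enters (bit τ) cn′ q s′))))))

  adm : Bool
  -- The length must itself be a position of column `suc (dbl i)`, so that it can serve as the
  -- marker for `τ`.
  adm = (fst (len τ) ≡ᵇ suc (dbl i)) ∧ ((m <ᵇ suc (len τ)) ∧ all (len τ) admBit)

candX candL : ℕ → ℕ
candX c = fst (snd c)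
candL c = snd (snd c)

refutes : ℕ → ℕ → ℕ → Bool
refutes i s c = (0 <ᵇ candL c) ∧ (CS.valid (fst c) (candL c) ∧ ((fe (hd (candL c)) ≡ᵇ fst i) ∧
  ((fx (hd (candL c)) ≡ᵇ candX c) ∧ not (guess (snd i) s (candX c) ≡ᵇ fy (hd (candL c))))))

-- The bound makes the mutual recursion of candidates and enumeration well-founded on codes.
fits : ℕ → ℕ → Bool
fits c s = (str (λ _ → true) c + c) <ᵇ s

pick : ℕ → (ℕ → Bool) → ℕ
pick s P = if least s P <ᵇ s then suc (least s P) else 0

-- The recursion is left open: `cn` stands for the candidates computed from `h`, and `cn′ τ` for
-- those computed from the string `τ`. The knot is tied in `candidateCode`.
module _ (h : ℕ → Bool) (cn : ℕ → ℕ → ℕ) (cn′ : ℕ → ℕ → ℕ → ℕ) (i s : ℕ) where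

  status : ℕ → ℕ → Bool
  status m c = fits c s ∧ (adm h cn (cn′ (fst c)) i s m (fst c) ∧ refutes i s c)

  chosenWith : ℕ → ℕ
  chosenWith m = if explained h cn s m then pick s (status m) else 0

  chosen : ℕ
  chosen = chosenWith (topMarker h i s)

-- A call is a single number, made of the visible part of the columns before `dbl j` and of `j`.
-- Erasing the other columns makes it evident that candidates cannot depend on them.
candidateVia : (ℕ → ℕ) → (ℕ → Bool) → ℕ → ℕ → ℕ
candidateVia c h j t = c ⟪ str (below h (dbl j)) t , j ⟫

choose : (ℕ → ℕ) → ℕ → ℕ
choose c x = chosen (bit (fst x)) (candidateVia c (bit (fst x))) (λ τ → candidateVia c (bit τ)) (snd x) (len (fst x))

-- Course-of-values recursion for the candidates

look : ℕ → ℕ → ℕ → ℕ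
look k r y = nth (k ∸ suc y) r

memo : (ℕ → ℕ → ℕ) → ℕ → ℕ
memo g n = natrec 0 (λ k r → cons (g k r) r) n

look-memo : ∀ g x y → y < x → look x (memo g x) y ≡ g y (memo g y)
look-memo g (suc x) y y<sx with m≤n⇒m<n∨m≡n (≤-pred y<sx)
... | inj₂ refl = trans (cong (λ k → nth k (memo g (suc y))) (n∸n≡0 y)) (hd-cons (g y (memo g y)) (memo g y))
... | inj₁ y<x = trans (cong (λ k → nth k (memo g (suc x))) (+-∸-assoc 1 y<x)) (trans (nth-cons (x ∸ suc y) (g x (memo g x)) (memo g x)) (look-memo g x y y<x))

stage : ℕ → ℕ → ℕ
stage k r = choose (look k r) k

-- Computability of the construction

module _ {h : ℕ → ℕ → Bool} (H : CpB2 h) where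
  hAt : ∀ {p q} → Cp p → Cp q → CpB λ e → h (p e) (q e)
  hAt P Q = ap2 {λ e p → b2n (h e p)} H P Q

cmarker : ∀ {h : ℕ → ℕ → Bool} {i p} → CpB2 h → Cp i → Cp p → CpB λ e → marker (h e) (i e) (p e)
cmarker {h} H I P = (cl P c< cdbl I) c∧ ((cpar (cl P) c≡ ck 1) c∧ hAt {h} H cid P)

ctopMarker : ∀ {h : ℕ → ℕ → Bool} {i s} → CpB2 h → Cp i → Cp s → Cp λ e → topMarker (h e) (i e) (s e)
ctopMarker {h} {i} {s} H I S = clast {λ e → marker (h e) (i e)} S (cmarker {h = λ z → h (fst z)} (hAt {h} H (cl cv0) cv1) (cc I cv0) cv1)

module _ {h : ℕ → ℕ → Bool} {cn : ℕ → ℕ → ℕ → ℕ} (H : CpB2 h) (N : Cp3 cn) where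

  nAt : ∀ {a j t} → Cp a → Cp j → Cp t → Cp λ e → cn (a e) (j e) (t e)
  nAt A J T = ap3 {cn} N A J T

  wkH : CpB2 (λ z → h (fst z))
  wkH = hAt {h} H (cl cv0) cv1

  wkN : Cp3 (λ z → cn (fst z))
  wkN = nAt (cl (cl cv0)) (cr cv0) cv1

cexplains : ∀ {h : ℕ → ℕ → Bool} {cn : ℕ → ℕ → ℕ → ℕ} {j s p t} → CpB2 h → Cp3 cn → Cp j → Cp s → Cp p → Cp t →
  CpB λ e → explains (h e) (cn e) (j e) (s e) (p e) (t e)
cexplains {h} {cn} H N J S P T = (cpr (cdbl J) T c< S) c∧ (cnot (hAt {h} H cid (cpr (cdbl J) T)) c∧
  ((ck 0 c< ap3 {cn} N cid J T) c∧ (cl (cl (cpred (ap3 {cn} N cid J T))) c≡ P)))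

cexplanation : ∀ {h : ℕ → ℕ → Bool} {cn : ℕ → ℕ → ℕ → ℕ} {s p} → CpB2 h → Cp3 cn → Cp s → Cp p → Cp λ e → explanation (h e) (cn e) (s e) (p e)
cexplanation {h} {cn} {s} {p} H N S P = cleast {λ e → explains (h e) (cn e) (owner (p e)) (s e) (p e)} S
  (cexplains {λ z → h (fst z)} {λ z → cn (fst z)} (wkH {h} {cn} H N) (wkN {h} {cn} H N) (chalf (cl (cc P cv0))) (cc S cv0) (cc P cv0) cv1)

cforced : ∀ {h : ℕ → ℕ → Bool} {cn : ℕ → ℕ → ℕ → ℕ} {s p} → CpB2 h → Cp3 cn → Cp s → Cp p → Cp λ e → forced (h e) (cn e) (s e) (p e)
cforced {h} {cn} H N S P = cl (cpred (ap3 {cn} N cid (chalf (cl P)) (cexplanation {h} {cn} H N S P)))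

centersWith : ∀ {h : ℕ → ℕ → Bool} {cn : ℕ → ℕ → ℕ → ℕ} {q s m} → CpB2 h → Cp3 cn → Cp q → Cp s → Cp m → CpB λ e → entersWith (h e) (cn e) (q e) (s e) (m e)
centersWith {h} {cn} {q} {s} {m} H N Q S M =
  ((ck 0 c< M) c∧ ((cexplanation {h} {cn} H N S (cpred M) c< S) c∧ ((Q c< cpred M) c∧ cbit (cforced {h} {cn} H N S (cpred M)) Q))) c∨
  (((cpar (cl Q) c≡ ck 0) c∧ ((M c< cs Q) c∧ ((cr Q c< cs S) c∧ ((nn (cr Q) c≡ ck 0) c∨ cnot (nn (cr Q) c≡ nn S))))) c∨
   ((cpar (cl Q) c≡ ck 1) c∧ ((M c< cs Q) c∧ cany {λ e → explains (h e) (cn e) (owner (q e)) (s e) (q e)} S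
     (cexplains {λ z → h (fst z)} {λ z → cn (fst z)} (wkH {h} {cn} H N) (wkN {h} {cn} H N) (chalf (cl (cc Q cv0))) (cc S cv0) (cc Q cv0) cv1))))
  where
  nn : ∀ {t} → Cp t → Cp λ e → cn e (owner (q e)) (t e)
  nn T = ap3 {cn} N cid (chalf (cl Q)) T

centers : ∀ {h : ℕ → ℕ → Bool} {cn : ℕ → ℕ → ℕ → ℕ} {q s} → CpB2 h → Cp3 cn → Cp q → Cp s → CpB λ e → enters (h e) (cn e) (q e) (s e)
centers {h} {cn} H N Q S = centersWith {h} {cn} H N Q S (ctopMarker {h} H (chalf (cl Q)) S)

cadm : ∀ {h : ℕ → ℕ → Bool} {cn cn′ : ℕ → ℕ → ℕ → ℕ} {i s m τ} → CpB2 h → Cp3 cn → Cp3 cn′ → Cp i → Cp s → Cp m → Cp τ →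
  CpB λ e → adm (h e) (cn e) (cn′ e) (i e) (s e) (m e) (τ e)
cadm {h} {cn} {cn′} {i} {s} {m} {τ} H N N′ I S M T =
  (cl (cl T) c≡ cs (cdbl I)) c∧ ((M c< cs (cl T)) c∧ call {λ e → admBit (h e) (cn e) (cn′ e) (i e) (s e) (m e) (τ e)} (cl T)
    (((cl cv1 c< cdbl I₁) c⇒ (bq c== hAt {h} H cv0 cv1)) c∧
    (((cs cv1 c< M₁) c⇒ (bq c== cbit (cforced {λ z → h (fst z)} {λ z → cn (fst z)} (wkH {h} {cn} H N) (wkN {h} {cn} H N) (cc S cv0) (cpred M₁)) cv1)) c∧
    (((M₁ c< cs cv1) c⇒ (((cl cv1 c≡ cdbl I₁) c⇒ bq) c∧ ((cl cv1 c≡ cs (cdbl I₁)) c⇒ cnot bq))) c∧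
     ((cs (cdbl I₁) c< cl cv1) c⇒ (bq c∨ call {λ z s′ → not (enters (bit (τ (fst z))) (cn′ (fst z)) (snd z) s′)} (cs (cl T₁))
        (cnot (centers {λ z p → bit (τ (fst (fst z))) p} {λ z → cn′ (fst (fst z))} (cbit (cc T (cl (cl cv0))) cv1)
          (ap3 {cn′} N′ (cl (cl (cl cv0))) (cr cv0) cv1) (cr cv0) cv1))))))))
  where
  I₁ = cc I cv0
  M₁ = cc M cv0
  T₁ = cc T cv0
  bq : CpB λ z → bit (τ (fst z)) (snd z)
  bq = cbit T₁ cv1

crefutes : ∀ {i s c} → Cp i → Cp s → Cp c → CpB λ e → refutes (i e) (s e) (c e)
crefutes I S C = (ck 0 c< cr (cr C)) c∧ (CS.cvalid cstrOracle (cl C) (cr (cr C)) c∧ ((cl (chd (cr (cr C))) c≡ cl I) c∧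
  ((cl (cr (chd (cr (cr C)))) c≡ cl (cr C)) c∧ cnot (cguess (cr I) S (cl (cr C)) c≡ cr (cr (chd (cr (cr C))))))))

cfits : ∀ {c s} → Cp c → Cp s → CpB λ e → fits (c e) (s e)
cfits C S = (cstr {λ _ _ → true} (ck 1) C c+ C) c< S

cchosen : ∀ {h : ℕ → ℕ → Bool} {cn : ℕ → ℕ → ℕ → ℕ} {cn′ : ℕ → ℕ → ℕ → ℕ → ℕ} {i s} → CpB2 h → Cp3 cn → Cp3 (λ z → cn′ (fst z) (snd z)) →
  Cp i → Cp s → Cp λ e → chosen (h e) (cn e) (cn′ e) (i e) (s e)
cchosen {h} {cn} {cn′} {i} {s} H N N′ I S =
  cif ((M c≡ ck 0) c∨ (cexplanation {h} {cn} H N S (cpred M) c< S)) (cif (L c< S) (cs L) (ck 0)) (ck 0)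
  where
  M = ctopMarker {h} H I S
  st : CpB2 λ e c → status (h e) (cn e) (cn′ e) (i e) (s e) (topMarker (h e) (i e) (s e)) c
  st = cfits cv1 (cc S cv0) c∧ (cadm {λ z → h (fst z)} {λ z → cn (fst z)} {λ z → cn′ (fst z) (fst (snd z))} (wkH {h} {cn} H N) (wkN {h} {cn} H N)
         (ap3 {λ z → cn′ (fst z) (snd z)} N′ (cpr (cl (cl cv0)) (cl (cr (cl cv0)))) (cr cv0) cv1 `by` λ z → cong₂ (λ a b → cn′ a b (snd (fst z)) (snd z)) (fst-pair _ _) (snd-pair _ _))
         (cc I cv0) (cc S cv0) (cc M cv0) (cl cv1) c∧ crefutes (cc I cv0) (cc S cv0) cv1)
    where
    _`by`_ : ∀ {f g} → Cp f → (∀ x → f x ≡ g x) → Cp g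
    F `by` e = cext e F
  L = cleast {λ e → status (h e) (cn e) (cn′ e) (i e) (s e) (topMarker (h e) (i e) (s e))} S st

ccandidateVia : ∀ {c : ℕ → ℕ → ℕ} {h : ℕ → ℕ → Bool} → Cp2 c → CpB2 h → Cp3 λ e → candidateVia (c e) (h e)
ccandidateVia {c} {h} C H = ap2 {c} C (cl cv0) (cpr (cstr {λ z → below (h (fst (fst z))) (dbl (snd (fst z)))}
  (cifB (cl cv1 c< cdbl (cr (cl cv0))) (hAt {h} H (cl (cl cv0)) cv1) (ck 0)) cv1) (cr cv0))

cchoose : ∀ {c : ℕ → ℕ → ℕ} {x} → Cp2 c → Cp x → Cp λ e → choose (c e) (x e)
cchoose {c} {x} C X = cchosen {λ e → bit (fst (x e))} {λ e → candidateVia (c e) (bit (fst (x e)))} {λ e τ → candidateVia (c e) (bit τ)}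
  (cbit (cl (cc X cv0)) cv1) (ccandidateVia {c} {λ e → bit (fst (x e))} C (cbit (cl (cc X cv0)) cv1))
  (ccandidateVia {λ z → c (fst z)} {λ z → bit (snd z)} (ap2 {c} C (cl cv0) cv1) (cbit (cr cv0) cv1)) (cr X) (cl (cl X))

ctable : ∀ {n} → Cp n → Cp λ e → memo stage (n e)
ctable N = crec {g = λ _ k r → cons (stage k r) r} (ck 0)
  (ccons (cchoose {λ z → look (snd (fst z)) (snd z)} (cnth (cr (cl cv0) c∸ cs cv1) (cr cv0)) (cr cv0)) cv1) N

abstract
  candidateCode : ℕ → ℕ
  candidateCode x = stage x (memo stage x)

  ccandidateCode : ∀ {x} → Cp x → Cp λ e → candidateCode (x e)
  ccandidateCode {x} X = cchoose {λ e → look (x e) (memo stage (x e))} (cnth (cc X cv0 c∸ cs cv1) (ctable (cc X cv0))) X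

  candidateCode-def : ∀ x → candidateCode x ≡ choose (look x (memo stage x)) x
  candidateCode-def x = refl

  look-candidateCode : ∀ x y → y < x → look x (memo stage x) y ≡ candidateCode y
  look-candidateCode = look-memo stage

abstract
  candidate : (ℕ → Bool) → ℕ → ℕ → ℕ
  candidate h j t = candidateVia candidateCode h j t

  candidate-def : ∀ h j t → candidate h j t ≡ candidateCode ⟪ str (below h (dbl j)) t , j ⟫
  candidate-def h j t = refl

  ccandidate : ∀ {h : ℕ → ℕ → Bool} → CpB2 h → Cp3 λ e → candidate (h e)
  ccandidate {h} H = ccandidateVia {λ _ → candidateCode} {h} (ccandidateCode cv1) H

-- Locality: what the construction reads

∧-guard : ∀ a {b c} → (a ≡ true → b ≡ c) → (a ∧ b) ≡ (a ∧ c)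
∧-guard true f = f refl
∧-guard false f = refl

⇒-guard : ∀ a {b c} → (a ≡ true → b ≡ c) → (a ⇒ b) ≡ (a ⇒ c)
⇒-guard true f = f refl
⇒-guard false f = refl

if-guard : ∀ a {b c d : ℕ} → (a ≡ true → b ≡ c) → (if a then b else d) ≡ (if a then c else d)
if-guard true f = f refl
if-guard false f = refl

least≤ : ∀ n P → least n P ≤ n
least≤ n P with least n P | least-spec n P
... | r | none refl _ = ≤-refl
... | r | found l _ _ = <⇒≤ l

record TopMarker (h : ℕ → Bool) (i s p : ℕ) : Set where
  constructor mkTopMarker
  field
    p<s  : p < s
    hp   : h p ≡ true
    odd  : par (fst p) ≡ 1
    col< : fst p < dbl i
    top  : ∀ r → r < s → h r ≡ true → par (fst r) ≡ 1 → fst r < dbl i → r ≤ p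
  own< : owner p < i
  own< = dbl-cancel< (≤-<-trans (dbl-half≤ (fst p)) col<)

marker-intro : ∀ {h i r} → h r ≡ true → par (fst r) ≡ 1 → fst r < dbl i → marker h i r ≡ true
marker-intro a b c = ∧-i (lt-complete c) (∧-i (eq-complete b) a)

topMarker-cases : ∀ h i s → (topMarker h i s ≡ 0 × (∀ r → r < s → h r ≡ true → par (fst r) ≡ 1 → fst r < dbl i → ⊥)) ⊎ (Σ ℕ λ p → topMarker h i s ≡ suc p × TopMarker h i s p)
topMarker-cases h i s with last-spec s (marker h i)
... | inj₁ (e , hi) = inj₁ (e , λ r l a b c → clash (marker-intro {h} {i} a b c) (hi r l))
... | inj₂ (p , e , l , P , hi) = inj₂ (p , e , mkTopMarker l (∧-r {par (fst p) ≡ᵇ 1} P′) (eq-sound _ _ (∧-l P′)) (lt-sound _ _ (∧-l P)) λ r l a b c → hi r l (marker-intro {h} {i} a b c))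
  where P′ = ∧-r {fst p <ᵇ dbl i} P

topMarker-suc : ∀ {h i s p} → topMarker h i s ≡ suc p → TopMarker h i s p
topMarker-suc {h} {i} {s} e with topMarker-cases h i s
... | inj₁ (z , _) with trans (sym e) z
... | ()
topMarker-suc {h} {i} {s} e | inj₂ (p , e′ , m) with suc-injective (trans (sym e) e′)
... | refl = m

topMarker-cong : ∀ h h′ i s → (∀ p → p < s → fst p < dbl i → h p ≡ h′ p) → topMarker h i s ≡ topMarker h′ i s
topMarker-cong h h′ i s a = last-cong s _ _ λ p l → ∧-guard (fst p <ᵇ dbl i) λ e → cong ((par (fst p) ≡ᵇ 1) ∧_) (a p l (lt-sound _ _ e))

module _ {h h′ : ℕ → Bool} {cn cn′ : ℕ → ℕ → ℕ} {s : ℕ} where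

  Same : ℕ → Set
  Same j = (∀ t → ⟪ dbl j , t ⟫ < s → h ⟪ dbl j , t ⟫ ≡ h′ ⟪ dbl j , t ⟫) × (∀ t → t ≤ s → cn j t ≡ cn′ j t)

  explains-cong : ∀ {j} → Same j → ∀ p t → t ≤ s → explains h cn j s p t ≡ explains h′ cn′ j s p t
  explains-cong {j} (a , b) p t l = ∧-guard (⟪ dbl j , t ⟫ <ᵇ s) λ e → cong₂ (λ x y → not x ∧ ((0 <ᵇ y) ∧ (len (strOf y) ≡ᵇ p))) (a t (lt-sound _ _ e)) (b t l)

  explanation-cong : ∀ {p} → Same (owner p) → explanation h cn s p ≡ explanation h′ cn′ s p
  explanation-cong {p} a = least-cong s _ _ λ t l → explains-cong a p t (<⇒≤ l)

  forced-cong : ∀ {p} → Same (owner p) → forced h cn s p ≡ forced h′ cn′ s p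
  forced-cong {p} a = cong strOf (trans (proj₂ a _ (least≤ s _)) (cong (cn′ (owner p)) (explanation-cong a)))

  explained-cong : ∀ m → (∀ p → m ≡ suc p → Same (owner p)) → explained h cn s m ≡ explained h′ cn′ s m
  explained-cong zero a = refl
  explained-cong (suc p) a = cong (_<ᵇ s) (explanation-cong (a p refl))

  follow-cong : ∀ m q → (∀ p → m ≡ suc p → Same (owner p)) → follow h cn s m q ≡ follow h′ cn′ s m q
  follow-cong zero q a = refl
  follow-cong (suc p) q a = cong₂ (λ x y → (x <ᵇ s) ∧ ((q <ᵇ p) ∧ bit y q)) (explanation-cong (a p refl)) (forced-cong (a p refl))

  entersWith-cong : ∀ m q → (∀ p → m ≡ suc p → Same (owner p)) → (∀ t → t ≤ s → cn (owner q) t ≡ cn′ (owner q) t) →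
    (par (fst q) ≡ 1 → Same (owner q)) → entersWith h cn q s m ≡ entersWith h′ cn′ q s m
  entersWith-cong m q a b c = cong₂ _∨_ (follow-cong m q a) (cong₂ _∨_
    (∧-guard (par (fst q) ≡ᵇ 0) λ _ → ∧-guard (m <ᵇ suc q) λ _ → ∧-guard (snd q <ᵇ suc s) λ e →
      cong₂ (λ x y → (x ≡ᵇ 0) ∨ not (x ≡ᵇ y)) (b (snd q) (≤-pred (lt-sound _ _ e))) (b s ≤-refl))
    (∧-guard (par (fst q) ≡ᵇ 1) λ e → ∧-guard (m <ᵇ suc q) λ _ → any-cong s _ _ λ t l → explains-cong (c (eq-sound _ _ e)) q t (<⇒≤ l)))

-- Column `fst q` is c.e. in the earlier columns for this reason: the last marker lies before the
-- columns of the owner, and the even column of the owner is consulted only when `q` is in the odd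
-- one.
enters-cong : ∀ h h′ cn cn′ q s → (∀ p → p < s → fst p < fst q → h p ≡ h′ p) → (∀ j t → t ≤ s → dbl j ≤ fst q → cn j t ≡ cn′ j t) →
  enters h cn q s ≡ enters h′ cn′ q s
enters-cong h h′ cn cn′ q s a b = trans
  (entersWith-cong {h} {h′} {cn} {cn′} (topMarker h (owner q) s) q
    (λ p e → same (owner p) (<-≤-trans (≤-<-trans (dbl-half≤ (fst p)) (TopMarker.col< (topMarker-suc {h} {owner q} {s} e))) (dbl-half≤ (fst q))))
    (λ t l → b _ t l (dbl-half≤ (fst q)))
    (λ e → same (owner q) (≤-reflexive (sym (half-odd (fst q) e)))))
  (cong (entersWith h′ cn′ q s) (topMarker-cong h h′ (owner q) s λ p l c → a p l (<-≤-trans c (dbl-half≤ (fst q)))))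
  where
  same : ∀ j → dbl j < fst q → Same {h} {h′} {cn} {cn′} {s} j
  same j l = (λ t k → a _ k (subst (_< fst q) (sym (fst-pair _ _)) l)) , λ t k → b j t k (<⇒≤ l)

fits-sum : ∀ {c s} → fits c s ≡ true → str (λ _ → true) c + c < s
fits-sum h = lt-sound _ _ h

fits-< : ∀ {c s} → fits c s ≡ true → c < s
fits-< {c} h = ≤-<-trans (m≤n+m c _) (fits-sum h)

len≤c : ∀ c → len (fst c) ≤ c
len≤c c = ≤-trans (fst≤ _) (fst≤ c)

adm-cong : ∀ h h′ cn cn′ c₁ c₁′ i s m τ → len τ ≤ s →
  (∀ p → p < s → fst p < dbl i → h p ≡ h′ p) → (∀ p → m ≡ suc p → Same {h} {h′} {cn} {cn′} {s} (owner p)) →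
  (∀ j t → t ≤ len τ → j ≤ len τ → c₁ j t ≡ c₁′ j t) → adm h cn c₁ i s m τ ≡ adm h′ cn′ c₁′ i s m τ
adm-cong h h′ cn cn′ c₁ c₁′ i s m τ l a b c = cong (λ z → (fst (len τ) ≡ᵇ suc (dbl i)) ∧ ((m <ᵇ suc (len τ)) ∧ z)) (all-cong (len τ) _ _ λ q q< →
  cong₂ _∧_ (⇒-guard (fst q <ᵇ dbl i) λ e → cong (bit τ q ==_) (a q (<-≤-trans q< l) (lt-sound _ _ e)))
  (cong₂ _∧_ (⇒-guard (suc q <ᵇ m) λ e → cong (λ z → bit τ q == bit z q) (fc m b (lt-sound _ _ e)))
  (cong (_ ∧_) (⇒-guard (suc (dbl i) <ᵇ fst q) λ _ → cong (bit τ q ∨_) (all-cong (suc (len τ)) _ _ λ s′ s′< →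
    cong not (enters-cong (bit τ) (bit τ) c₁ c₁′ q s′ (λ _ _ _ → refl) λ j t t≤ j≤ →
      c j t (≤-trans t≤ (≤-pred s′<)) (≤-trans (≤-trans (m≤m+n j j) j≤) (≤-trans (fst≤ q) (<⇒≤ q<))))))))) 
  where
  fc : ∀ {q} m → (∀ p → m ≡ suc p → Same {h} {h′} {cn} {cn′} {s} (owner p)) → suc q < m → forced h cn s (pred m) ≡ forced h′ cn′ s (pred m)
  fc (suc p) b _ = forced-cong {h} {h′} {cn} {cn′} {s} {p} (b p refl)

-- The third hypothesis describes exactly the calls made on candidate strings. The guards in the
-- tests let agreement be assumed only for them.
chosen-cong : ∀ h h′ cn cn′ c₁ c₁′ i s →
  (∀ p → p < s → fst p < dbl i → h p ≡ h′ p) → (∀ j t → j < i → t ≤ s → cn j t ≡ cn′ j t) →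
  (∀ c j t → fits c s ≡ true → t ≤ c → j ≤ c → c₁ (fst c) j t ≡ c₁′ (fst c) j t) →
  chosen h cn c₁ i s ≡ chosen h′ cn′ c₁′ i s
chosen-cong h h′ cn cn′ c₁ c₁′ i s a b c = trans (cong (λ x → if x then pick s (status h cn c₁ i s m) else 0) (explained-cong {h} {h′} {cn} {cn′} {s} m same))
  (trans (if-guard (explained h′ cn′ s m) λ _ → cong (λ r → if r <ᵇ s then suc r else 0) (least-cong s _ _ λ k _ →
    ∧-guard (fits k s) λ e → cong (_∧ refutes i s k) (adm-cong h h′ cn cn′ (c₁ (fst k)) (c₁′ (fst k)) i s m (fst k)
      (≤-trans (len≤c k) (<⇒≤ (fits-< e))) a same λ j t t≤ j≤ → c k j t e (≤-trans t≤ (len≤c k)) (≤-trans j≤ (len≤c k)))))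
  (cong (chosenWith h′ cn′ c₁′ i s) (topMarker-cong h h′ i s a)))
  where
  m = topMarker h i s
  same : ∀ p → m ≡ suc p → Same {h} {h′} {cn} {cn′} {s} (owner p)
  same p e = (λ t l → a _ l (subst (_< dbl i) (sym (fst-pair _ _)) (<-≤-trans (s≤s (n≤1+n _)) (dbl-mono< (TopMarker.own< mp))))) , λ t l → b _ t (TopMarker.own< mp) l
    where mp = topMarker-suc {h} {i} {s} e

below-cong : ∀ h h′ m s → (∀ p → p < s → fst p < m → h p ≡ h′ p) → str (below h m) s ≡ str (below h′ m) s
below-cong h h′ m s a = str-cong s _ _ λ p l → lem p l
  where
  lem : ∀ p → p < s → below h m p ≡ below h′ m p
  lem p l with fst p <ᵇ m in e
  ... | true = a p l (lt-sound _ _ e)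
  ... | false = refl

below-here : ∀ h m p → fst p < m → below h m p ≡ h p
below-here h m p l rewrite lt-complete l = refl

below-sub : ∀ h m p → below h m p ≡ true → fst p < m × h p ≡ true
below-sub h m p e with fst p <ᵇ m in l
... | true = lt-sound _ _ l , e

candidate-cong : ∀ h h′ j s → (∀ p → p < s → fst p < dbl j → h p ≡ h′ p) → candidate h j s ≡ candidate h′ j s
candidate-cong h h′ j s a = trans (candidate-def h j s) (trans (cong (λ z → candidateCode ⟪ z , j ⟫) (below-cong h h′ (dbl j) s a)) (sym (candidate-def h′ j s)))

-- The fixed-point equation holds because all calls have smaller codes. For earlier requirements the
-- string does not grow and the requirement drops (`calls1`). On a candidate string, `fits` keeps
-- the code of the call below `s`, hence below that of any string of length `s` (`calls2`).
candidate-unfold : ∀ h i s → candidate h i s ≡ chosen h (candidate h) (λ τ → candidate (bit τ)) i s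
candidate-unfold h i s = trans (candidate-def h i s) (trans (candidateCode-def x) (trans (cong₂ (λ a b → chosen (bit a) (candidateVia c (bit a)) (λ τ → candidateVia c (bit τ)) b (len a)) (fst-pair ρ i) (snd-pair ρ i))
  (trans (cong (chosen (bit ρ) (candidateVia c (bit ρ)) (λ τ → candidateVia c (bit τ)) i) (len-str _ s))
  (chosen-cong (bit ρ) h (candidateVia c (bit ρ)) (candidate h) (λ τ → candidateVia c (bit τ)) (λ τ → candidate (bit τ)) i s agree calls1 calls2))))
  where
  ρ = str (below h (dbl i)) s
  x = ⟪ ρ , i ⟫
  c = look x (memo stage x)
  agree : ∀ p → p < s → fst p < dbl i → bit ρ p ≡ h p
  agree p l k = trans (bit-str _ s p l) (below-here h (dbl i) p k)
  calls1 : ∀ j t → j < i → t ≤ s → candidateVia c (bit ρ) j t ≡ candidate h j t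
  calls1 j t l k = trans (cong (λ z → c ⟪ z , j ⟫) (below-cong (bit ρ) h (dbl j) t λ p p< q → agree p (<-≤-trans p< k) (<-≤-trans q (dbl-mono (<⇒≤ l)))))
    (trans (look-candidateCode x _ (pair-sum< (+-mono-≤-< (str-mono t s _ _ k λ p _ e → up p (below-sub h (dbl j) p e)) l))) (sym (candidate-def h j t)))
    where
    up : ∀ p → fst p < dbl j × h p ≡ true → below h (dbl i) p ≡ true
    up p (a , b) = trans (below-here h (dbl i) p (<-≤-trans a (dbl-mono (<⇒≤ l)))) b
  calls2 : ∀ k j t → fits k s ≡ true → t ≤ k → j ≤ k → candidateVia c (bit (fst k)) j t ≡ candidate (bit (fst k)) j t
  calls2 k j t b t≤ j≤ = trans (look-candidateCode x _ (pair-sum< (≤-<-trans (+-mono-≤ (str-mono t k _ (λ _ → true) t≤ λ _ _ _ → refl) j≤)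
    (<-≤-trans (fits-sum b) (≤-trans (x≤pair s _) (m≤m+n ρ i)))))) (sym (candidate-def (bit (fst k)) j t))

-- The true outcome

record Adm (h : ℕ → Bool) (cn cn′ : ℕ → ℕ → ℕ) (i s m τ : ℕ) : Set where
  field
    lenCol : fst (len τ) ≡ suc (dbl i)
    m≤len  : m ≤ len τ
    low    : ∀ q → q < len τ → fst q < dbl i → bit τ q ≡ h q
    old    : ∀ q → q < len τ → suc q < m → bit τ q ≡ bit (forced h cn s (pred m)) q
    ones   : ∀ q → q < len τ → m ≤ q → fst q ≡ dbl i → bit τ q ≡ true
    zeros  : ∀ q → q < len τ → m ≤ q → fst q ≡ suc (dbl i) → bit τ q ≡ false
    closed : ∀ q → q < len τ → suc (dbl i) < fst q → ∀ s′ → s′ ≤ len τ → enters (bit τ) cn′ q s′ ≡ true → bit τ q ≡ true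

adm-sound : ∀ h cn cn′ i s m τ → adm h cn cn′ i s m τ ≡ true → Adm h cn cn′ i s m τ
adm-sound h cn cn′ i s m τ e = record
  { lenCol = eq-sound _ _ (∧-l e)
  ; m≤len = ≤-pred (lt-sound m _ (∧-l e₁))
  ; low = λ q l c → ==-sound _ _ (⇒-e (∧-l (b q l)) (lt-complete c))
  ; old = λ q l c → ==-sound _ _ (⇒-e (∧-l (b₁ q l)) (lt-complete c))
  ; ones = λ q l c d → ⇒-e (∧-l (⇒-e (∧-l (b₂ q l)) (lt-complete (s≤s c)))) (eq-complete d)
  ; zeros = λ q l c d → not-t (⇒-e (∧-r {(fst q ≡ᵇ dbl i) ⇒ bit τ q} (⇒-e (∧-l (b₂ q l)) (lt-complete (s≤s c)))) (eq-complete d))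
  ; closed = λ q l c s′ l′ E → cl? q s′ l′ E (∨-e (⇒-e (∧-r {(m <ᵇ suc q) ⇒ (((fst q ≡ᵇ dbl i) ⇒ bit τ q) ∧ ((fst q ≡ᵇ suc (dbl i)) ⇒ not (bit τ q)))} (b₂ q l)) (lt-complete c)))
  }
  where
  e₁ = ∧-r {fst (len τ) ≡ᵇ suc (dbl i)} e
  b : ∀ q → q < len τ → admBit h cn cn′ i s m τ q ≡ true
  b = all-sound (len τ) _ (∧-r {m <ᵇ suc (len τ)} e₁)
  b₁ : ∀ q → q < len τ → _
  b₁ q l = ∧-r {(fst q <ᵇ dbl i) ⇒ (bit τ q == h q)} (b q l)
  b₂ : ∀ q → q < len τ → _
  b₂ q l = ∧-r {(suc q <ᵇ m) ⇒ (bit τ q == bit (forced h cn s (pred m)) q)} (b₁ q l)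
  cl? : ∀ q s′ → s′ ≤ len τ → enters (bit τ) cn′ q s′ ≡ true → bit τ q ≡ true ⊎ all (suc (len τ)) (λ s′ → not (enters (bit τ) cn′ q s′)) ≡ true → bit τ q ≡ true
  cl? q s′ l E (inj₁ t) = t
  cl? q s′ l E (inj₂ t) = clash E (not-t (all-sound (suc (len τ)) _ t s′ (s≤s l)))

adm-complete : ∀ h cn cn′ i s m τ → Adm h cn cn′ i s m τ → adm h cn cn′ i s m τ ≡ true
adm-complete h cn cn′ i s m τ a = ∧-i (eq-complete lenCol) (∧-i (lt-complete (s≤s m≤len)) (all-complete (len τ) _ λ q l →
  ∧-i (⇒-i {fst q <ᵇ dbl i} λ c → ==-complete (low q l (lt-sound _ _ c)))
  (∧-i (⇒-i {suc q <ᵇ m} λ c → ==-complete (old q l (lt-sound _ _ c)))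
  (∧-i (⇒-i {m <ᵇ suc q} λ c → ∧-i (⇒-i {fst q ≡ᵇ dbl i} λ d → ones q l (≤-pred (lt-sound _ _ c)) (eq-sound _ _ d))
                                    (⇒-i {fst q ≡ᵇ suc (dbl i)} λ d → not-f (zeros q l (≤-pred (lt-sound _ _ c)) (eq-sound _ _ d))))
       (⇒-i {suc (dbl i) <ᵇ fst q} λ c → cls q l (lt-sound _ _ c))))))
  where
  open Adm a
  cls : ∀ q → q < len τ → suc (dbl i) < fst q → (bit τ q ∨ all (suc (len τ)) (λ s′ → not (enters (bit τ) cn′ q s′))) ≡ true
  cls q l c with bit τ q in e
  ... | true = refl
  ... | false = all-complete (suc (len τ)) _ λ s′ l′ → not-f (≢true⇒false λ E → clash (closed q l c s′ (≤-pred l′) E) e)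

record Refutes (i s c : ℕ) : Set where
  field
    pos   : 0 < candL c
    vld   : CS.V (fst c) (candL c)
    prog  : fe (hd (candL c)) ≡ fst i
    arg   : fx (hd (candL c)) ≡ candX c
    wrong : ¬ (guess (snd i) s (candX c) ≡ fy (hd (candL c)))

refutes-sound : ∀ i s c → refutes i s c ≡ true → Refutes i s c
refutes-sound i s c e = record
  { pos = lt-sound _ _ (∧-l e)
  ; vld = CS.valid-V {fst c} {candL c} (∧-l e₁)
  ; prog = eq-sound _ _ (∧-l e₂)
  ; arg = eq-sound _ _ (∧-l e₃)
  ; wrong = λ d → clash (eq-complete d) (not-t (∧-r {fx (hd (candL c)) ≡ᵇ candX c} e₃))
  }
  where
  e₁ = ∧-r {0 <ᵇ candL c} e
  e₂ = ∧-r {CS.valid (fst c) (candL c)} e₁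
  e₃ = ∧-r {fe (hd (candL c)) ≡ᵇ fst i} e₂

refutes-complete : ∀ i s c → Refutes i s c → refutes i s c ≡ true
refutes-complete i s c r = ∧-i (lt-complete pos) (∧-i (CS.V-valid {fst c} {candL c} vld) (∧-i (eq-complete prog) (∧-i (eq-complete arg) (not-f (≢true⇒false λ e → wrong (eq-sound _ _ e))))))
  where open Refutes r

pick-suc : ∀ {s P c} → pick s P ≡ suc c → c < s × P c ≡ true
pick-suc {s} {P} e with least s P | least-spec s P
... | r | found l Pr _ rewrite lt-complete l with e
...   | refl = l , Pr
pick-suc {s} {P} e | r | none refl _ with r <ᵇ r in z
... | true = ⊥-elim (<-irrefl refl (lt-sound r r z))
pick-suc {s} {P} () | r | none refl _ | false

if-suc : ∀ {b x c} → (if b then x else 0) ≡ suc c → b ≡ true × x ≡ suc c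
if-suc {true} e = refl , e

enters-follow : ∀ h cn q s p → topMarker h (owner q) s ≡ suc p → explanation h cn s p < s → q < p → bit (forced h cn s p) q ≡ true → enters h cn q s ≡ true
enters-follow h cn q s p e a b c = subst (λ m → entersWith h cn q s m ≡ true) (sym e) (∨-l _ (∧-i (lt-complete a) (∧-i (lt-complete b) c)))

enters-ownT : ∀ h cn q s → par (fst q) ≡ 0 → topMarker h (owner q) s ≤ q → snd q ≤ s → cn (owner q) (snd q) ≡ 0 ⊎ ¬ (cn (owner q) (snd q) ≡ cn (owner q) s) → enters h cn q s ≡ true
enters-ownT h cn q s a b c d = ∨-r (follow h cn s (topMarker h (owner q) s) q) (∨-l _ (∧-i (eq-complete a) (∧-i (lt-complete (s≤s b)) (∧-i (lt-complete (s≤s c)) (lem d)))))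
  where
  lem : ∀ {x y} → x ≡ 0 ⊎ ¬ (x ≡ y) → ((x ≡ᵇ 0) ∨ not (x ≡ᵇ y)) ≡ true
  lem (inj₁ e) = ∨-l _ (eq-complete e)
  lem {x} {y} (inj₂ n) = ∨-r (x ≡ᵇ 0) (not-f (≢true⇒false λ e → n (eq-sound _ _ e)))

enters-ownW : ∀ h cn q s t → par (fst q) ≡ 1 → topMarker h (owner q) s ≤ q → t < s → explains h cn (owner q) s q t ≡ true → enters h cn q s ≡ true
enters-ownW h cn q s t a b c d = ∨-r (follow h cn s (topMarker h (owner q) s) q) (∨-r (ownT h cn (owner q) s (topMarker h (owner q) s) q)
  (∧-i (eq-complete a) (∧-i (lt-complete (s≤s b)) (any-complete s _ t c d))))

data Entry (h : ℕ → Bool) (cn : ℕ → ℕ → ℕ) (q s : ℕ) : Set where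
  byFollow : ∀ p → topMarker h (owner q) s ≡ suc p → explanation h cn s p < s → q < p → bit (forced h cn s p) q ≡ true → Entry h cn q s
  byT : par (fst q) ≡ 0 → topMarker h (owner q) s ≤ q → snd q ≤ s → cn (owner q) (snd q) ≡ 0 ⊎ ¬ (cn (owner q) (snd q) ≡ cn (owner q) s) → Entry h cn q s
  byW : par (fst q) ≡ 1 → topMarker h (owner q) s ≤ q → ∀ t → t < s → explains h cn (owner q) s q t ≡ true → Entry h cn q s

enters-view : ∀ h cn q s → enters h cn q s ≡ true → Entry h cn q s
enters-view h cn q s e = go (topMarker h (owner q) s) refl (∨-e e)
  where
  i = owner q
  go : ∀ m → topMarker h i s ≡ m → follow h cn s m q ≡ true ⊎ (ownT h cn i s m q ∨ ownW h cn i s m q) ≡ true → Entry h cn q s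
  go (suc p) e (inj₁ f) = byFollow p e (lt-sound _ _ (∧-l f)) (lt-sound _ _ (∧-l f₁)) (∧-r {q <ᵇ p} f₁)
    where f₁ = ∧-r {explanation h cn s p <ᵇ s} f
  go m e (inj₂ f) with ∨-e f
  ... | inj₁ t = byT (eq-sound _ _ (∧-l t)) (≤-trans (≤-reflexive e) (≤-pred (lt-sound _ _ (∧-l t₁)))) (≤-pred (lt-sound _ _ (∧-l t₂))) (lem (∨-e (∧-r {snd q <ᵇ suc s} t₂)))
    where
    t₁ = ∧-r {par (fst q) ≡ᵇ 0} t
    t₂ = ∧-r {m <ᵇ suc q} t₁
    lem : ∀ {x y} → (x ≡ᵇ 0) ≡ true ⊎ not (x ≡ᵇ y) ≡ true → x ≡ 0 ⊎ ¬ (x ≡ y)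
    lem (inj₁ a) = inj₁ (eq-sound _ _ a)
    lem (inj₂ b) = inj₂ λ e → clash (eq-complete e) (not-t b)
  ... | inj₂ w with any-sound s _ (∧-r {m <ᵇ suc q} (∧-r {par (fst q) ≡ᵇ 1} w))
  ...   | t , l , ht = byW (eq-sound _ _ (∧-l w)) (≤-trans (≤-reflexive e) (≤-pred (lt-sound _ _ (∧-l (∧-r {par (fst q) ≡ᵇ 1} w))))) t l ht

record Explains (h : ℕ → Bool) (cn : ℕ → ℕ → ℕ) (j s p t : ℕ) : Set where
  constructor mkExplains
  field
    pos< : ⟪ dbl j , t ⟫ < s
    out  : h ⟪ dbl j , t ⟫ ≡ false
    c    : ℕ
    act  : cn j t ≡ suc c
    lenp : len (fst c) ≡ p

explains-sound : ∀ h cn j s p t → explains h cn j s p t ≡ true → Explains h cn j s p t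
explains-sound h cn j s p t e = go (cn j t) refl (∧-r {not (h ⟪ dbl j , t ⟫)} e₁)
  where
  e₁ = ∧-r {⟪ dbl j , t ⟫ <ᵇ s} e
  go : ∀ v → cn j t ≡ v → ((0 <ᵇ v) ∧ (len (strOf v) ≡ᵇ p)) ≡ true → Explains h cn j s p t
  go (suc c) eq x = mkExplains (lt-sound _ _ (∧-l e)) (not-t (∧-l e₁)) c eq (eq-sound _ _ x)

explains-complete : ∀ h cn j s p t → Explains h cn j s p t → explains h cn j s p t ≡ true
explains-complete h cn j s p t (mkExplains a b c d e) rewrite d = ∧-i (lt-complete a) (∧-i (not-f b) (eq-complete e))

explanation-explains : ∀ h cn s p → explanation h cn s p < s → Explains h cn (owner p) s p (explanation h cn s p)
explanation-explains h cn s p l with least s (explains h cn (owner p) s p) | least-spec s (explains h cn (owner p) s p)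
... | r | none e _ = ⊥-elim (<-irrefl e l)
... | r | found _ H _ = explains-sound h cn (owner p) s p r H

explanation-exists : ∀ h cn s p t → t < s → explains h cn (owner p) s p t ≡ true → explanation h cn s p < s
explanation-exists h cn s p t l H with least s (explains h cn (owner p) s p) | least-spec s (explains h cn (owner p) s p)
... | r | none _ hi = clash H (hi t l)
... | r | found l′ _ _ = l′

-- Final candidates and the strings they force

module Truth (lem : (P : Set) → Dec P) (C : ℕ → Bool)
  (C-out : ∀ q → C q ≡ true → Σ ℕ λ s → enters C (candidate C) q s ≡ true)
  (C-in : ∀ q s → enters C (candidate C) q s ≡ true → C q ≡ true) where

  n : ℕ → ℕ → ℕ
  n = candidate C

  record Active (i s c : ℕ) : Set where
    field
      env : explained C n s (topMarker C i s) ≡ true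
      bd  : fits c s ≡ true
      ad  : Adm C n (candidate (bit (fst c))) i s (topMarker C i s) (fst c)
      ct  : Refutes i s c
    len< : len (fst c) < s
    len< = ≤-<-trans (len≤c c) (fits-< bd)

  active : ∀ {i s c} → n i s ≡ suc c → Active i s c
  active {i} {s} {c} e with if-suc (trans (sym (candidate-unfold C i s)) e)
  ... | a , b with pick-suc {s} {status C n (λ τ → candidate (bit τ)) i s (topMarker C i s)} b
  ...   | _ , st = record { env = a ; bd = ∧-l st
        ; ad = adm-sound C n (candidate (bit (fst c))) i s (topMarker C i s) (fst c) (∧-l (∧-r {fits c s} st))
        ; ct = refutes-sound i s c (∧-r {adm C n (candidate (bit (fst c))) i s (topMarker C i s) (fst c)} (∧-r {fits c s} st)) }

  Settled : ℕ → ℕ → ℕ → Set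
  Settled i t c = n i t ≡ suc c × (∀ s → t ≤ s → n i s ≡ n i t)

  settled-later : ∀ {i t c} s → t ≤ s → Settled i t c → Settled i s c
  settled-later s l (e , k) = trans (k s l) e , λ s′ l′ → trans (k s′ (≤-trans l l′)) (sym (k s l))

  settled-unique : ∀ {i t t′ c c′} → Settled i t c → Settled i t′ c′ → c ≡ c′
  settled-unique {t = t} {t′} (e , k) (e′ , k′) = suc-injective (trans (sym e) (trans (sym (k _ (m≤m⊔n t t′))) (trans (k′ _ (m≤n⊔m t t′)) e′)))

  -- The data behind the last marker: the requirement that left it, its final candidate, and an
  -- omitted position that explains the marker to later columns.
  record Own (i M : ℕ) : Set where
    constructor mkOwn
    field
      {P j t c} : ℕ
      M≡   : M ≡ suc P
      j<i  : j < i
      colP : fst P ≡ suc (dbl j)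
      inP  : C P ≡ true
      st   : Settled j t c
      lenP : len (fst c) ≡ P
      outT : C ⟪ dbl j , t ⟫ ≡ false

  -- `M` is the successor of the largest element of `C` in the odd columns before `dbl i`, or 0 if
  -- there is none. From `M` on, only requirement `i` acts on its two columns.
  record Inv (i : ℕ) : Set where
    field
      M   : ℕ
      top : ∀ p → C p ≡ true → par (fst p) ≡ 1 → fst p < dbl i → p < M
      own : M ≡ 0 ⊎ Own i M

  module Env (i : ℕ) (I : Inv i) where
    open Inv I public

    topMarker≤ : ∀ s → topMarker C i s ≤ M
    topMarker≤ s with topMarker-cases C i s
    ... | inj₁ (e , _) = subst (_≤ M) (sym e) z≤n
    ... | inj₂ (p , e , k) = subst (_≤ M) (sym e) (top p (TopMarker.hp k) (TopMarker.odd k) (TopMarker.col< k))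

    topMarker≡ : ∀ s → M ≤ s → topMarker C i s ≡ M
    topMarker≡ s l with own
    ... | inj₁ e = n≤0⇒n≡0 (subst (topMarker C i s ≤_) e (topMarker≤ s)) `trans` sym e
      where _`trans`_ = trans
    ... | inj₂ (mkOwn {P} {j} refl j<i cP inP _ _ _) with topMarker-cases C i s
    ...   | inj₁ (_ , no′) = ⊥-elim (no′ P l inP (trans (cong par cP) (par-sdbl j)) (subst (_< dbl i) (sym cP) (dbl-mono< j<i)))
    ...   | inj₂ (p , e , k) = trans e (cong suc (≤-antisym (≤-pred (subst (_≤ suc P) e (topMarker≤ s))) (TopMarker.top k P l inP (trans (cong par cP) (par-sdbl j)) (subst (_< dbl i) (sym cP) (dbl-mono< j<i)))))

    explained-ev : Eventually λ s → explained C n s (topMarker C i s) ≡ true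
    explained-ev with own
    ... | inj₁ e = 0 , λ s _ → subst (λ m → explained C n s m ≡ true) (sym (n≤0⇒n≡0 (subst (topMarker C i s ≤_) e (topMarker≤ s)))) refl
    ... | inj₂ (mkOwn {P} {j} {t} {c} e j<i cP inP (act , _) lenP outT) = M ⊔ suc ⟪ dbl j , t ⟫ , λ s l →
        subst (λ m → explained C n s m ≡ true) (sym (trans (topMarker≡ s (≤-trans (m≤m⊔n M _) l)) e))
          (lt-complete (explanation-exists C n s P t (≤-<-trans (y≤pair (dbl j) t) (≤-trans (m≤n⊔m M _) l))
            (subst (λ k → explains C n k s P t ≡ true) (sym (trans (cong half cP) (half-sdbl j))) (explains-complete C n j s P t (mkExplains (≤-trans (m≤n⊔m M _) l) outT c act lenP)))))

    -- From `M` on no marker blocks `ownT`. Since it never fired, there was a candidate at stage `t`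
    -- and it never changed.
    T-out : ∀ t → M ≤ ⟪ dbl i , t ⟫ → C ⟪ dbl i , t ⟫ ≡ false → Σ ℕ (Settled i t)
    T-out t l out = go (n i t) refl
      where
      q = ⟪ dbl i , t ⟫
      ow : owner q ≡ i
      ow = trans (cong half (fst-pair _ _)) (half-dbl i)
      put : ∀ s → t ≤ s → n i t ≡ 0 ⊎ ¬ (n i t ≡ n i s) → ⊥
      put s l′ d = clash (C-in q s (enters-ownT C n q s (trans (cong par (fst-pair _ _)) (par-dbl i)) (subst (λ k → topMarker C k s ≤ q) (sym ow) (≤-trans (topMarker≤ s) l))
        (subst (_≤ s) (sym (snd-pair _ _)) l′) (subst₂ (λ k y → n k y ≡ 0 ⊎ ¬ (n k y ≡ n k s)) (sym ow) (sym (snd-pair _ _)) d))) out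
      go : ∀ v → n i t ≡ v → Σ ℕ (Settled i t)
      go zero e = ⊥-elim (put t ≤-refl (inj₁ e))
      go (suc c) e = c , e , λ s l′ → stay s l′ (n i s ≟ n i t)
        where
        stay : ∀ s → t ≤ s → Dec (n i s ≡ n i t) → n i s ≡ n i t
        stay s l′ (yes p) = p
        stay s l′ (no p) = ⊥-elim (put s l′ (inj₂ λ z → p (sym z)))

    -- `follow` acts only below a marker, hence below `M`, and the condition of `ownT` contradicts
    -- finality.
    T-in : ∀ t c → M ≤ ⟪ dbl i , t ⟫ → Settled i t c → C ⟪ dbl i , t ⟫ ≡ false
    T-in t c l (e , k) = ≢true⇒false λ z → go (C-out q z)
      where
      q = ⟪ dbl i , t ⟫
      ow : owner q ≡ i
      ow = trans (cong half (fst-pair _ _)) (half-dbl i)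
      go : (Σ ℕ λ s → enters C n q s ≡ true) → ⊥
      go (s , E) with enters-view C n q s E
      ... | byFollow p e′ _ q<p _ = <-irrefl refl (<-≤-trans q<p (≤-trans (n≤1+n p) (≤-trans (subst (_≤ M) e′ (subst (λ k → topMarker C k s ≤ M) (sym ow) (topMarker≤ s))) l)))
      ... | byT _ _ t≤s d = done d
        where
        t≤ : t ≤ s
        t≤ = subst (_≤ s) (snd-pair _ _) t≤s
        done : _ → ⊥
        done (inj₁ z) with trans (sym e) (trans (sym (cong₂ n ow (snd-pair _ _))) z)
        ... | ()
        done (inj₂ z) = z (trans (cong₂ n ow (snd-pair _ _)) (trans (sym (k s t≤)) (sym (cong (λ k → n k s) ow))))
      ... | byW o _ _ _ _ with trans (sym o) (trans (cong par (fst-pair _ _)) (par-dbl i))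
      ...   | ()

    -- An explanation read off the true `C` cannot mislead: its stage exceeds the length `p`, so the
    -- omitted position lies beyond `M`, where `T-out` applies.
    explains-settled : ∀ {s p t} → M ≤ p → (H : Explains C n i s p t) → Settled i t (Explains.c H)
    explains-settled {s} {p} {t} l H = subst (Settled i t) (suc-injective (trans (sym (proj₁ (proj₂ r))) (Explains.act H))) (proj₂ r)
      where
      p<t : p < t
      p<t = subst (_< t) (Explains.lenp H) (Active.len< (active (Explains.act H)))
      r : Σ ℕ (Settled i t)
      r = T-out t (≤-trans l (≤-trans (<⇒≤ p<t) (y≤pair (dbl i) t))) (Explains.out H)

    W-out : ∀ p → C p ≡ true → fst p ≡ suc (dbl i) → M ≤ p → Σ ℕ λ t → Σ ℕ λ c → Settled i t c × len (fst c) ≡ p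
    W-out p z cp l = go (C-out p z)
      where
      ow : owner p ≡ i
      ow = trans (cong half cp) (half-sdbl i)
      go : (Σ ℕ λ s → enters C n p s ≡ true) → Σ ℕ λ t → Σ ℕ λ c → Settled i t c × len (fst c) ≡ p
      go (s , E) with enters-view C n p s E
      ... | byFollow r e′ _ q<r _ = ⊥-elim (<-irrefl refl (<-≤-trans q<r (≤-trans (n≤1+n r) (≤-trans (subst (_≤ M) e′ (subst (λ k → topMarker C k s ≤ M) (sym ow) (topMarker≤ s))) l))))
      ... | byT o _ _ _ with trans (sym (par-sdbl i)) (trans (sym (cong par cp)) o)
      ...   | ()
      go (s , E) | byW _ _ t t<s ht = t , Explains.c H , explains-settled l H , Explains.lenp H
        where
        H : Explains C n i s p t
        H = explains-sound C n i s p t (subst (λ k → explains C n k s p t ≡ true) ow ht)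

  module Fin (i : ℕ) (I : Inv i) (t₀ c : ℕ) (st₀ : Settled i t₀ c) where
    open Env i I
    -- A final candidate remains final, so its stage can be moved to where `topMarker` has its true
    -- value.
    t = t₀ ⊔ M
    st : Settled i t c
    st = settled-later t (m≤m⊔n t₀ M) st₀
    A : Active i t c
    A = active (proj₁ st)
    open Active A public
    τ = fst c
    P = len τ
    M≤t : M ≤ t
    M≤t = m≤n⊔m t₀ M
    topMarker-t : topMarker C i t ≡ M
    topMarker-t = topMarker≡ t M≤t
    M≤P : M ≤ P
    M≤P = subst (_≤ P) topMarker-t (Adm.m≤len ad)
    M≤q : M ≤ ⟪ dbl i , t ⟫
    M≤q = ≤-trans M≤t (y≤pair (dbl i) t)
    outT : C ⟪ dbl i , t ⟫ ≡ false
    outT = T-in t c M≤q st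
    colP : fst P ≡ suc (dbl i)
    colP = Adm.lenCol ad
    parP : par (fst P) ≡ 1
    parP = trans (cong par colP) (par-sdbl i)
    owP : owner P ≡ i
    owP = trans (cong half colP) (half-sdbl i)
    inP : C P ≡ true
    inP = C-in P s (enters-ownW C n P s t parP (subst (λ k → topMarker C k s ≤ P) (sym owP) (≤-trans (topMarker≤ s) M≤P)) (s≤s (y≤pair (dbl i) t))
        (subst (λ k → explains C n k s P t ≡ true) (sym owP) (explains-complete C n i s P t (mkExplains ≤-refl outT c (proj₁ st) refl))))
      -- This is the first stage that can read the omitted position.
      where s = suc ⟪ dbl i , t ⟫
    -- Each such marker comes from a final candidate, and two final candidates of one requirement
    -- coincide.
    uniqueP : ∀ p → C p ≡ true → fst p ≡ suc (dbl i) → M ≤ p → p ≡ P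
    uniqueP p z cp l with W-out p z cp l
    ... | t′ , c′ , st′ , lp = trans (sym lp) (cong (λ k → len (fst k)) (settled-unique st′ st))
    topP : ∀ p → C p ≡ true → par (fst p) ≡ 1 → owner p ≤ i → p ≤ P
    topP p z o l with m≤n⇒m<n∨m≡n l
    ... | inj₁ l′ = ≤-trans (<⇒≤ (top p z o (subst (_< dbl i) (sym (half-odd _ o)) (dbl-mono< l′)))) M≤P
    ... | inj₂ refl with <-≤-connex p M
    ...   | inj₁ k = ≤-trans (<⇒≤ k) M≤P
    ...   | inj₂ k = ≤-reflexive (uniqueP p z (half-odd _ o) k)

  -- If requirement `i` has a final candidate, its marker is the new last one. Otherwise `W-out`
  -- shows that column `suc (dbl i)` gains nothing from `M` on, and the old data survive.
  inv : ∀ i → Inv i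
  inv zero = record { M = 0 ; top = λ _ _ _ () ; own = inj₁ refl }
  inv (suc i) with inv i | lem (Σ ℕ λ t → Σ ℕ λ c → Settled i t c)
  ... | I | yes (t , c , st) = record { M = suc F.P ; top = λ p z o l → s≤s (F.topP p z o (≤-pred (dbl-cancel< (≤-<-trans (dbl-half≤ _) l))))
        ; own = inj₂ (mkOwn refl ≤-refl F.colP F.inP F.st refl F.outT) }
    where module F = Fin i I t c st
  ... | I | no nope = record { M = M ; top = tp ; own = ow own }
    where
    open Env i I
    tp : ∀ p → C p ≡ true → par (fst p) ≡ 1 → fst p < dbl (suc i) → p < M
    tp p z o l with m≤n⇒m<n∨m≡n (≤-pred (dbl-cancel< {owner p} {suc i} (≤-<-trans (dbl-half≤ _) l)))
    ... | inj₁ k = top p z o (subst (_< dbl i) (sym (half-odd _ o)) (dbl-mono< k))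
    ... | inj₂ refl with <-≤-connex p M
    ...   | inj₁ k = k
    ...   | inj₂ k with W-out p z (half-odd _ o) k
    ...     | t , c , st , _ = ⊥-elim (nope (t , c , st))
    ow : M ≡ 0 ⊎ Own i M → M ≡ 0 ⊎ Own (suc i) M
    ow (inj₁ e) = inj₁ e
    ow (inj₂ (mkOwn a b c d e f g)) = inj₂ (mkOwn a (≤-trans b (n≤1+n i)) c d e f g)

  module Ext (i t₀ c : ℕ) (st₀ : Settled i t₀ c) where
    open Fin i (inv i) t₀ c st₀
    open Env i (inv i)

    above : ∀ s j → i < j → P < s → Σ ℕ λ p → topMarker C j s ≡ suc p × TopMarker C j s p × P ≤ p
    above s j i<j P<s = go (topMarker-cases C j s)
      where
      colP< : fst P < dbl j
      colP< = subst (_< dbl j) (sym colP) (dbl-mono< i<j)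
      go : _ → Σ ℕ λ p → topMarker C j s ≡ suc p × TopMarker C j s p × P ≤ p
      go (inj₁ (_ , nm)) = ⊥-elim (nm P P<s inP parP colP<)
      go (inj₂ (p , e , k)) = p , e , k , TopMarker.top k P P<s inP parP colP<

    explains-τ : ∀ {k s r t′} → k ≡ i → r ≡ P → (H : Explains C n k s r t′) → fst (Explains.c H) ≡ τ
    explains-τ refl refl H = cong fst (settled-unique (explains-settled M≤P H) st)

    Extends : ℕ → Set
    Extends s = ∀ j → i < j → P < s → explained C n s (topMarker C j s) ≡ true →
      Σ ℕ λ p → topMarker C j s ≡ suc p × P ≤ p × explanation C n s p < s × (∀ q → q < P → bit (forced C n s p) q ≡ bit τ q)

    -- Whatever later requirements force extends τ, as they can only force extensions of what they see forced.
    ext : ∀ s → Extends s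
    ext = <-rec Extends body
      where
      body : ∀ s → (∀ {s′} → s′ < s → Extends s′) → Extends s
      body s rec j i<j P<s ok = go (above s j i<j P<s)
        where
        go : (Σ ℕ λ p → topMarker C j s ≡ suc p × TopMarker C j s p × P ≤ p) → _
        go (p , e , k , P≤p) = p , e , P≤p , ex< , λ q l → trans (cong (λ z → bit z q) (cong strOf (Explains.act H))) (cases (m≤n⇒m<n∨m≡n P≤p) q l)
          where
          ex< : explanation C n s p < s
          ex< = lt-sound _ _ (subst (λ m → explained C n s m ≡ true) e ok)
          t₁ = explanation C n s p
          H : Explains C n (owner p) s p t₁
          H = explanation-explains C n s p ex<
          c₁ = Explains.c H
          A₁ : Active (owner p) t₁ c₁
          A₁ = active (Explains.act H)
          cases : P < p ⊎ P ≡ p → ∀ q → q < P → bit (fst c₁) q ≡ bit τ q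
          cases (inj₂ P≡p) q l = cong (λ z → bit z q) (explains-τ (trans (cong owner (sym P≡p)) owP) (sym P≡p) H)
          -- A marker beyond `P` belongs to a requirement after `i`. Its candidate was admissible at
          -- stage `t₁`, which lies after `p` and before `s`, so by `Adm.old` it copied the string
          -- forced there, and the induction applies at `t₁`.
          cases (inj₁ P<p) q l = deeper (rec ex< (owner p) i<j₁ (<-trans P<p p<t₁) (Active.env A₁))
            where
            p<t₁ : p < t₁
            p<t₁ = subst (_< t₁) (Explains.lenp H) (Active.len< A₁)
            i<j₁ : i < owner p
            i<j₁ = ≰⇒> λ le → <-irrefl refl (<-≤-trans P<p (topP p (TopMarker.hp k) (TopMarker.odd k) le))
            deeper : (Σ ℕ λ p₃ → topMarker C (owner p) t₁ ≡ suc p₃ × P ≤ p₃ × explanation C n t₁ p₃ < t₁ × (∀ q → q < P → bit (forced C n t₁ p₃) q ≡ bit τ q)) → bit (fst c₁) q ≡ bit τ q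
            deeper (p₃ , e₃ , P≤p₃ , _ , b₃) = trans (Adm.old (Active.ad A₁) q (<-trans l (subst (P <_) (sym (Explains.lenp H)) P<p)) (subst (suc q <_) (sym e₃) (s≤s (≤-trans l P≤p₃))))
              (trans (cong (λ z → bit (forced C n t₁ z) q) (cong pred e₃)) (b₃ q l))

  Forcing : ℕ → Set
  Forcing i = ∀ t₀ c → Settled i t₀ c → ∀ q → q < len (fst c) → C q ≡ bit (fst c) q

  -- Two nested inductions: over requirements for positions below the previous marker, where `τ`
  -- copies an older forced string, and over columns for the rest, because enumeration reads only
  -- earlier columns.
  forcing : ∀ i → Forcing i
  forcing = <-rec Forcing body
    where
    body : ∀ i → (∀ {j} → j < i → Forcing j) → Forcing i
    body i IH t₀ c st₀ q q<P = <-rec (λ m → ∀ q → fst q ≡ m → q < P → C q ≡ bit τ q) cols (fst q) q refl q<P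
      where
      open Fin i (inv i) t₀ c st₀
      open Env i (inv i)
      open Ext i t₀ c st₀ using (above; ext)

      oldBits : ∀ q → q < P → suc q < M → M ≡ 0 ⊎ Own i M → C q ≡ bit τ q
      oldBits q l k (inj₁ e) = ⊥-elim (n≮0 (subst (suc q <_) e k))
      oldBits q l k (inj₂ (mkOwn {P₀} {j₀} {t₁} {c₀} M≡ j<i cP _ st₁ lenP _)) =
        trans (IH j<i t₁ c₀ st₁ q (subst (q <_) (sym lenP) (≤-pred (subst (suc q <_) M≡ k))))
        (sym (trans (Adm.old ad q l (subst (suc q <_) (sym topMarker-t) k)) (trans (cong (λ z → bit (forced C n t z) q) (cong pred topMarker≡P₀)) (cong (λ z → bit z q) (trans (cong strOf (Explains.act H)) (same owP₀ H))))))
        where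
        module F₀ = Fin j₀ (inv j₀) t₁ c₀ st₁
        topMarker≡P₀ : topMarker C i t ≡ suc P₀
        topMarker≡P₀ = trans topMarker-t M≡
        owP₀ : owner P₀ ≡ j₀
        owP₀ = trans (cong half cP) (half-sdbl j₀)
        H : Explains C n (owner P₀) t P₀ (explanation C n t P₀)
        H = explanation-explains C n t P₀ (lt-sound _ _ (subst (λ m → explained C n t m ≡ true) topMarker≡P₀ env))
        same : ∀ {k t′} → k ≡ j₀ → (H : Explains C n k t P₀ t′) → fst (Explains.c H) ≡ fst c₀
        same refl H = cong fst (settled-unique (Env.explains-settled j₀ (inv j₀) (subst (Inv.M (inv j₀) ≤_) lenP F₀.M≤P) H) st₁)

      -- The position of the previous marker falls between the ranges of `old` and of `ones` and
      -- `zeros`. It lies in an earlier column, so `low` decides it.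
      markerBit : ∀ q → q < P → M ≡ suc q → M ≡ 0 ⊎ Own i M → C q ≡ bit τ q
      markerBit q l e (inj₁ z) = ⊥-elim (1+n≢0 (trans (sym e) z))
      markerBit q l e (inj₂ (mkOwn M≡ j<i cP _ _ _ _)) = sym (Adm.low ad q l (subst (λ z → fst z < dbl i) (suc-injective (trans (sym M≡) e)) (subst (_< dbl i) (sym cP) (dbl-mono< j<i))))

      -- If `q` were omitted, then `snd q` would be a stage with the final candidate. Such a stage
      -- exceeds `P`, whereas `q` is below `P`.
      T-bit : ∀ q → q < P → M ≤ q → fst q ≡ dbl i → C q ≡ bit τ q
      T-bit q l k e = trans (bit≡ (C q) refl) (sym (Adm.ones ad q l (subst (_≤ q) (sym topMarker-t) k) e))
        where
        q≡ : ⟪ dbl i , snd q ⟫ ≡ q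
        q≡ = trans (cong (λ z → ⟪ z , snd q ⟫) (sym e)) (pair-fs q)
        bit≡ : ∀ b → C q ≡ b → C q ≡ true
        bit≡ true z = z
        bit≡ false z = ⊥-elim (absurd (T-out (snd q) (subst (M ≤_) (sym q≡) k) (trans (cong C q≡) z)))
          where
          absurd : Σ ℕ (Settled i (snd q)) → ⊥
          absurd (c′ , st′) = <-irrefl refl (<-≤-trans (subst (λ z → len (fst z) < snd q) (settled-unique st′ st) (Active.len< (active (proj₁ st′)))) (≤-trans (snd≤ q) (<⇒≤ l)))

      W-bit : ∀ q → q < P → M ≤ q → fst q ≡ suc (dbl i) → C q ≡ bit τ q
      W-bit q l k e = trans (≢true⇒false λ z → <-irrefl (uniqueP q z e k) l) (sym (Adm.zeros ad q l (subst (_≤ q) (sym topMarker-t) k) e))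

      -- Stage `P` separates two mechanisms. Up to it, the induction over columns lets `τ` replace
      -- `C`, and `closed` applies. After it, the last marker lies above `q`, so `follow` is the
      -- only clause left.
      highBit : ∀ q → q < P → suc (dbl i) < fst q → (∀ r → fst r < fst q → r < P → C r ≡ bit τ r) → C q ≡ bit τ q
      highBit q l k rec = bool-iff (λ z → out (C-out q z)) inn
        where
        iq = owner q
        i<iq : i < iq
        i<iq = dbl-cancel< (≤-pred (<-≤-trans k (≤sdbl-half (fst q))))
        tooLow : ∀ s → P < s → topMarker C iq s ≤ q → bit τ q ≡ true
        tooLow s P<s le with above s iq i<iq P<s
        ... | p , e , _ , P≤p = ⊥-elim (<-irrefl refl (<-≤-trans l (≤-trans P≤p (≤-trans (n≤1+n p) (subst (_≤ q) e le)))))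
        out : (Σ ℕ λ s → enters C n q s ≡ true) → bit τ q ≡ true
        out (s , E) with <-≤-connex P s
        ... | inj₂ s≤P = Adm.closed ad q l k s s≤P (trans (sym (enters-cong C (bit τ) n (candidate (bit τ)) q s
              (λ r r<s r< → rec r r< (<-≤-trans r<s s≤P))
              λ j t′ t≤ j≤ → candidate-cong C (bit τ) j t′ λ r r<t r< → rec r (<-≤-trans r< j≤) (<-≤-trans r<t (≤-trans t≤ s≤P)))) E)
        ... | inj₁ P<s = late (enters-view C n q s E)
          where
          late : Entry C n q s → bit τ q ≡ true
          late (byT _ le _ _) = tooLow s P<s le
          late (byW _ le _ _ _) = tooLow s P<s le
          late (byFollow p e ex< q<p b) = fin (ext s iq i<iq P<s (subst (λ m → explained C n s m ≡ true) (sym e) (lt-complete ex<)))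
            where
            fin : (Σ ℕ λ p → topMarker C iq s ≡ suc p × P ≤ p × explanation C n s p < s × (∀ q → q < P → bit (forced C n s p) q ≡ bit τ q)) → bit τ q ≡ true
            fin (p′ , e′ , _ , _ , bs) = trans (sym (bs q l)) (subst (λ z → bit (forced C n s z) q ≡ true) (suc-injective (trans (sym e) e′)) b)
        inn : bit τ q ≡ true → C q ≡ true
        inn b = go (Env.explained-ev iq (inv iq))
          where
          go : Eventually (λ s → explained C n s (topMarker C iq s) ≡ true) → C q ≡ true
          -- Every late enough stage is explained, so some stage beyond `P` copies the bit.
          go (s₀ , h) = fin (ext s iq i<iq (m≤n⊔m s₀ (suc P)) (h s (m≤m⊔n s₀ (suc P))))
            where
            s = s₀ ⊔ suc P
            fin : (Σ ℕ λ p → topMarker C iq s ≡ suc p × P ≤ p × explanation C n s p < s × (∀ q → q < P → bit (forced C n s p) q ≡ bit τ q)) → C q ≡ true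
            fin (p , e , P≤p , ex< , bs) = C-in q s (enters-follow C n q s p e ex< (<-≤-trans l P≤p) (trans (bs q l) b))

      cols : ∀ m → (∀ {m′} → m′ < m → ∀ q → fst q ≡ m′ → q < P → C q ≡ bit τ q) → ∀ q → fst q ≡ m → q < P → C q ≡ bit τ q
      cols m rec q refl l with <-≤-connex (suc q) M
      ... | inj₁ k = oldBits q l k own
      ... | inj₂ k with m≤n⇒m<n∨m≡n k
      ...   | inj₂ e = markerBit q l e own
      ...   | inj₁ (s≤s M≤q) with <-≤-connex (fst q) (dbl i)
      ...     | inj₁ lo = sym (Adm.low ad q l lo)
      ...     | inj₂ hi with m≤n⇒m<n∨m≡n hi
      ...       | inj₂ e = T-bit q l M≤q (sym e)
      ...       | inj₁ hi′ with m≤n⇒m<n∨m≡n hi′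
      ...         | inj₂ e = W-bit q l M≤q (sym e)
      ...         | inj₁ hi″ = highBit q l hi″ λ r r< r<P → rec r< r refl r<P

-- The stage grows while the search for the limit stops at `c`, so the bounds differ; a witness
-- below both fixes the result.
least-eq : ∀ n m P Q c → c < n → c < m → P c ≡ true → (∀ k → k ≤ c → P k ≡ Q k) → least n P ≡ least m Q
least-eq n m P Q c c<n c<m Pc eq = ≤-antisym (no-less n m P Q c c<n c<m Pc eq) (no-less m n Q P c c<m c<n (trans (sym (eq c ≤-refl)) Pc) λ k l → sym (eq k l))
  where
  no-less : ∀ n m P Q c → c < n → c < m → P c ≡ true → (∀ k → k ≤ c → P k ≡ Q k) → least n P ≤ least m Q
  no-less n m P Q c c<n c<m Pc eq with least n P | least-spec n P | least m Q | least-spec m Q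
  ... | r | none _ hi | _ | _ = clash Pc (hi c c<n)
  ... | r | found _ _ _ | r′ | none _ hi = clash (trans (sym (eq c ≤-refl)) Pc) (hi c c<m)
  ... | r | found _ _ lo | r′ | found _ Qr lo′ = ≮⇒≥ λ l → clash (trans (eq r′ (≮⇒≥ λ c<r′ → clash (trans (sym (eq c ≤-refl)) Pc) (lo′ c c<r′))) Qr) (lo r′ l)

strOracle-agree : ∀ {h : ℕ → Bool} {τ} → (∀ q → q < len τ → bit τ q ≡ h q) → ∀ z → strOracle τ z < 2 → strOracle τ z ≡ b2n (h z)
strOracle-agree {h} {τ} a z l with z <ᵇ len τ in e
... | true = cong b2n (a z (lt-sound _ _ e))
... | false = ⊥-elim (<-irrefl refl l)

strOracle-str : ∀ h ℓ z → z < ℓ → strOracle (str h ℓ) z ≡ b2n (h z)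
strOracle-str h ℓ z l = trans (cong (λ b → if b then b2n (bit (str h ℓ) z) else 2) (lt-complete (subst (z <_) (sym (len-str h ℓ)) l))) (cong b2n (bit-str h ℓ z l))

candidate-len : ∀ h j t c → candidate h j t ≡ suc c → len (fst c) < t
candidate-len h j t c e = go (if-suc (trans (sym (candidate-unfold h j t)) e))
  where
  go : explained h (candidate h) t (topMarker h j t) ≡ true × pick t (status h (candidate h) (λ τ → candidate (bit τ)) j t (topMarker h j t)) ≡ suc c → len (fst c) < t
  go (_ , b) = ≤-<-trans (len≤c c) (fits-< (∧-l (proj₂ (pick-suc {t} {status h (candidate h) (λ τ → candidate (bit τ)) j t (topMarker h j t)} b))))

-- Strings compatible with the outcome that no candidate is final

module Outcome (lem : (P : Set) → Dec P) (K : ℕ → Bool) (isK : IsHaltingSet K) (C : ℕ → Bool)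
  (C-out : ∀ q → C q ≡ true → Σ ℕ λ s → enters C (candidate C) q s ≡ true)
  (C-in : ∀ q s → enters C (candidate C) q s ≡ true → C q ≡ true) where

  open Truth lem C C-out C-in

  -- At an explained stage past `M` the forced string is that of the last requirement with a final
  -- candidate, and `C` extends it by `forcing`.
  forced-C : ∀ i s → let M = Inv.M (inv i) in M ≤ s → explained C n s (topMarker C i s) ≡ true → ∀ q → suc q < M → bit (forced C n s (pred M)) q ≡ C q
  forced-C i s l ok q k = go own
    where
    open Env i (inv i)
    go : M ≡ 0 ⊎ Own i M → bit (forced C n s (pred M)) q ≡ C q
    go (inj₁ e) = ⊥-elim (n≮0 (subst (suc q <_) e k))
    go (inj₂ (mkOwn {P₀} {j₀} {t₁} {c₀} M≡ j<i cP _ st₁ lenP _)) =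
      trans (cong (λ z → bit (forced C n s z) q) (cong pred M≡)) (trans (cong (λ z → bit z q) (trans (cong strOf (Explains.act H)) (same owP₀ H)))
        (sym (forcing j₀ t₁ c₀ st₁ q (subst (q <_) (sym lenP) (≤-pred (subst (suc q <_) M≡ k))))))
      where
      module F₀ = Fin j₀ (inv j₀) t₁ c₀ st₁
      owP₀ : owner P₀ ≡ j₀
      owP₀ = trans (cong half cP) (half-sdbl j₀)
      H : Explains C n (owner P₀) s P₀ (explanation C n s P₀)
      H = explanation-explains C n s P₀ (lt-sound _ _ (subst (λ m → explained C n s m ≡ true) (trans (topMarker≡ s l) M≡) ok))
      same : ∀ {k t′} → k ≡ j₀ → (H : Explains C n k s P₀ t′) → fst (Explains.c H) ≡ fst c₀
      same refl H = cong fst (settled-unique (Env.explains-settled j₀ (inv j₀) (subst (Inv.M (inv j₀) ≤_) lenP F₀.M≤P) H) st₁)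

  -- The limit of `Adm`: stage, last marker and forced string are replaced by `M` and `C`. At steady
  -- stages the two agree, so admissibility of a fixed string eventually stops changing.
  record Good (i τ : ℕ) : Set where
    M = Inv.M (inv i)
    field
      lenCol : fst (len τ) ≡ suc (dbl i)
      M≤len  : M ≤ len τ
      low    : ∀ q → q < len τ → fst q < dbl i → bit τ q ≡ C q
      old    : ∀ q → q < len τ → suc q < M → bit τ q ≡ C q
      ones   : ∀ q → q < len τ → M ≤ q → fst q ≡ dbl i → bit τ q ≡ true
      zeros  : ∀ q → q < len τ → M ≤ q → fst q ≡ suc (dbl i) → bit τ q ≡ false
      closed : ∀ q → q < len τ → suc (dbl i) < fst q → ∀ s′ → s′ ≤ len τ → enters (bit τ) (candidate (bit τ)) q s′ ≡ true → bit τ q ≡ true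

  admC : ℕ → ℕ → ℕ → Bool
  admC i s τ = adm C n (candidate (bit τ)) i s (topMarker C i s) τ

  Steady : ℕ → ℕ → Set
  Steady i s = Inv.M (inv i) ≤ s × explained C n s (topMarker C i s) ≡ true

  steady : ∀ i → Eventually (Steady i)
  steady i = ev-× (ev-≥ (Inv.M (inv i))) (Env.explained-ev i (inv i))

  adm-good : ∀ i s τ → Steady i s → admC i s τ ≡ true → Good i τ
  adm-good i s τ (l , ok) e = record
    { lenCol = lenCol
    ; M≤len = subst (_≤ len τ) topMarker≡M m≤len
    ; low = low
    ; old = λ q a b → trans (old q a (subst (suc q <_) (sym topMarker≡M) b)) (trans (cong (λ z → bit (forced C n s (pred z)) q) topMarker≡M) (forced-C i s l ok q b))
    ; ones = λ q a b → ones q a (subst (_≤ q) (sym topMarker≡M) b)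
    ; zeros = λ q a b → zeros q a (subst (_≤ q) (sym topMarker≡M) b)
    ; closed = closed }
    where
    open Adm (adm-sound C n (candidate (bit τ)) i s (topMarker C i s) τ e)
    topMarker≡M : topMarker C i s ≡ Inv.M (inv i)
    topMarker≡M = Env.topMarker≡ i (inv i) s l

  good-adm : ∀ i s τ → Steady i s → Good i τ → admC i s τ ≡ true
  good-adm i s τ (l , ok) g = adm-complete C n (candidate (bit τ)) i s (topMarker C i s) τ (record
    { lenCol = lenCol
    ; m≤len = subst (_≤ len τ) (sym topMarker≡M) M≤len
    ; low = low
    ; old = λ q a b → trans (old q a (subst (suc q <_) topMarker≡M b)) (sym (trans (cong (λ z → bit (forced C n s (pred z)) q) topMarker≡M) (forced-C i s l ok q (subst (suc q <_) topMarker≡M b))))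
    ; ones = λ q a b → ones q a (subst (_≤ q) topMarker≡M b)
    ; zeros = λ q a b → zeros q a (subst (_≤ q) topMarker≡M b)
    ; closed = closed })
    where
    open Good g
    topMarker≡M : topMarker C i s ≡ Inv.M (inv i)
    topMarker≡M = Env.topMarker≡ i (inv i) s l

  record Proof (i τ X v L : ℕ) : Set where
    constructor mkProof
    field
      pos  : 0 < L
      vld  : CS.V τ L
      hdL  : hd L ≡ fact (fst i) X v

  module Req (i : ℕ) (B : ℕ → Bool) (ΦC : ∀ x → Eval C (decode (fst i)) x (χ B x)) (ΦK : ∀ x → Eval K (decode (snd i)) x (χ B x)) where

    -- A final candidate differs from the guess at every late stage. But `C` extends its string, so
    -- its certificate yields `χ B X`, to which the guess converges.
    unsettled : ∀ t c → ¬ Settled i t c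
    unsettled t c st = go (guess-settles K isK (ΦK X))
      where
      X = candX c
      L = candL c
      v = fy (hd L)
      refutesAt : ∀ s → t ≤ s → Refutes i s c
      refutesAt s l = Active.ct (active (proj₁ (settled-later s l st)))
      open Refutes (refutesAt t ≤-refl) using (pos; vld; prog; arg)
      v≡ : v ≡ χ B X
      v≡ = det (subst₂ (λ e x → Eval C (decode e) x v) prog arg (CS.sound C (fst c) L (λ z _ → strOracle-agree {C} {fst c} (λ q l → sym (forcing i t c st q l)) z) vld (In-hd L pos))) (ΦC X)
      go : Eventually (λ s → guess (snd i) s X ≡ χ B X) → ⊥
      go (s₀ , h) = Refutes.wrong (refutesAt (t ⊔ s₀) (m≤m⊔n t s₀)) (trans (h _ (m≤n⊔m t s₀)) (sym v≡))

    statusC : ℕ → ℕ → Bool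
    statusC s c = status C n (λ τ → candidate (bit τ)) i s (topMarker C i s) c

    -- Each of the three tests has a limit: `fits` becomes true, admissibility becomes `Good`, and
    -- refutation follows the convergent guess.
    statusC-settles : ∀ c → Σ Bool λ b → Eventually λ s → statusC s c ≡ b
    statusC-settles c = go (lem (Good i (fst c)))
      where
      b₀ = (0 <ᵇ candL c) ∧ (CS.valid (fst c) (candL c) ∧ ((fe (hd (candL c)) ≡ᵇ fst i) ∧ ((fx (hd (candL c)) ≡ᵇ candX c) ∧ not (χ B (candX c) ≡ᵇ fy (hd (candL c))))))
      refutes-ev : Eventually λ s → refutes i s c ≡ b₀
      refutes-ev = ev-map (λ s e → cong (λ g → (0 <ᵇ candL c) ∧ (CS.valid (fst c) (candL c) ∧ ((fe (hd (candL c)) ≡ᵇ fst i) ∧ ((fx (hd (candL c)) ≡ᵇ candX c) ∧ not (g ≡ᵇ fy (hd (candL c))))))) e) (guess-settles K isK (ΦK (candX c)))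
      fits-ev : Eventually λ s → fits c s ≡ true
      fits-ev = ev-map (λ s l → lt-complete l) (ev-≥ (suc (str (λ _ → true) c + c)))
      go : Dec (Good i (fst c)) → Σ Bool λ b → Eventually λ s → statusC s c ≡ b
      go (yes g) = b₀ , ev-map (λ { s (a , b , d) → cong₂ _∧_ a (cong₂ _∧_ (good-adm i s (fst c) b g) d) }) (ev-× fits-ev (ev-× (steady i) refutes-ev))
      go (no ng) = false , ev-map (λ { s (a , b) → cong₂ _∧_ a (cong (_∧ refutes i s c) (≢true⇒false λ e → ng (adm-good i s (fst c) b e))) }) (ev-× fits-ev (steady i))

    -- With a wrong value, `c` would pass all tests from some stage on. The status of every number
    -- up to `c` settles, so the least passing one would become a final candidate, against
    -- `unsettled`.
    agrees : ∀ {τ X v L} → Good i τ → Proof i τ X v L → v ≡ χ B X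
    agrees {τ} {X} {v} {L} g (mkProof pos vld hdL) = decide (v ≟ χ B X)
      where
      c = ⟪ τ , ⟪ X , L ⟫ ⟫
      cτ : fst c ≡ τ
      cτ = fst-pair _ _
      cX : candX c ≡ X
      cX = trans (cong fst (snd-pair _ _)) (fst-pair _ _)
      cL : candL c ≡ L
      cL = trans (cong snd (snd-pair _ _)) (snd-pair _ _)
      decide : Dec (v ≡ χ B X) → v ≡ χ B X
      decide (yes p) = p
      decide (no p) = ⊥-elim (contra all-ev)
        where
        b : ℕ → Bool
        b k = proj₁ (statusC-settles k)
        good-ev : Eventually λ s → statusC s c ≡ true
        good-ev = ev-map (λ { s (bd , sd , gs) → ∧-i (lt-complete bd) (∧-i (subst (λ z → admC i s z ≡ true) (sym cτ) (good-adm i s τ sd g)) (refutes-complete i s c (record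
            { pos = subst (0 <_) (sym cL) pos
            ; vld = subst₂ CS.V (sym cτ) (sym cL) vld
            ; prog = trans (cong (λ z → fe (hd z)) cL) (trans (cong fe hdL) (fe-fact _ _ _))
            ; arg = trans (cong (λ z → fx (hd z)) cL) (trans (cong fx hdL) (trans (fx-fact _ _ _) (sym cX)))
            ; wrong = λ e → p (trans (sym (trans (cong (λ z → fy (hd z)) cL) (trans (cong fy hdL) (fy-fact _ _ _)))) (trans (sym e) (trans (cong (guess (snd i) s) cX) gs))) }))) })
          (ev-× (ev-≥ (suc (str (λ _ → true) c + c))) (ev-× (steady i) (guess-settles K isK (ΦK X))))
        all-ev : Eventually λ s → suc c ≤ s × (explained C n s (topMarker C i s) ≡ true × (statusC s c ≡ true × (∀ k → k < suc c → statusC s k ≡ b k)))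
        all-ev = ev-× (ev-≥ (suc c)) (ev-× (Env.explained-ev i (inv i)) (ev-× good-ev (ev-all (suc c) λ k _ → proj₂ (statusC-settles k))))
        r = least (suc c) b
        contra : Eventually (λ s → suc c ≤ s × (explained C n s (topMarker C i s) ≡ true × (statusC s c ≡ true × (∀ k → k < suc c → statusC s k ≡ b k)))) → ⊥
        contra (s₀ , h) = unsettled s₀ r (val s₀ ≤-refl , λ s l → trans (val s l) (sym (val s₀ ≤-refl)))
          where
          val : ∀ s → s₀ ≤ s → n i s ≡ suc r
          val s l = fin (h s l)
            where
            fin : suc c ≤ s × (explained C n s (topMarker C i s) ≡ true × (statusC s c ≡ true × (∀ k → k < suc c → statusC s k ≡ b k))) → n i s ≡ suc r
            fin (c<s , ok , sc , ag) = trans (candidate-unfold C i s) (trans (cong (λ z → if z then pick s (statusC s) else 0) ok)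
              (trans (cong (λ z → if z <ᵇ s then suc z else 0) lr) (cong (λ z → if z then suc r else 0) (lt-complete r<s))))
              where
              lr : least s (statusC s) ≡ r
              lr = least-eq s (suc c) (statusC s) b c c<s ≤-refl sc λ k l → ag k (s≤s l)
              r<s : r < s
              r<s = ≤-<-trans r≤c c<s
                where
                r≤c : r ≤ c
                r≤c with least (suc c) b | least-spec (suc c) b
                ... | x | none _ hi = clash (trans (sym (ag c ≤-refl)) sc) (hi c ≤-refl)
                ... | x | found l _ _ = ≤-pred l

    -- Such an `h` may deviate from `C` only past the last marker and in columns after
    -- `suc (dbl i)`, where closure under enumeration is all that is asked. Since nothing is
    -- settled, `C` itself has the ones and zeros that `Good` prescribes.
    good-str : ∀ h ℓ → fst ℓ ≡ suc (dbl i) → Inv.M (inv i) ≤ ℓ → (∀ q → q < ℓ → fst q ≤ suc (dbl i) → h q ≡ C q) → (∀ q → suc q < Inv.M (inv i) → h q ≡ C q) →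
      (∀ q → q < ℓ → suc (dbl i) < fst q → ∀ s → s ≤ ℓ → enters h (candidate h) q s ≡ true → h q ≡ true) → Good i (str h ℓ)
    good-str h ℓ cℓ M≤ℓ lo old hi = record
      { lenCol = trans (cong fst (len-str h ℓ)) cℓ
      ; M≤len = subst (M ≤_) (sym (len-str h ℓ)) M≤ℓ
      ; low = λ q a b → trans (bt q a) (lo q (lt q a) (≤-trans (<⇒≤ b) (n≤1+n _)))
      ; old = λ q a b → trans (bt q a) (old q b)
      ; ones = λ q a b e → trans (bt q a) (trans (lo q (lt q a) (≤-trans (≤-reflexive e) (n≤1+n _))) (inT q b e (C q) refl))
      ; zeros = λ q a b e → trans (bt q a) (trans (lo q (lt q a) (≤-reflexive e)) (≢true⇒false λ z → noW (W-out q z e b)))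
      ; closed = λ q a b s s≤ E → trans (bt q a) (hi q (lt q a) b s (subst (s ≤_) (len-str h ℓ) s≤) (trans (sym (enters-cong (bit τ) h (candidate (bit τ)) (candidate h) q s
          (λ p p<s _ → bt p (<-≤-trans p<s s≤)) λ j t t≤ _ → candidate-cong (bit τ) h j t λ p p<t _ → bt p (<-≤-trans p<t (≤-trans t≤ s≤)))) E)) }
      where
      open Env i (inv i)
      τ = str h ℓ
      lt : ∀ q → q < len τ → q < ℓ
      lt q a = subst (q <_) (len-str h ℓ) a
      bt : ∀ q → q < len τ → bit τ q ≡ h q
      bt q a = bit-str h ℓ q (lt q a)
      inT : ∀ q → M ≤ q → fst q ≡ dbl i → ∀ b → C q ≡ b → C q ≡ true
      inT q b e true z = z
      inT q b e false z = ⊥-elim (no-st (T-out (snd q) (subst (M ≤_) (sym q≡) b) (trans (cong C q≡) z)))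
        where
        q≡ : ⟪ dbl i , snd q ⟫ ≡ q
        q≡ = trans (cong (λ z → ⟪ z , snd q ⟫) (sym e)) (pair-fs q)
        no-st : Σ ℕ (Settled i (snd q)) → ⊥
        no-st (c , st) = unsettled _ c st
      noW : ∀ {p} → (Σ ℕ λ t → Σ ℕ λ c → Settled i t c × len (fst c) ≡ p) → ⊥
      noW (t , c , st , _) = unsettled t c st

    good-C : ∀ ℓ → fst ℓ ≡ suc (dbl i) → Inv.M (inv i) ≤ ℓ → Good i (str C ℓ)
    good-C ℓ a b = good-str C ℓ a b (λ _ _ _ → refl) (λ _ _ → refl) λ q _ _ s _ E → C-in q s E

-- Computing a set below both `C` and the halting set

eventuallyConstant-computable : ∀ N₀ (f : ℕ → Bool) b → (∀ y → N₀ ≤ y → f y ≡ b) → CpB f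
eventuallyConstant-computable zero f b e = cext (λ y → cong b2n (sym (e y z≤n))) (ck (b2n b))
eventuallyConstant-computable (suc N₀) f b e = cext eq (cif (cid c≡ ck N₀) (ck (b2n (f N₀))) (eventuallyConstant-computable N₀ f′ b e′))
  where
  f′ : ℕ → Bool
  f′ y = if y ≡ᵇ N₀ then b else f y
  e′ : ∀ y → N₀ ≤ y → f′ y ≡ b
  e′ y l with y ≡ᵇ N₀ in z
  ... | true = refl
  ... | false = e y (≤∧≢⇒< l λ k → clash (eq-complete (sym k)) z)
  eq : ∀ y → (if y ≡ᵇ N₀ then b2n (f N₀) else b2n (f′ y)) ≡ b2n (f y)
  eq y with y ≡ᵇ N₀ in z
  ... | true = cong (λ k → b2n (f k)) (sym (eq-sound y N₀ z))
  ... | false = refl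

below-suc : ∀ h m p → below h (suc m) p ≡ (if fst p ≡ᵇ m then h ⟪ m , snd p ⟫ else below h m p)
below-suc h m p with fst p ≡ᵇ m in e
... | true = trans (below-here h (suc m) p (s≤s (≤-reflexive (eq-sound _ _ e)))) (cong h (trans (sym (pair-fs p)) (cong (λ k → ⟪ k , snd p ⟫) (eq-sound _ _ e))))
... | false with <-≤-connex (fst p) m
...   | inj₁ l = trans (below-here h (suc m) p (≤-trans l (n≤1+n m))) (sym (below-here h m p l))
...   | inj₂ l = trans (out (suc m) (≤∧≢⇒< l λ k → clash (eq-complete (sym k)) e)) (sym (out m l))
  where
  out : ∀ k → k ≤ fst p → below h k p ≡ false
  out k le with fst p <ᵇ k in z
  ... | true = ⊥-elim (<-irrefl refl (<-≤-trans (lt-sound _ _ z) le))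
  ... | false = refl

-- The empty oracle always answers 0, so `Zero` can stand in for a query. The new program gives the
-- same value from any oracle, in particular from `K`.
noOracle : Code → Code
noOracle Oracle = Zero
noOracle (Comp f g) = Comp (noOracle f) (noOracle g)
noOracle (Pair f g) = Pair (noOracle f) (noOracle g)
noOracle (Prec f g) = Prec (noOracle f) (noOracle g)
noOracle (Mu f) = Mu (noOracle f)
noOracle c = c

noOracle-eval : ∀ {X c x y} → Eval ∅ c x y → Eval X (noOracle c) x y
noOracle-eval ezero = ezero
noOracle-eval esucc = esucc
noOracle-eval eid = eid
noOracle-eval eleft = eleft
noOracle-eval eright = eright
noOracle-eval eorc = ezero
noOracle-eval (ecomp a b) = ecomp (noOracle-eval a) (noOracle-eval b)
noOracle-eval (epair a b) = epair (noOracle-eval a) (noOracle-eval b)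
noOracle-eval (eprec0 e a) = eprec0 e (noOracle-eval a)
noOracle-eval (eprecS e a b) = eprecS e (noOracle-eval a) (noOracle-eval b)
noOracle-eval (emu a h) = emu (noOracle-eval a) λ m l → proj₁ (h m l) , noOracle-eval (proj₂ (h m l))

module Final (lem : (P : Set) → Dec P) (K : ℕ → Bool) (isK : IsHaltingSet K) (C : ℕ → Bool)
  (C-out : ∀ q → C q ≡ true → Σ ℕ λ s → enters C (candidate C) q s ≡ true)
  (C-in : ∀ q s → enters C (candidate C) q s ≡ true → C q ≡ true) where

  open Truth lem C C-out C-in
  open Outcome lem K isK C C-out C-in

  -- An odd column is bounded by the `M` of the next requirement. An even one is, past a threshold,
  -- empty or full according to whether a final candidate exists. Neither case nor threshold is
  -- found effectively.
  column-constant : ∀ m → Σ Bool λ b → Eventually λ y → C ⟪ m , y ⟫ ≡ b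
  column-constant m = go (half-cases m)
    where
    i = half m
    open Env i (inv i)
    go : _ → Σ Bool λ b → Eventually λ y → C ⟪ m , y ⟫ ≡ b
    go (inj₂ (e , o)) = false , Inv.M (inv (suc i)) , λ y l → ≢true⇒false λ z → <-irrefl refl (<-≤-trans (Inv.top (inv (suc i)) _ z (trans (cong par (fst-pair _ _)) o)
        (subst (_< dbl (suc i)) (sym (fst-pair _ _)) (subst (_< dbl (suc i)) (sym e) (dbl-mono< ≤-refl)))) (≤-trans l (y≤pair m y)))
    go (inj₁ (e , _)) = even (lem (Σ ℕ λ t → Σ ℕ λ c → Settled i t c))
      where
      even : Dec (Σ ℕ λ t → Σ ℕ λ c → Settled i t c) → Σ Bool λ b → Eventually λ y → C ⟪ m , y ⟫ ≡ b
      even (yes (t , c , st)) = false , t ⊔ M , λ y l → trans (cong (λ k → C ⟪ k , y ⟫) e)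
        (T-in y c (≤-trans (≤-trans (m≤n⊔m t M) l) (y≤pair (dbl i) y)) (settled-later y (≤-trans (m≤m⊔n t M) l) st))
      even (no ns) = true , M , λ y l → trans (cong (λ k → C ⟪ k , y ⟫) e) (inn y l (C ⟪ dbl i , y ⟫) refl)
        where
        inn : ∀ y → M ≤ y → ∀ b → C ⟪ dbl i , y ⟫ ≡ b → C ⟪ dbl i , y ⟫ ≡ true
        inn y l true z = z
        inn y l false z = ⊥-elim (ns (y , T-out y (≤-trans l (y≤pair (dbl i) y)) z))

  below-computable : ∀ m → CpB (below C m)
  below-computable zero = cext (λ p → cong b2n (sym (zero≡ p))) (ck 0)
    where
    zero≡ : ∀ p → below C 0 p ≡ false
    zero≡ p with fst p
    ... | zero = refl
    ... | suc _ = refl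
  below-computable (suc m) = cext (λ p → cong b2n (sym (below-suc C m p))) (cifB (cv0 c≡ ck m) (cc col cv1) (below-computable m))
    where
    k = column-constant m
    col : CpB λ y → C ⟪ m , y ⟫
    col = eventuallyConstant-computable (proj₁ (proj₂ k)) (λ y → C ⟪ m , y ⟫) (proj₁ k) (proj₂ (proj₂ k))

  module Compute (i : ℕ) (B : ℕ → Bool) (ΦC : ∀ x → Eval C (decode (fst i)) x (χ B x)) (ΦK : ∀ x → Eval K (decode (snd i)) x (χ B x)) where
    open Req i B ΦC ΦK

    -- Admissibility for `i` reads `C` only in these columns, which are computable, so `Z` can
    -- replace `C` in a program.
    Z : ℕ → Bool
    Z = below C (dbl i)

    s₀ = proj₁ (steady i)

    admZ : ℕ → ℕ → Bool
    admZ s τ = adm Z (candidate Z) (candidate (bit τ)) i s (topMarker Z i s) τ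

    admZ≡ : ∀ s τ → len τ ≤ s → admZ s τ ≡ admC i s τ
    admZ≡ s τ l = trans (cong (λ m → adm Z (candidate Z) (candidate (bit τ)) i s m τ) (topMarker-cong Z C i s agree))
      (adm-cong Z C (candidate Z) n (candidate (bit τ)) (candidate (bit τ)) i s (topMarker C i s) τ l agree same λ _ _ _ _ → refl)
      where
      agree : ∀ p → p < s → fst p < dbl i → Z p ≡ C p
      agree p _ k = below-here C (dbl i) p k
      same : ∀ p → topMarker C i s ≡ suc p → Same {Z} {C} {candidate Z} {n} {s} (owner p)
      same p e = (λ t k → below-here C (dbl i) _ (subst (_< dbl i) (sym (fst-pair _ _)) lt)) ,
                 λ t k → candidate-cong Z C (owner p) t λ r _ r< → below-here C (dbl i) r (<-trans r< lt)
        where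
        lt : dbl (owner p) < dbl i
        lt = <-trans ≤-refl (dbl-mono< (TopMarker.own< (topMarker-suc {C} {i} {s} e)))

    -- Here `z` codes a stage together with string, input and certificate. The clause `fits` keeps
    -- the string shorter than the stage, as `admZ≡` demands; by `agrees`, every hit of the search
    -- carries the right value.
    test : ℕ → ℕ → Bool
    test x z = (s₀ <ᵇ suc (fst z)) ∧ (fits (snd z) (fst z) ∧ (admZ (fst z) (fst (snd z)) ∧ ((0 <ᵇ candL (snd z)) ∧
      (CS.valid (fst (snd z)) (candL (snd z)) ∧ ((fe (hd (candL (snd z))) ≡ᵇ fst i) ∧ (fx (hd (candL (snd z))) ≡ᵇ x))))))

    ctest : CpB2 test
    ctest = (ck s₀ c< cs (cl cv1)) c∧ (cfits (cr cv1) (cl cv1) c∧ (cadm {λ _ → Z} {λ _ → candidate Z} {λ e → candidate (bit (fst (snd (snd e))))}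
        (cc (below-computable (dbl i)) cv1) (ccandidate {λ _ → Z} (cc (below-computable (dbl i)) cv1)) (ccandidate {λ e → bit (fst (snd (snd e)))} (cbit (cl (cr (cr cv0))) cv1))
        (ck i) (cl cv1) (ctopMarker {λ _ → Z} (cc (below-computable (dbl i)) cv1) (ck i) (cl cv1)) (cl (cr cv1)) c∧
      ((ck 0 c< L) c∧ (CS.cvalid cstrOracle (cl (cr cv1)) L c∧ ((cl (chd L) c≡ ck (fst i)) c∧ (cl (cr (chd L)) c≡ cv0))))))
      where L = cr (cr (cr cv1))

    correct : ∀ x z → test x z ≡ true → fy (hd (candL (snd z))) ≡ χ B x
    correct x z e = trans (agrees (adm-good i s τ (proj₂ (steady i) s (≤-pred (lt-sound _ _ (∧-l e)))) (trans (sym (admZ≡ s τ len≤s)) (∧-l e₂)))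
        (mkProof (lt-sound _ _ (∧-l e₃)) (CS.valid-V {τ} {L} (∧-l e₄)) hdL)) (cong (χ B) (eq-sound _ _ (∧-r {fe (hd L) ≡ᵇ fst i} e₅)))
      where
      s = fst z
      c = snd z
      τ = fst c
      L = candL c
      e₁ = ∧-r {s₀ <ᵇ suc s} e
      e₂ = ∧-r {fits c s} e₁
      e₃ = ∧-r {admZ s τ} e₂
      e₄ = ∧-r {0 <ᵇ L} e₃
      e₅ = ∧-r {CS.valid τ L} e₄
      len≤s : len τ ≤ s
      len≤s = ≤-trans (len≤c c) (<⇒≤ (fits-< {c} {s} (∧-l e₁)))
      hdL : hd L ≡ fact (fst i) (fx (hd L)) (fy (hd L))
      hdL = trans (sym (pair-fs _)) (cong₂ ⟪_,_⟫ (eq-sound _ _ (∧-l e₅)) (sym (pair-fs _)))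

    exists : ∀ x → Σ ℕ λ z → test x z ≡ true
    exists x = go (CS.certificate C {fst i} (ΦC x))
      where
      M = Inv.M (inv i)
      go : (Σ ℕ λ L → 0 < L × hd L ≡ fact (fst i) x (χ B x) × Σ ℕ λ k → ∀ w → CS.Agree C w k → CS.V w L) → Σ ℕ λ z → test x z ≡ true
      go (L , pos , hdL , k , v) = ⟪ s , c ⟫ , subst₂ (λ a b → ((s₀ <ᵇ suc a) ∧ (fits b a ∧ (admZ a (fst b) ∧ ((0 <ᵇ candL b) ∧
            (CS.valid (fst b) (candL b) ∧ ((fe (hd (candL b)) ≡ᵇ fst i) ∧ (fx (hd (candL b)) ≡ᵇ x))))))) ≡ true) (sym (fst-pair _ _)) (sym (snd-pair _ _))
          (∧-i (lt-complete (s≤s s₀≤s)) (∧-i (lt-complete bd)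
            (subst₂ (λ a b → (admZ s a ∧ ((0 <ᵇ b) ∧ (CS.valid a b ∧ ((fe (hd b) ≡ᵇ fst i) ∧ (fx (hd b) ≡ᵇ x))))) ≡ true) (sym cτ) (sym cL)
              (∧-i (trans (admZ≡ s τ len≤s) (good-adm i s τ (proj₂ (steady i) s s₀≤s) g)) (∧-i (lt-complete pos) (∧-i (CS.V-valid {τ} {L} vL)
                (∧-i (eq-complete (trans (cong fe hdL) (fe-fact _ _ _))) (eq-complete (trans (cong fx hdL) (fx-fact _ _ _))))))))))
        where
        -- An admissible length must lie in this column and be at least `M`; `k` covers the use of
        -- the computation.
        ℓ = ⟪ suc (dbl i) , M ⊔ k ⟫
        τ = str C ℓ
        c = ⟪ τ , ⟪ x , L ⟫ ⟫
        s = suc (str (λ _ → true) c + c) ⊔ s₀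
        bd : str (λ _ → true) c + c < s
        bd = m≤m⊔n (suc (str (λ _ → true) c + c)) s₀
        s₀≤s : s₀ ≤ s
        s₀≤s = m≤n⊔m (suc (str (λ _ → true) c + c)) s₀
        cτ : fst c ≡ τ
        cτ = fst-pair _ _
        cL : candL c ≡ L
        cL = trans (cong snd (snd-pair _ _)) (snd-pair _ _)
        len≤s : len τ ≤ s
        len≤s = ≤-trans (≤-trans (fst≤ τ) (x≤pair τ _)) (≤-trans (m≤n+m c _) (<⇒≤ bd))
        g : Good i τ
        g = good-C ℓ (fst-pair _ _) (≤-trans (m≤m⊔n M k) (y≤pair _ _))
        vL : CS.V τ L
        vL = v τ λ q q<k → strOracle-str C ℓ q (<-≤-trans q<k (≤-trans (m≤n⊔m M k) (y≤pair _ _)))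

    computableB : Computable B
    computableB = proj₁ r , λ x → subst (Eval ∅ (decode (proj₁ r)) x) (correct x _ (proj₁ (mu-spec test ctest exists x))) (proj₂ r x)
      where
      r = computable (cr (cr (chd (cr (cr (cr (cmu test ctest exists)))))))

  -- Noncomputability of `C`

  module NotComputable (comp : Computable C) where
    i₂ = ix (noOracle (decode (proj₁ comp)))
    i = ⟪ ix Oracle , i₂ ⟫

    ΦC : ∀ x → Eval C (decode (fst i)) x (χ C x)
    ΦC x = subst (λ d → Eval C d x (χ C x)) (sym (trans (cong decode (fst-pair _ _)) (decode-ix Oracle))) eorc

    ΦK : ∀ x → Eval K (decode (snd i)) x (χ C x)
    ΦK x = subst (λ d → Eval K d x (χ C x)) (sym (trans (cong decode (snd-pair _ _)) (decode-ix (noOracle (decode (proj₁ comp)))))) (noOracle-eval (proj₂ comp x))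

    open Req i C ΦC ΦK

    M = Inv.M (inv i)
    a = suc (dbl i)
    -- The column lies after `suc (dbl i)`, is odd so that `ownT` never applies to `q`, and is large
    -- enough to give `M ≤ q`.
    m = suc (dbl (suc (i + M)))
    d = m ∸ a
    q = ⟪ m , 0 ⟫
    -- This is the position of column `a` on the diagonal that starts at `q`.
    ℓ = ⟪ a , d ⟫

    a<m : a < m
    a<m = s≤s (<-trans ≤-refl (dbl-mono< (s≤s (m≤m+n i M))))

    sum≡ : a + d ≡ m
    sum≡ = m+[n∸m]≡n (<⇒≤ a<m)

    ℓ≡ : ℓ ≡ q + d
    ℓ≡ = trans (pair-shift a d) (cong (λ k → ⟪ k , 0 ⟫ + d) sum≡)

    m≤q : m ≤ q
    m≤q = x≤pair m 0

    M≤q : M ≤ q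
    M≤q = ≤-trans (≤-trans (≤-trans (m≤n+m M i) (n≤1+n _)) (≤-trans (m≤m+n _ _) (n≤1+n _))) m≤q

    q<ℓ : q < ℓ
    q<ℓ = subst (q <_) (sym ℓ≡) (≤-trans (≤-reflexive (sym (+-comm q 1))) (+-monoʳ-≤ q (m<n⇒0<n∸m a<m)))

    ℓ≤2q : ℓ ≤ q + q
    ℓ≤2q = subst (_≤ q + q) (sym ℓ≡) (+-monoʳ-≤ q (≤-trans (m∸n≤m m a) m≤q))

    fq : fst q ≡ m
    fq = fst-pair m 0

    -- Positions below `ℓ` lie on diagonals up to `m`, and there only `q` has a column as large as
    -- `m`. Hence changing the bit at `q` affects no earlier column.
    corner : ∀ r → r < ℓ → m ≤ fst r → r ≡ q
    corner r r<ℓ l = trans (sym (pair-fs r)) (cong₂ ⟪_,_⟫ (≤-antisym (≤-trans (m≤m+n _ _) sum≤) l) (n≤0⇒n≡0 (+-cancelˡ-≤ (fst r) _ _ (≤-trans sum≤ (≤-trans l (≤-reflexive (sym (+-identityʳ _))))))))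
      where
      sum≤ : fst r + snd r ≤ m
      sum≤ = ≮⇒≥ λ k → <-irrefl refl (<-trans r<ℓ (subst (ℓ <_) (pair-fs r) (pair-sum< (subst (_< fst r + snd r) (sym sum≡) k))))

    module _ (b : Bool) where
      h : ℕ → Bool
      h p = if p ≡ᵇ q then b else C p

      h-else : ∀ p → ¬ (p ≡ q) → h p ≡ C p
      h-else p k with p ≡ᵇ q in e
      ... | true = ⊥-elim (k (eq-sound _ _ e))
      ... | false = refl

      h-q : h q ≡ b
      h-q rewrite eq-refl q = refl

      h-col : ∀ p → fst p < m → h p ≡ C p
      h-col p l = h-else p λ e → <-irrefl (trans (cong fst e) fq) l

      -- The stage `t` of an explanation is at least `q`, and its position `⟪ dbl j , t ⟫` is at
      -- least `t + t`, hence at least `ℓ`. It is not yet visible at a stage up to `ℓ`.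
      early : ∀ {j s p t} → s ≤ ℓ → q ≤ p → Explains h (candidate h) j s p t → ⊥
      early {j} {s} {p} {t} s≤ q≤p H = <-irrefl refl (<-≤-trans (Explains.pos< H) (≤-trans s≤ (≤-trans ℓ≤2q (≤-trans (+-mono-≤ q≤t q≤t) (≤-trans (+-monoˡ-≤ t (≤-trans (m≤n+m t (dbl j)) (x≤pair _ 0))) (≤-reflexive (sym (pair-shift (dbl j) t))))))))
        where
        q≤t : q ≤ t
        q≤t = ≤-trans q≤p (<⇒≤ (subst (_< t) (Explains.lenp H) (candidate-len h j t (Explains.c H) (Explains.act H))))

      not-early : ∀ s → s ≤ ℓ → enters h (candidate h) q s ≡ true → ⊥
      not-early s l E with enters-view h (candidate h) q s E
      ... | byFollow p _ ex< q<p _ = early l (<⇒≤ q<p) (explanation-explains h (candidate h) s p ex<)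
      ... | byW _ _ t _ ht = early l ≤-refl (explains-sound h (candidate h) (owner q) s q t ht)
      ... | byT e _ _ _ with trans (sym e) (trans (cong par fq) (par-sdbl (suc (i + M))))
      ...   | ()

      good : Good i (str h ℓ)
      good = good-str h ℓ (fst-pair a d) (≤-trans M≤q (<⇒≤ q<ℓ)) (λ p _ l → h-col p (≤-<-trans l a<m))
        (λ p l → h-else p λ e → <-irrefl refl (<-≤-trans (<-trans ≤-refl l) (subst (M ≤_) (sym e) M≤q)))
        λ r r<ℓ _ s s≤ E → closed r r<ℓ s s≤ E (r ≟ q)
        where
        closed : ∀ r → r < ℓ → ∀ s → s ≤ ℓ → enters h (candidate h) r s ≡ true → Dec (r ≡ q) → h r ≡ true
        closed r r<ℓ s s≤ E (yes refl) = ⊥-elim (not-early s s≤ E)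
        closed r r<ℓ s s≤ E (no k) = trans (h-else r k) (C-in r s (trans (sym (enters-cong h C (candidate h) n r s (λ p _ l → h-col p (<-trans l r<m))
            λ j t _ j≤ → candidate-cong h C j t λ p _ l → h-col p (<-trans (<-≤-trans l j≤) r<m))) E))
          where
          r<m : fst r < m
          r<m = ≰⇒> λ l → k (corner r r<ℓ l)

      -- A single oracle query at `q` is a certificate for the value `b`, and `agrees` equates it
      -- with `C q`, whichever `b` was chosen.
      value : b2n b ≡ χ C q
      value = agrees good (mkProof (s≤s z≤n) (CS.V-cons {L = 0} just-ok λ k p → ⊥-elim (<-irrefl (sym (drop0 k)) p)) (trans (hd-cons u 0) (cong (λ e → fact e q (b2n b)) (sym (fst-pair _ _)))))
        where
        u = fact (ix Oracle) q (b2n b)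
        lt2 : ∀ b → (b2n b <ᵇ 2) ≡ true
        lt2 true = refl
        lt2 false = refl
        tag : fst (fe u) ≡ 5
        tag = trans (cong fst (fe-fact _ _ _)) (fst-pair 5 0)
        just-ok : CS.just (str h ℓ) u 0 ≡ true
        just-ok = subst (λ t → byTag (strOracle (str h ℓ) (fx u)) (fe u) (fx u) (fy u) 0 t ≡ true) (sym tag)
          (subst₂ (λ x y → ((y <ᵇ 2) ∧ (strOracle (str h ℓ) x ≡ᵇ y)) ≡ true) (sym (fx-fact (ix Oracle) q (b2n b))) (sym (fy-fact (ix Oracle) q (b2n b)))
            (∧-i (lt2 b) (eq-complete (trans (strOracle-str h ℓ q q<ℓ) (cong b2n h-q)))))

    absurd : ⊥
    absurd with trans (value true) (sym (value false))
    ... | ()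

-- Existence of `C` and the indices of its columns

enumerates : ℕ → ℕ → Bool
enumerates q ρ = enters (bit ρ) (candidate (bit ρ)) q (len ρ)

cenumerates : CpB2 enumerates
cenumerates = centers {λ e → bit (snd e)} {λ e → candidate (bit (snd e))} (cbit (cr cv0) cv1) (ccandidate {λ e → bit (snd e)} (cbit (cr cv0) cv1)) cv0 (cl cv1)

enumerates-str : ∀ h h′ q s → (∀ p → fst p < fst q → h p ≡ h′ p) → enumerates q (str h s) ≡ enters h′ (candidate h′) q s
enumerates-str h h′ q s a = trans (cong (enters (bit ρ) (candidate (bit ρ)) q) (len-str h s)) (enters-cong (bit ρ) h′ (candidate (bit ρ)) (candidate h′) q s (λ p l k → trans (bit-str h s p l) (a p k))
  λ j t t≤ j≤ → candidate-cong (bit ρ) h′ j t λ p l k → trans (bit-str h s p (<-≤-trans l t≤)) (a p (<-≤-trans k j≤)))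
  where ρ = str h s

module Build (lem : (P : Set) → Dec P) where

  Enum : (ℕ → Bool) → ℕ → Set
  Enum Z q = Σ ℕ λ s → enumerates q (str Z s) ≡ true

  -- Sets are Boolean-valued, so `lem` has to decide membership in each c.e. column. Going column by
  -- column, every question refers to columns already fixed.
  upTo : ℕ → ℕ → Bool
  upTo zero q = false
  upTo (suc m) q = if fst q ≡ᵇ m then does (lem (Enum (upTo m) q)) else upTo m q

  C : ℕ → Bool
  C q = upTo (suc (fst q)) q

  C-def : ∀ q → C q ≡ does (lem (Enum (upTo (fst q)) q))
  C-def q rewrite eq-refl (fst q) = refl

  upTo-below : ∀ m q → upTo m q ≡ below C m q
  upTo-below zero q with fst q
  ... | zero = refl
  ... | suc _ = refl
  upTo-below (suc m) q = trans (lemma (fst q ≡ᵇ m) refl) (sym (below-suc C m q))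
    where
    lemma : ∀ b → (fst q ≡ᵇ m) ≡ b → upTo (suc m) q ≡ (if fst q ≡ᵇ m then C ⟪ m , snd q ⟫ else below C m q)
    lemma true e rewrite e = trans (lemma₂ (eq-sound _ _ e)) (cong C (trans (sym (pair-fs q)) (cong (λ k → ⟪ k , snd q ⟫) (eq-sound _ _ e))))
      where
      lemma₂ : ∀ {m} → fst q ≡ m → does (lem (Enum (upTo m) q)) ≡ C q
      lemma₂ refl = sym (C-def q)
    lemma false e rewrite e = upTo-below m q

  upTo-C : ∀ q p → fst p < fst q → upTo (fst q) p ≡ C p
  upTo-C q p l = trans (upTo-below (fst q) p) (below-here C (fst q) p l)

  does-true : ∀ {P : Set} (d : Dec P) → does d ≡ true → P
  does-true (yes p) _ = p

  true-does : ∀ {P : Set} (d : Dec P) → P → does d ≡ true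
  true-does (yes _) _ = refl
  true-does (no k) p = ⊥-elim (k p)

  C-out : ∀ q → C q ≡ true → Σ ℕ λ s → enters C (candidate C) q s ≡ true
  C-out q e = go (does-true (lem (Enum (upTo (fst q)) q)) (trans (sym (C-def q)) e))
    where
    go : Enum (upTo (fst q)) q → Σ ℕ λ s → enters C (candidate C) q s ≡ true
    go (s , E) = s , trans (sym (enumerates-str (upTo (fst q)) C q s (upTo-C q))) E

  C-in : ∀ q s → enters C (candidate C) q s ≡ true → C q ≡ true
  C-in q s E = trans (C-def q) (true-does (lem (Enum (upTo (fst q)) q)) (s , trans (enumerates-str (upTo (fst q)) C q s (upTo-C q)) E))

  columnsBelow≡ : ∀ m p → fst p < m → columnsBelow C m p ≡ C p
  columnsBelow≡ m p l = trans (cong (λ k → if k <ᵇ m then C p else false) (cong proj₁ (unpair-def p))) (cong (λ b → if b then C p else false) (lt-complete l))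

  search : OCp λ X w → b2n (not (enumerates (fst w) (str X (snd w))))
  search = oext (λ X w → cong₂ (λ a b → b2n (not (enumerates a b))) (fst-pair _ _) (snd-pair _ _)) (occ (cnot cenumerates) (opr (olift cv0) (ostr cv1)))

  progC : ℕ → Code
  progC m = Comp (Mu (ocode search)) (Pair (code (ck m)) Id)

  -- This takes the place of the s-m-n theorem: the index of the constant program is computed from
  -- the constant.
  ix-const : ∀ m → natrec (ix Zero) (λ _ r → ⟪ 6 , ⟪ ix Succ , r ⟫ ⟫) m ≡ ix (code (ck m))
  ix-const zero = refl
  ix-const (suc m) = cong (λ r → ⟪ 6 , ⟪ ix Succ , r ⟫ ⟫) (ix-const m)

  ixC : ℕ → ℕ
  ixC m = ix (progC m)

  cixC : Cp ixC
  cixC = cext (λ m → cong (λ r → ⟪ 6 , ⟪ ix (Mu (ocode search)) , ⟪ 7 , ⟪ r , ix Id ⟫ ⟫ ⟫ ⟫) (ix-const m))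
    (cpr (ck 6) (cpr (ck (ix (Mu (ocode search)))) (cpr (ck 7) (cpr (crec {g = λ _ _ r → ⟪ 6 , ⟪ ix Succ , r ⟫ ⟫} (ck (ix Zero)) (cpr (ck 6) (cpr (ck (ix Succ)) cv1)) cid) (ck (ix Id))))))

  search-val : ∀ X q s → b2n (not (enumerates (fst (pair q s)) (str X (snd (pair q s))))) ≡ b2n (not (enumerates q (str X s)))
  search-val X q s rewrite sym (⟪⟫-def q s) | fst-pair q s | snd-pair q s = refl

  halts : ∀ X q → Enum X q → Σ ℕ λ v → Eval X (Mu (ocode search)) q v
  halts X q (s , E) = go (least (suc s) P) (least-spec (suc s) P)
    where
    P : ℕ → Bool
    P k = enumerates q (str X k)
    go : ∀ r → Least (suc s) P r → Σ ℕ λ v → Eval X (Mu (ocode search)) q v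
    go r (none _ hi) = clash E (hi s ≤-refl)
    go r (found _ Pr lo) = r , emu (subst (Eval X _ _) (trans (search-val X q r) (cong (λ b → b2n (not b)) Pr)) (orun search X _))
      λ k l → 0 , subst (Eval X _ _) (trans (search-val X q k) (cong (λ b → b2n (not b)) (lo k l))) (orun search X _)

  halts⁻¹ : ∀ X q v → Eval X (Mu (ocode search)) q v → Enum X q
  halts⁻¹ X q v (emu e _) = v , tt (enumerates q (str X v)) (trans (sym (search-val X q v)) (det (orun search X _) e))
    where
    tt : ∀ b → b2n (not b) ≡ 0 → b ≡ true
    tt true _ = refl

  runs : ∀ X m y → Eval X (Pair (code (ck m)) Id) y (pair m y)
  runs X m y = epair (run (ck m) X y) eid

  rea : REAω C
  rea = ixC , computable cixC , λ m y →
    (λ e → let r = C-out (pair m y) e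
               h = halts (columnsBelow C m) (pair m y) (proj₁ r , trans (enumerates-str (columnsBelow C m) C (pair m y) (proj₁ r) (agree m y)) (proj₂ r))
           in proj₁ h , subst (λ d → Eval (columnsBelow C m) d y (proj₁ h)) (sym (decode-ix (progC m))) (ecomp (runs _ m y) (proj₂ h))) ,
    λ { (v , e) → back m y v (subst (λ d → Eval (columnsBelow C m) d y v) (decode-ix (progC m)) e) }
    where
    fstp : ∀ m y → fst (pair m y) ≡ m
    fstp m y = trans (cong fst (sym (⟪⟫-def m y))) (fst-pair m y)
    agree : ∀ m y p → fst p < fst (pair m y) → columnsBelow C m p ≡ C p
    agree m y p l = columnsBelow≡ m p (subst (fst p <_) (fstp m y) l)
    back : ∀ m y v → Eval (columnsBelow C m) (progC m) y v → C (pair m y) ≡ true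
    back m y v (ecomp {y = w} a b) = fin (halts⁻¹ (columnsBelow C m) (pair m y) v (subst (λ z → Eval (columnsBelow C m) (Mu (ocode search)) z v) (det a (runs _ m y)) b))
      where
      fin : Enum (columnsBelow C m) (pair m y) → C (pair m y) ≡ true
      fin (s , E) = C-in (pair m y) s (trans (sym (enumerates-str (columnsBelow C m) C (pair m y) s (agree m y))) E)

theorem1p2 : ((P : Set) → Dec P) →
    (K : ℕ → Bool) → IsHaltingSet K →
    Σ (ℕ → Bool) λ C → REAω C × ¬ Computable C ×
    ((B : ℕ → Bool) → B ≤T C → B ≤T K → Computable B)
theorem1p2 lem K isK = C , rea , NotComputable.absurd , λ { B (e , hC) (i , hK) → Compute.computableB ⟪ e , i ⟫ B
    (λ x → subst (λ d → Eval C (decode d) x (χ B x)) (sym (fst-pair e i)) (hC x))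
    (λ x → subst (λ d → Eval K (decode d) x (χ B x)) (sym (snd-pair e i)) (hK x)) }
  where
  open Build lem
  open Final lem K isK C C-out C-in
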